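{- The set $\mathcal O=\mathcal Q\cup S_\gamma^G$ is a $(q+1)$-ovoid of $\mathcal W(5,q)$, i.e. every generator (totally isotropic plane) of $\mathcal W(5,q)$ contains exactly $q+1$ points of $\mathcal O$. It has $(q+1)(q^3+1)$ points.
   Context: Let $q$ be an even prime power and $\mathrm{PG}(5,q^2)$ have homogeneous coordinates $(X_1,\dots,X_6)$, points written as column vectors. Let $\Sigma$ be the set of points having a coordinate vector $(\alpha,\alpha^q,\delta_0,\beta,\beta^q,\delta_1)$ with $\alpha,\beta\in\mathbb F_{q^2}$, $\delta_0,\delta_1\in\mathbb F_q$ (a Baer subgeometry $\cong\mathrm{PG}(5,q)$). Let $\mathcal Q=\Sigma\cap\{X_6=0,\ X_3^2+X_1X_5+X_2X_4=0\}=\{(\alpha,\alpha^q,\sqrt{\alpha\beta^q+\alpha^q\beta},\beta,\beta^q,0):(\alpha,\beta)\ne(0,0)\}$. Fix $\omega\in\mathbb F_{q^2}\setminus\mathbb F_q$ with $\omega+\omega^q=1$ and let $h(X,Y)=\omega X_1Y_4^q+\omega^qX_1Y_6^q+\omega^qX_2Y_5^q+\omega X_2Y_6^q+X_3Y_6^q+\omega^qX_4Y_1^q+\omega X_5Y_2^q+\omega X_6Y_1^q+\omega^qX_6Y_2^q+X_6Y_3^q$. Restricted to $\Sigma$, $P\perp R\iff h(P,R)=0$ defines a symplectic polarity $\perp$ of $\Sigma\cong\mathrm{PG}(5,q)$; $\mathcal W(5,q)$ is the associated symplectic polar space. For $a,b,c,d\in\mathbb F_{q^2}$ with $ad+bc=1$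 let $M_{a,b,c,d}$ be the $6\times6$ matrix with rows $(a^2,0,0,0,c^2,\tfrac{c(a+c\omega^q)}{\omega})$, $(0,a^{2q},0,c^{2q},0,\tfrac{c^q(a^q+c^q\omega)}{\omega^q})$, $(ab,a^qb^q,1,c^qd^q,cd,\tfrac{d(a+c\omega^q)}{\omega}+\tfrac{d^q(a^q+c^q\omega)}{\omega^q}+\tfrac{1}{\omega^{q+1}})$, $(0,b^{2q},0,d^{2q},0,\tfrac{d^q(b^q+d^q\omega)+\omega}{\omega^q})$, $(b^2,0,0,0,d^2,\tfrac{d(b+d\omega^q)+\omega^q}{\omega})$, $(0,0,0,0,0,1)$, and let $G\cong\mathrm{PSL}(2,q^2)$ be the group of projectivities $X\mapsto M_{a,b,c,d}X$. Fix $\gamma\in\mathbb F_{q^2}$ with $X^2+X+\gamma$ irreducible over $\mathbb F_{q^2}$, let $S_\gamma=\left(\frac{\gamma}{\omega},\frac{\gamma^q}{\omega^q},\frac{\omega^q\gamma}{\omega}+\frac{\omega\gamma^q}{\omega^q},1,1,1\right)$ and $S_\gamma^G$ its $G$-orbit. An $m$-ovoid of $\mathcal W(5,q)$ is a set of points meeting every generator in exactly $m$ points. -}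

module Defs where

open import Level using (Level; _⊔_) renaming (suc to lsuc)
open import Data.Nat.Base as ℕ using (ℕ; zero; suc)
open import Data.Nat.Primality using (Prime)
open import Data.Fin.Base using (Fin)
import Data.Fin.Properties as Fin
open import Data.Fin.Patterns using (0F; 1F; 2F; 3F; 4F; 5F)
open import Data.List.Base as List using (List)
open import Data.Vec.Functional using (Vector; []; _∷_)
open import Data.Product.Base using (∃-syntax; _×_; _,_; proj₁)
open import Function.Bundles using (Inverse)
open import Relation.Nullary using (¬_; Dec; yes; no; contradiction)
open import Relation.Unary using (Pred; _∈_; _⊆_; _∪_; _∩_)
open import Relation.Binary.Bundles using (Setoid)
open import Relation.Binary.PropositionalEquality as ≡ using (_≡_)
import Relation.Binary.Construct.On as On
import Relation.Binary.Reasoning.Setoid as SetoidReasoning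
open import Algebra.Bundles using (CommutativeRing; Semiring)
open import Algebra.Bundles.Raw using (RawSemiring)
import Algebra.Definitions.RawSemiring as SemiringDefs
import Algebra.Properties.Ring as RingProperties
open import Algebra.Apartness.Bundles using (HeytingField; HeytingCommutativeRing)

IsPrimePower : ℕ → Set
IsPrimePower q = ∃[ p ] ∃[ e ] Prime p × 1 ℕ.≤ e × q ≡ p ℕ.^ e

module _ {a ℓ : Level} (S : Setoid a ℓ) where
  open Setoid S using (Carrier)

  subsetoid : ∀ {p} → Pred Carrier p → Setoid (a ⊔ p) ℓ
  subsetoid P = On.setoid S (proj₁ {B = P})

  HasCardinality : ∀ {p} → Pred Carrier p → ℕ → Set (a ⊔ ℓ ⊔ p)
  HasCardinality P n = Inverse (subsetoid P) (≡.setoid (Fin n))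

-- Univariate polynomials: lists of coefficients, constant term first,
-- compared coefficientwise so that trailing zeros do not matter.
module Polynomial {c ℓ : Level} (R : CommutativeRing c ℓ) where
  open CommutativeRing R

  Poly : Set c
  Poly = List Carrier

  coeff : Poly → ℕ → Carrier
  coeff List.[]      _       = 0#
  coeff (a List.∷ f) zero    = a
  coeff (a List.∷ f) (suc n) = coeff f n

  infix  4 _≈ₚ_
  infixl 6 _+ₚ_
  infixl 7 _*ₚ_

  _≈ₚ_ : Poly → Poly → Set ℓ
  f ≈ₚ g = ∀ n → coeff f n ≈ coeff g n

  _+ₚ_ : Poly → Poly → Poly
  List.[]      +ₚ g            = g
  (a List.∷ f) +ₚ List.[]      = a List.∷ f
  (a List.∷ f) +ₚ (b List.∷ g) = (a + b) List.∷ (f +ₚ g)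

  _*ₚ_ : Poly → Poly → Poly
  List.[]      *ₚ g = List.[]
  (a List.∷ f) *ₚ g = List.map (a *_) g +ₚ (0# List.∷ (f *ₚ g))

  polySemiring : RawSemiring c ℓ
  polySemiring = record
    { Carrier = Poly
    ; _≈_     = _≈ₚ_
    ; _+_     = _+ₚ_
    ; _*_     = _*ₚ_
    ; 0#      = List.[]
    ; 1#      = 1# List.∷ List.[]
    }

  open SemiringDefs polySemiring public using (Irreducible)

record FiniteField (c ℓ₁ ℓ₂ : Level) (n : ℕ) : Set (lsuc (c ⊔ ℓ₁ ⊔ ℓ₂)) where
  field
    heytingField : HeytingField c ℓ₁ ℓ₂

  open HeytingField heytingField public
    using (_#_; #-irrefl; #⇒invertible; invertible⇒#; tight; heytingCommutativeRing)

  commutativeRing : CommutativeRing c ℓ₁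
  commutativeRing = HeytingCommutativeRing.commutativeRing heytingCommutativeRing

  open CommutativeRing commutativeRing public
  open Semiring semiring public using (rawSemiring)

  field
    enumeration : Inverse setoid (≡.setoid (Fin n))

  open Inverse enumeration public using ()
    renaming (to to index; from to element; to-cong to index-cong; strictlyInverseʳ to element-index)

  open SemiringDefs rawSemiring public using (_^_; sum)

  infix 4 _≟_
  _≟_ : ∀ x y → Dec (x ≈ y)
  x ≟ y with index x Fin.≟ index y
  ... | yes eq = yes (trans (sym (element-index x))
                        (trans (reflexive (≡.cong element eq)) (element-index y)))
  ... | no neq = no λ eq → neq (index-cong eq)

  inverse? : ∀ x → Dec (∃[ i ] x * element i ≈ 1#)
  inverse? x = Fin.any? λ i → x * element i ≟ 1#

  -- Total inverse, with the junk value 0# at 0#; see *-inverseʳ.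
  infix 9 _⁻¹
  _⁻¹ : Carrier → Carrier
  x ⁻¹ with inverse? x
  ... | yes (i , _) = element i
  ... | no _        = 0#

  infixl 7 _÷_
  _÷_ : Carrier → Carrier → Carrier
  x ÷ y = x * y ⁻¹

  private
    x-0≈x : ∀ x → x - 0# ≈ x
    x-0≈x x = trans (+-congˡ (RingProperties.-0#≈0# ring)) (+-identityʳ x)

  1≉0 : 1# ≉ 0#
  1≉0 eq = #-irrefl eq (invertible⇒#
    (1# , trans (*-identityˡ _) (x-0≈x 1#) , trans (*-identityʳ _) (x-0≈x 1#)))

  *-inverseʳ : ∀ {x} → x ≉ 0# → x * x ⁻¹ ≈ 1#
  *-inverseʳ {x} x≉0 with inverse? x
  ... | yes (_ , eq) = eq
  ... | no none      = contradiction (proj₁ (tight x 0#) not-apart) x≉0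
    where
    not-apart : ¬ (x # 0#)
    not-apart x#0 with #⇒invertible x#0
    ... | (y , _ , eq) = none (index y ,
      trans (*-congˡ (element-index y)) (trans (*-congʳ (sym (x-0≈x x))) eq))

  *-≉0 : ∀ {x y} → x ≉ 0# → y ≉ 0# → x * y ≉ 0#
  *-≉0 {x} {y} x≉0 y≉0 xy≈0 = y≉0 (begin
    y                 ≈⟨ *-identityˡ y ⟨
    1# * y            ≈⟨ *-congʳ (*-inverseʳ x≉0) ⟨
    x * x ⁻¹ * y      ≈⟨ *-congʳ (*-comm x (x ⁻¹)) ⟩
    x ⁻¹ * x * y      ≈⟨ *-assoc (x ⁻¹) x y ⟩
    x ⁻¹ * (x * y)    ≈⟨ *-congˡ xy≈0 ⟩
    x ⁻¹ * 0#         ≈⟨ zeroʳ (x ⁻¹) ⟩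
    0#                ∎)
    where open SetoidReasoning setoid

  ⁻¹-≉0 : ∀ {x} → x ≉ 0# → x ⁻¹ ≉ 0#
  ⁻¹-≉0 {x} x≉0 eq = 1≉0
    (trans (sym (*-inverseʳ x≉0)) (trans (*-congˡ eq) (zeroʳ x)))

module Geometry {c ℓ₁ ℓ₂ : Level} (q : ℕ) (K : FiniteField c ℓ₁ ℓ₂ (q ℕ.^ 2)) where
  open FiniteField K
  open Polynomial commutativeRing public using (Irreducible)

  -- The subfield of order q.
  𝔽q : Pred Carrier ℓ₁
  𝔽q x = x ^ q ≈ x

  -- Coordinates are numbered from 0F, so X i with i = 0F, …, 5F is X₁, …, X₆.
  Coords : Set c
  Coords = Vector Carrier 6

  -- Proportionality: equality of projective points, in terms of coordinates.
  infix 4 _∼_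
  _∼_ : Coords → Coords → Set (c ⊔ ℓ₁)
  u ∼ v = ∃[ k ] k ≉ 0# × ∀ i → u i ≈ k * v i

  record Point : Set (c ⊔ ℓ₁) where
    field
      coords  : Coords
      nonzero : ∃[ i ] coords i ≉ 0#

  open Point public

  pointSetoid : Setoid (c ⊔ ℓ₁) (c ⊔ ℓ₁)
  pointSetoid = record
    { Carrier = Point
    ; _≈_ = λ P R → coords P ∼ coords R
    ; isEquivalence = record
      { refl  = 1# , 1≉0 , λ i → sym (*-identityˡ _)
      ; sym   = λ {P} {R} → ∼-sym (coords P) (coords R)
      ; trans = λ (k , k≉0 , f) (l , l≉0 , g) →
          k * l , *-≉0 k≉0 l≉0 ,
          λ i → trans (f i) (trans (*-congˡ (g i)) (sym (*-assoc k l _)))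
      }
    }
    where
    ∼-sym : ∀ u v → u ∼ v → v ∼ u
    ∼-sym u v (k , k≉0 , f) = k ⁻¹ , ⁻¹-≉0 k≉0 , λ i → begin
      v i                ≈⟨ *-identityˡ (v i) ⟨
      1# * v i           ≈⟨ *-congʳ (trans (*-comm (k ⁻¹) k) (*-inverseʳ k≉0)) ⟨
      k ⁻¹ * k * v i     ≈⟨ *-assoc (k ⁻¹) k (v i) ⟩
      k ⁻¹ * (k * v i)   ≈⟨ *-congˡ (f i) ⟨
      k ⁻¹ * u i         ∎
      where open SetoidReasoning setoid

  PointSet : Set (lsuc (c ⊔ ℓ₁))
  PointSet = Pred Point (c ⊔ ℓ₁)

  Size : PointSet → ℕ → Set (c ⊔ ℓ₁)
  Size = HasCardinality pointSetoid

  -- The 𝔽q-vector space of coordinate vectors underlying the Baer subgeometry.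
  BaerVector : Pred Coords (c ⊔ ℓ₁)
  BaerVector v = ∃[ α ] ∃[ β ] ∃[ δ₀ ] ∃[ δ₁ ] δ₀ ∈ 𝔽q × δ₁ ∈ 𝔽q ×
    ∀ i → v i ≈ (α ∷ α ^ q ∷ δ₀ ∷ β ∷ β ^ q ∷ δ₁ ∷ []) i

  Baer : PointSet
  Baer P = ∃[ v ] v ∈ BaerVector × coords P ∼ v

  combination : ∀ {r} → Vector Carrier r → Vector Coords r → Coords
  combination t v j = sum λ i → t i * v i j

  -- A plane of the subgeometry Baer ≅ PG(5,q), i.e. the set of points given by
  -- a 3-dimensional 𝔽q-subspace of BaerVector.
  record Plane : Set (c ⊔ ℓ₁) where
    field
      basis       : Vector Coords 3
      inBaer      : ∀ i → basis i ∈ BaerVector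
      independent : ∀ t → (∀ i → t i ∈ 𝔽q) →
                    (∀ j → combination t basis j ≈ 0#) → ∀ i → t i ≈ 0#

  pointsOf : Plane → PointSet
  pointsOf π P = ∃[ t ] (∀ i → t i ∈ 𝔽q) × coords P ∼ combination t (Plane.basis π)

  𝒬 : PointSet
  𝒬 P = P ∈ Baer × X 5F ≈ 0# × X 2F ^ 2 + X 0F * X 4F + X 1F * X 3F ≈ 0#
    where X = coords P

  Matrix : Set c
  Matrix = Vector Coords 6

  infixr 7 _·_
  _·_ : Matrix → Coords → Coords
  (M · v) i = sum λ j → M i j * v j

  module Form (ω : Carrier) where

    ω̄ : Carrier
    ω̄ = ω ^ q

    h : Coords → Coords → Carrier
    h X Y =
        ω * X 0F * Y 3F ^ q + ω̄ * X 0F * Y 5F ^ q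
      + ω̄ * X 1F * Y 4F ^ q + ω * X 1F * Y 5F ^ q
      + X 2F * Y 5F ^ q
      + ω̄ * X 3F * Y 0F ^ q
      + ω * X 4F * Y 1F ^ q
      + ω * X 5F * Y 0F ^ q + ω̄ * X 5F * Y 1F ^ q + X 5F * Y 2F ^ q

    infix 4 _⊥_
    _⊥_ : Point → Point → Set ℓ₁
    P ⊥ R = h (coords P) (coords R) ≈ 0#

    -- The generators of 𝒲(5,q) are the totally isotropic planes, the rank being 3.
    IsGenerator : Plane → Set (c ⊔ ℓ₁)
    IsGenerator π = ∀ P R → P ∈ pointsOf π → R ∈ pointsOf π → P ⊥ R

    IsOvoid : ℕ → PointSet → Set (c ⊔ ℓ₁)
    IsOvoid m S = S ⊆ Baer × (∀ π → IsGenerator π → Size (pointsOf π ∩ S) m)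

    matrix : (a b c d : Carrier) → Matrix
    matrix a b c d =
        (a ^ 2 ∷ 0# ∷ 0# ∷ 0# ∷ c ^ 2 ∷ c * (a + c * ω̄) ÷ ω ∷ [])
      ∷ (0# ∷ a ^ (2 ℕ.* q) ∷ 0# ∷ c ^ (2 ℕ.* q) ∷ 0# ∷ c ^ q * (a ^ q + c ^ q * ω) ÷ ω̄ ∷ [])
      ∷ (a * b ∷ a ^ q * b ^ q ∷ 1# ∷ c ^ q * d ^ q ∷ c * d
          ∷ d * (a + c * ω̄) ÷ ω + d ^ q * (a ^ q + c ^ q * ω) ÷ ω̄ + 1# ÷ ω ^ suc q ∷ [])
      ∷ (0# ∷ b ^ (2 ℕ.* q) ∷ 0# ∷ d ^ (2 ℕ.* q) ∷ 0# ∷ (d ^ q * (b ^ q + d ^ q * ω) + ω) ÷ ω̄ ∷ [])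
      ∷ (b ^ 2 ∷ 0# ∷ 0# ∷ 0# ∷ d ^ 2 ∷ (d * (b + d * ω̄) + ω̄) ÷ ω ∷ [])
      ∷ (0# ∷ 0# ∷ 0# ∷ 0# ∷ 0# ∷ 1# ∷ [])
      ∷ []

    -- The orbit of the point with coordinate vector S under the group G of all
    -- projectivities X ↦ matrix a b c d · X with a d + b c = 1.
    orbit : Coords → PointSet
    orbit S P = ∃[ a ] ∃[ b ] ∃[ c ] ∃[ d ]
      a * d + b * c ≈ 1# × coords P ∼ matrix a b c d · S

    S : Carrier → Coords
    S γ = γ ÷ ω ∷ γ ^ q ÷ ω̄ ∷ ω̄ * γ ÷ ω + ω * γ ^ q ÷ ω̄ ∷ 1# ∷ 1# ∷ 1# ∷ []

    𝒪 : Carrier → PointSet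
    𝒪 γ = 𝒬 ∪ orbit (S γ)

{-# OPTIONS --safe #-}

-- Over K consider the quadratic form f(a, E, s, d) = a (ω E + ω̄ d) + ω s² + s d + (γ/ω) d²
-- with polar form B. It is elliptic because X² + X + γ is irreducible. On the vectors with
-- d ∈ 𝔽q the 𝔽q-linear map baer : (a, E, s, d) ↦ (a, ā, Tr s + d μ, Ē, E, d) has kernel
-- {(0, 0, s, 0) : s ∈ 𝔽q}, maps onto the Baer vectors, pulls h back to Tr ∘ B, and takes the
-- singular vectors of f exactly to the coordinate vectors of the points of 𝒪.
-- A Baer vector has exactly one lift at which f takes a value in 𝔽q. On a generator these lifts
-- form a 3-dimensional 𝔽q-space on which f is a ternary quadratic form over 𝔽q, and the points
-- of 𝒪 in the generator are its zeros. Some nonsingular vector r is orthogonal to the whole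
-- space. If the polar form of the ternary form is nonzero, r spans its radical: every binary
-- quadratic form over 𝔽q is isotropic over K, so a singular r would give a line on the elliptic
-- quadric. If it is zero, any nonsingular r will do, and one exists because singular orthogonal
-- vectors are proportional over K, which is only 2-dimensional over 𝔽q. Each of the q + 1 lines
-- of the plane through r contains exactly one zero.

module Submission where

open import Defs
open import Level using (Level; _⊔_)
open import Data.Bool.Base using (Bool; true; false; if_then_else_)
import Data.Bool.Properties as Bool
open import Data.Fin.Base as Fin using (Fin; zero; suc)
open import Data.Fin.Patterns using (0F; 1F; 2F; 3F; 4F; 5F; 6F; 7F; 8F)
open import Data.Fin.Permutation as Perm using (Permutation; permutation)
import Data.Fin.Properties as Fin
open import Data.List.Base as List using ([]; _∷_)
open import Data.Maybe.Base using (Maybe; just; nothing)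
open import Data.Nat.Base as ℕ using (ℕ; zero; suc)
open import Data.Nat.Divisibility as ∣ using (_∣_)
import Data.Nat.Primality as Prime
import Data.Nat.Properties as ℕ
import Data.Nat.Solver as ℕSolver
open import Data.Product.Base using (∃; ∃-syntax; _×_; _,_; proj₁; proj₂)
open import Data.Product.Function.NonDependent.Propositional using (_×-↔_)
open import Data.Sum.Base using (_⊎_; inj₁; inj₂; [_,_]′)
open import Data.Sum.Function.Propositional using (_⊎-↔_)
open import Data.Unit.Base using (⊤; tt)
open import Data.Vec.Base using (Vec; []; _∷_)
open import Data.Vec.Functional as Vector using (Vector)
open import Data.Vec.Relation.Binary.Pointwise.Inductive as Pointwise using (Pointwise; []; _∷_)
open import Function.Base using (_∘_; case_of_)
open import Function.Bundles using (Inverse; _↔_)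
open import Function.Properties.Inverse using (↔-sym; ↔-trans)
open import Relation.Binary.Bundles using (Setoid)
open import Relation.Binary.Definitions using (tri<; tri≈; tri>)
open import Relation.Binary.PropositionalEquality as ≡ using (_≡_; _≢_)
import Relation.Binary.Reasoning.Setoid as SetoidReasoning
open import Relation.Nullary using (¬_; Dec; yes; no; contradiction; ¬?)
open import Relation.Unary using (Pred; Decidable; _∈_; _⊆_; _∩_)
open import Algebra.Bundles using (CommutativeRing; CommutativeMonoid; RawRing)
open import Algebra.Definitions.RawMagma using (_∣ʳ_)
import Algebra.Definitions.RawSemiring as SemiringDefs
import Algebra.Properties.CommutativeMonoid.Sum as MonoidSum
import Algebra.Properties.CommutativeSemigroup as CommutativeSemigroup
import Algebra.Properties.CommutativeSemiring.Exp as CommutativeExp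
import Algebra.Properties.Group as GroupProperties
import Algebra.Properties.Ring as RingProperties
import Algebra.Properties.Semiring.Exp as Exp
import Algebra.Properties.Semiring.Mult as Mult
import Algebra.Solver.Ring as RingSolver
open import Algebra.Solver.Ring.AlmostCommutativeRing
  using (fromCommutativeRing; _-Raw-AlmostCommutative⟶_)

-- The vectors with d ∈ 𝔽q form a 7-dimensional space over 𝔽q, one dimension more than the Baer
-- vectors, and the radical of Tr ∘ B on it is exactly the kernel of `baer`. The obstacle is that f
-- is not constant on the fibres of `baer`. Adding (0, 0, σ, 0) with σ ∈ 𝔽q changes f by ω σ² + σ d;
-- since Tr ω = 1, this adds σ² to the trace of f. Squaring permutes 𝔽q, so exactly one vector of
-- each fibre has Tr f = 0, that is, f ∈ 𝔽q. Above a totally isotropic subspace Tr ∘ B vanishes, so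
-- Tr ∘ f is additive there and these normalised lifts form a subspace. A singular vector is always
-- normalised, so whether a point belongs to 𝒪 can be read off from the normalised lift of a
-- coordinate vector. The size comes from the same picture. The quadric of f has q⁴ + 1 points over
-- K. Each of the q² + 1 points with d = 0 gives q + 1 points of 𝒪, one for each class of nonzero
-- scalars modulo 𝔽q, and each of the other q⁴ - q² points gives one, because d can be scaled to 1.

module _ {a ℓ p : Level} (S : Setoid a ℓ) (P : Pred (Setoid.Carrier S) p) where
  open Setoid S

  -- An arbitrary index type `I` is allowed so that each count can be read off from a
  -- parametrisation by sums and products of simpler types.
  hasCardinality-↔ : ∀ {i n} {I : Set i} → I ↔ Fin n →
    (f : I → Carrier) → (∀ i → f i ∈ P) → (∀ i j → f i ≈ f j → i ≡ j) →
    (∀ x → x ∈ P → ∃ λ i → x ≈ f i) → HasCardinality S P n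
  hasCardinality-↔ I↔n f f∈P f-injective f-surjective = record
    { to        = λ (x , x∈P) → I.to (code x x∈P)
    ; from      = λ i → f (I.from i) , f∈P (I.from i)
    ; to-cong   = λ {(x , x∈P)} {(y , y∈P)} x≈y → ≡.cong I.to (f-injective _ _
        (trans (sym (code-≈ x x∈P)) (trans x≈y (code-≈ y y∈P))))
    ; from-cong = λ i≡j → reflexive (≡.cong (f ∘ I.from) i≡j)
    ; inverse   =
        (λ {i} {(y , y∈P)} y≈fi → ≡.trans
          (≡.cong I.to (f-injective _ _ (trans (sym (code-≈ y y∈P)) y≈fi)))
          (I.strictlyInverseˡ i)) ,
        (λ {(x , x∈P)} {i} i≡ → trans
          (reflexive (≡.cong f (≡.trans (≡.cong I.from i≡) (I.strictlyInverseʳ _))))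
          (sym (code-≈ x x∈P)))
    }
    where
    module I = Inverse I↔n
    code = λ x x∈P → proj₁ (f-surjective x x∈P)
    code-≈ = λ x x∈P → proj₂ (f-surjective x x∈P)

  module FromCardinality {n} (card : HasCardinality S P n) where
    open Inverse card

    member : Fin n → Carrier
    member i = proj₁ (from i)

    member-∈ : ∀ i → member i ∈ P
    member-∈ i = proj₂ (from i)

    member-injective : ∀ i j → member i ≈ member j → i ≡ j
    member-injective i j eq = ≡.trans (≡.sym (strictlyInverseˡ i))
      (≡.trans (to-cong eq) (strictlyInverseˡ j))

    member-surjective : ∀ x → x ∈ P → ∃ λ i → x ≈ member i
    member-surjective x x∈P = to (x , x∈P) , sym (strictlyInverseʳ (x , x∈P))

cardinality-unique : ∀ {a ℓ p} (S : Setoid a ℓ) (P : Pred (Setoid.Carrier S) p) {m n} →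
  HasCardinality S P m → HasCardinality S P n → m ≡ n
cardinality-unique S P A B = Fin.cantor-schröder-bernstein
  (recode-injective A B _ _) (recode-injective B A _ _)
  where
  open Inverse
  recode-injective : ∀ {m n} (A : HasCardinality S P m) (B : HasCardinality S P n) →
    ∀ i j → to B (from A i) ≡ to B (from A j) → i ≡ j
  recode-injective A B i j eq =
    FromCardinality.member-injective S P A i j
      (S.trans (S.sym (strictlyInverseʳ B (from A i)))
        (S.trans (from-cong B eq) (strictlyInverseʳ B (from A j))))
    where module S = Setoid S

hasCardinality-⇔ : ∀ {a ℓ p₁ p₂} (S : Setoid a ℓ) (P : Pred (Setoid.Carrier S) p₁)
  (Q : Pred (Setoid.Carrier S) p₂) → P ⊆ Q → Q ⊆ P →
  ∀ {n} → HasCardinality S P n → HasCardinality S Q n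
hasCardinality-⇔ S P Q P⊆Q Q⊆P card = hasCardinality-↔ S Q Perm.id member
  (λ i → P⊆Q (member-∈ i)) member-injective (λ x x∈Q → member-surjective x (Q⊆P x∈Q))
  where open FromCardinality S P card

enumerate : ∀ {p n} {P : Pred (Fin n) p} → Decidable P →
  ∃ λ m → ∃ λ (f : Fin m → Fin n) → (∀ i → f i ∈ P) ×
    (∀ i j → f i ≡ f j → i ≡ j) × (∀ k → k ∈ P → ∃ λ i → k ≡ f i)
enumerate {n = zero} P? = 0 , (λ ()) , (λ ()) , (λ ()) , λ ()
enumerate {n = suc n} {P} P? with P? zero | enumerate {P = P ∘ suc} (P? ∘ suc)
... | no ¬P0 | m , f , f∈ , inj , surj =
  m , suc ∘ f , f∈ , (λ i j eq → inj i j (Fin.suc-injective eq)) , λ where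
    zero    P0 → contradiction P0 ¬P0
    (suc k) Pk → proj₁ (surj k Pk) , ≡.cong suc (proj₂ (surj k Pk))
... | yes P0 | m , f , f∈ , inj , surj =
  suc m , g , g∈ , g-inj , g-surj
  where
  g : Fin (suc m) → Fin (suc n)
  g zero    = zero
  g (suc i) = suc (f i)
  g∈ : ∀ i → g i ∈ P
  g∈ zero    = P0
  g∈ (suc i) = f∈ i
  g-inj : ∀ i j → g i ≡ g j → i ≡ j
  g-inj zero    zero    _  = ≡.refl
  g-inj (suc i) (suc j) eq = ≡.cong suc (inj i j (Fin.suc-injective eq))
  g-surj : ∀ k → k ∈ P → ∃ λ i → k ≡ g i
  g-surj zero    _  = zero , ≡.refl
  g-surj (suc k) Pk = suc (proj₁ (surj k Pk)) , ≡.cong suc (proj₂ (surj k Pk))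

-- Pigeonhole: if k were missed, punching it out would embed `Fin (suc n)` into `Fin n`.
injective⇒surjective : ∀ {n} (f : Fin n → Fin n) →
  (∀ i j → f i ≡ f j → i ≡ j) → ∀ k → ∃ λ i → f i ≡ k
injective⇒surjective {suc n} f inj k with Fin.any? (λ i → f i Fin.≟ k)
... | yes p = p
... | no ¬p = contradiction
  (Fin.injective⇒≤ {f = λ i → Fin.punchOut (missed i)}
    (λ {i} {j} eq → inj i j (Fin.punchOut-injective (missed i) (missed j) eq)))
  ℕ.1+n≰n
  where
  missed : ∀ i → k ≢ f i
  missed i eq = ¬p (i , ≡.sym eq)

even-prime-power : ∀ {q} → IsPrimePower q → 2 ∣ q → ∃ λ e → q ≡ 2 ℕ.^ e
even-prime-power (p , e , p-prime , _ , ≡.refl) 2∣ = e , ≡.cong (ℕ._^ e) (p≡2 e 2∣)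
  where
  p≡2 : ∀ e → 2 ∣ p ℕ.^ e → p ≡ 2
  p≡2 zero 2∣1 with () ← ∣.∣1⇒≡1 2∣1
  p≡2 (suc e) 2∣ with Prime.euclidsLemma p (p ℕ.^ e) Prime.prime[2] 2∣
  ... | inj₂ 2∣p^e = p≡2 e 2∣p^e
  ... | inj₁ 2∣p with Prime.prime⇒irreducible p-prime 2∣p
  ...   | inj₂ 2≡p = ≡.sym 2≡p

-- Commutative rings of characteristic two.

module _ {c ℓ} (R : CommutativeRing c ℓ) where
  open CommutativeRing R

  module CharacteristicTwo (1+1≈0 : 1# + 1# ≈ 0#) where

    x+x≈0 : ∀ x → x + x ≈ 0#
    x+x≈0 x = trans (+-cong (sym (*-identityˡ x)) (sym (*-identityˡ x)))
      (trans (sym (distribʳ x 1# 1#)) (trans (*-congʳ 1+1≈0) (zeroˡ x)))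

    x+y≈0⇒x≈y : ∀ {x y} → x + y ≈ 0# → x ≈ y
    x+y≈0⇒x≈y {x} {y} eq = begin
      x              ≈⟨ +-identityʳ x ⟨
      x + 0#         ≈⟨ +-congˡ (x+x≈0 y) ⟨
      x + (y + y)    ≈⟨ +-assoc x y y ⟨
      (x + y) + y    ≈⟨ +-congʳ eq ⟩
      0# + y         ≈⟨ +-identityˡ y ⟩
      y              ∎
      where open SetoidReasoning setoid

    x≈y⇒x+y≈0 : ∀ {x y} → x ≈ y → x + y ≈ 0#
    x≈y⇒x+y≈0 {x} {y} eq = trans (+-congʳ eq) (x+x≈0 y)

    -- Over the coefficients 𝔽₂ the ring solver normalises modulo 2.
    private
      𝔽₂ : RawRing _ _
      𝔽₂ = CommutativeRing.rawRing Bool.xor-∧-commutativeRing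

      ⟦_⟧₂ : Bool → Carrier
      ⟦ b ⟧₂ = if b then 1# else 0#

      𝔽₂⟶R : 𝔽₂ -Raw-AlmostCommutative⟶ fromCommutativeRing R
      𝔽₂⟶R = record
        { ⟦_⟧    = ⟦_⟧₂
        ; +-homo = λ where
            true  true  → sym 1+1≈0
            true  false → sym (+-identityʳ _)
            false _     → sym (+-identityˡ _)
        ; *-homo = λ where
            true  _ → sym (*-identityˡ _)
            false _ → sym (zeroˡ _)
        ; -‿homo = λ where
            true  → x+y≈0⇒x≈y (-‿inverseʳ 1#)
            false → sym (RingProperties.-0#≈0# ring)
        ; 0-homo = refl
        ; 1-homo = refl
        }

      ⟦_⟧₂≟⟦_⟧₂ : ∀ a b → Maybe (⟦ a ⟧₂ ≈ ⟦ b ⟧₂)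
      ⟦ true  ⟧₂≟⟦ true  ⟧₂ = just refl
      ⟦ false ⟧₂≟⟦ false ⟧₂ = just refl
      ⟦ _     ⟧₂≟⟦ _     ⟧₂ = nothing

    open RingSolver 𝔽₂ (fromCommutativeRing R) 𝔽₂⟶R ⟦_⟧₂≟⟦_⟧₂ public
      using (Polynomial; op; con; var; :-_; _:^_; _:+_; _:*_; _:=_; solve; ⟦_⟧; [+]; [*])


-- Finite fields: sums and products over all elements, Fermat's identity, the characteristic.

module _ {a ℓ} (M : CommutativeMonoid a ℓ) where
  open CommutativeMonoid M
  open MonoidSum M using (sum; sum-cong-≋; sum-replicate-zero)

  sum-single : ∀ {n} (f : Vector Carrier n) i → (∀ j → j ≢ i → f j ≈ ε) → sum f ≈ f i
  sum-single {suc n} f zero f≈ε = trans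
    (∙-congˡ (trans (sum-cong-≋ (λ j → f≈ε (suc j) λ ())) (sum-replicate-zero n)))
    (identityʳ _)
  sum-single {suc n} f (suc i) f≈ε = trans
    (∙-cong (f≈ε zero λ ()) (sum-single (f ∘ suc) i λ j j≢i → f≈ε (suc j) (j≢i ∘ Fin.suc-injective)))
    (identityˡ _)

module FiniteFieldProperties {c ℓ₁ ℓ₂ n} (K : FiniteField c ℓ₁ ℓ₂ n) where
  open FiniteField K hiding (zero)
  open SetoidReasoning setoid
  open Exp semiring using (^-congˡ)
  open Mult semiring using (×1-homo-*) renaming (_×_ to _×#_)
  private
    module Σ = MonoidSum +-commutativeMonoid
    module Π = MonoidSum *-commutativeMonoid

  element-injective : ∀ i j → element i ≈ element j → i ≡ j
  element-injective i j eq = ≡.trans (≡.sym (Inverse.strictlyInverseˡ enumeration i))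
    (≡.trans (index-cong eq) (Inverse.strictlyInverseˡ enumeration j))

  *-inverseˡ : ∀ {x} → x ≉ 0# → x ⁻¹ * x ≈ 1#
  *-inverseˡ x≉0 = trans (*-comm _ _) (*-inverseʳ x≉0)

  *-cancelˡ : ∀ {x y z} → x ≉ 0# → x * y ≈ x * z → y ≈ z
  *-cancelˡ {x} {y} {z} x≉0 eq = begin
    y                ≈⟨ *-identityˡ y ⟨
    1# * y           ≈⟨ *-congʳ (*-inverseˡ x≉0) ⟨
    x ⁻¹ * x * y     ≈⟨ *-assoc _ _ _ ⟩
    x ⁻¹ * (x * y)   ≈⟨ *-congˡ eq ⟩
    x ⁻¹ * (x * z)   ≈⟨ *-assoc _ _ _ ⟨
    x ⁻¹ * x * z     ≈⟨ *-congʳ (*-inverseˡ x≉0) ⟩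
    1# * z           ≈⟨ *-identityˡ z ⟩
    z                ∎

  xy≈0⇒x≈0∨y≈0 : ∀ {x y} → x * y ≈ 0# → x ≈ 0# ⊎ y ≈ 0#
  xy≈0⇒x≈0∨y≈0 {x} {y} eq with x ≟ 0#
  ... | yes x≈0 = inj₁ x≈0
  ... | no  x≉0 = inj₂ (*-cancelˡ x≉0 (trans eq (sym (zeroʳ x))))

  x≉0∧xy≈0⇒y≈0 : ∀ {x y} → x ≉ 0# → x * y ≈ 0# → y ≈ 0#
  x≉0∧xy≈0⇒y≈0 {x} x≉0 eq = *-cancelˡ x≉0 (trans eq (sym (zeroʳ x)))

  x*x≈0⇒x≈0 : ∀ {x} → x * x ≈ 0# → x ≈ 0#
  x*x≈0⇒x≈0 eq with xy≈0⇒x≈0∨y≈0 eq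
  ... | inj₁ x≈0 = x≈0
  ... | inj₂ x≈0 = x≈0

  -- Transports a bijection of the field to the indices, so that a sum or product over all elements
  -- can be reindexed along it.
  bijection-permutes : (f g : Carrier → Carrier) →
    (∀ {x y} → x ≈ y → f x ≈ f y) → (∀ {x y} → x ≈ y → g x ≈ g y) →
    (∀ x → f (g x) ≈ x) → (∀ x → g (f x) ≈ x) → Permutation n n
  bijection-permutes f g f-cong g-cong fg gf = permutation
    (index ∘ f ∘ element) (index ∘ g ∘ element)
    (λ i → inverts f g f-cong fg i) (λ i → inverts g f g-cong gf i)
    where
    inverts : ∀ f g → (∀ {x y} → x ≈ y → f x ≈ f y) → (∀ x → f (g x) ≈ x) →
      ∀ i → index (f (element (index (g (element i))))) ≡ i
    inverts f g f-cong fg i = ≡.trans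
      (index-cong (trans (f-cong (element-index _)) (fg _)))
      (Inverse.strictlyInverseˡ enumeration i)

  -- Translation by `1#` permutes the field, so the sum of all elements equals itself plus n times
  -- `1#`.
  n×1≈0 : n ×# 1# ≈ 0#
  n×1≈0 = begin
    n ×# 1#                                        ≈⟨ +-identityˡ _ ⟨
    0# + n ×# 1#                                   ≈⟨ +-congʳ (-‿inverseˡ Σelement) ⟨
    - Σelement + Σelement + n ×# 1#                ≈⟨ +-assoc _ _ _ ⟩
    - Σelement + (Σelement + n ×# 1#)              ≈⟨ +-congˡ (+-congˡ (Σ.sum-replicate n)) ⟨
    - Σelement + (Σelement + Σ.sum (λ (_ : Fin n) → 1#))
      ≈⟨ +-congˡ (Σ.∑-distrib-+ element (λ _ → 1#)) ⟨
    - Σelement + Σ.sum (λ i → element i + 1#)      ≈⟨ +-congˡ (Σ.sum-cong-≋ {n} (λ i → element-index (element i + 1#))) ⟨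
    - Σelement + Σ.sum (λ i → element (index (element i + 1#)))
      ≈⟨ +-congˡ (Σ.sum-permute element shift) ⟨
    - Σelement + Σelement                          ≈⟨ -‿inverseˡ Σelement ⟩
    0#                                             ∎
    where
    Σelement = Σ.sum element
    shift : Permutation n n
    shift = bijection-permutes (_+ 1#) (_+ - 1#) +-congʳ +-congʳ
      (λ x → trans (+-assoc x _ _) (trans (+-congˡ (-‿inverseˡ 1#)) (+-identityʳ x)))
      (λ x → trans (+-assoc x _ _) (trans (+-congˡ (-‿inverseʳ 1#)) (+-identityʳ x)))

  -- For nonzero x, multiplication by x permutes the field, so the product of the nonzero elements
  -- is unchanged when each of them is multiplied by x. As products run over all n indices, `unit`
  -- replaces zero by `1#`, `off` carries the factor x at the nonzero elements and `on` carries the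
  -- one at zero. The product of `off` is then 1, and `on` contributes the single x that remains.
  x^n≈x : ∀ x → x ^ n ≈ x
  x^n≈x x with x ≟ 0#
  -- The index of `0#` witnesses that n is positive; otherwise the power would be `1#`.
  ... | yes x≈0 = trans (^-congˡ n x≈0) (trans (0^n≈0 n (index 0#)) (sym x≈0))
    where
    0^n≈0 : ∀ n → Fin n → 0# ^ n ≈ 0#
    0^n≈0 (suc n) _ = zeroˡ _
  ... | no x≉0 = begin
    x ^ n                                   ≈⟨ Π.sum-replicate n ⟨
    Π.sum (λ (_ : Fin n) → x)               ≈⟨ Π.sum-cong-≋ (λ i → off*on (element i)) ⟨
    Π.sum (λ i → off (element i) * on (element i))
      ≈⟨ Π.∑-distrib-+ (off ∘ element) (on ∘ element) ⟩
    Π.sum (off ∘ element) * Π.sum (on ∘ element)  ≈⟨ *-cong Πoff≈1 Πon≈x ⟩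
    1# * x                                  ≈⟨ *-identityˡ x ⟩
    x                                       ∎
    where
    unit off on : Carrier → Carrier
    unit y with y ≟ 0#
    ... | yes _ = 1#
    ... | no  _ = y
    off y with y ≟ 0#
    ... | yes _ = 1#
    ... | no  _ = x
    on y with y ≟ 0#
    ... | yes _ = x
    ... | no  _ = 1#

    unit-cong : ∀ {y z} → y ≈ z → unit y ≈ unit z
    unit-cong {y} {z} y≈z with y ≟ 0# | z ≟ 0#
    ... | yes _   | yes _   = refl
    ... | no _    | no _    = y≈z
    ... | yes y≈0 | no z≉0  = contradiction (trans (sym y≈z) y≈0) z≉0
    ... | no y≉0  | yes z≈0 = contradiction (trans y≈z z≈0) y≉0

    unit≉0 : ∀ y → unit y ≉ 0#
    unit≉0 y with y ≟ 0#
    ... | yes _   = 1≉0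
    ... | no  y≉0 = y≉0

    off*on : ∀ y → off y * on y ≈ x
    off*on y with y ≟ 0#
    ... | yes _ = *-identityˡ x
    ... | no  _ = *-identityʳ x

    unit-* : ∀ y → unit (x * y) ≈ off y * unit y
    unit-* y with x * y ≟ 0# | y ≟ 0#
    ... | yes _    | yes _   = sym (*-identityˡ 1#)
    ... | no _     | no _    = refl
    ... | yes xy≈0 | no y≉0  = contradiction xy≈0 (*-≉0 x≉0 y≉0)
    ... | no xy≉0  | yes y≈0 = contradiction (trans (*-congˡ y≈0) (zeroʳ x)) xy≉0

    Π≉0 : ∀ {m} (f : Fin m → Carrier) → (∀ i → f i ≉ 0#) → Π.sum f ≉ 0#
    Π≉0 {zero}  f f≉0 = 1≉0
    Π≉0 {suc m} f f≉0 = *-≉0 (f≉0 zero) (Π≉0 (f ∘ suc) (f≉0 ∘ suc))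

    scale : Permutation n n
    scale = bijection-permutes (x *_) (x ⁻¹ *_) *-congˡ *-congˡ
      (λ y → trans (sym (*-assoc _ _ _)) (trans (*-congʳ (*-inverseʳ x≉0)) (*-identityˡ y)))
      (λ y → trans (sym (*-assoc _ _ _)) (trans (*-congʳ (*-inverseˡ x≉0)) (*-identityˡ y)))

    Πunit = Π.sum (unit ∘ element)

    Πoff≈1 : Π.sum (off ∘ element) ≈ 1#
    Πoff≈1 = *-cancelˡ (Π≉0 (unit ∘ element) (unit≉0 ∘ element)) (begin
      Πunit * Π.sum (off ∘ element)                      ≈⟨ *-comm _ _ ⟩
      Π.sum (off ∘ element) * Πunit                      ≈⟨ Π.∑-distrib-+ (off ∘ element) (unit ∘ element) ⟨
      Π.sum (λ i → off (element i) * unit (element i))   ≈⟨ Π.sum-cong-≋ (λ i → unit-* (element i)) ⟨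
      Π.sum (λ i → unit (x * element i))                 ≈⟨ Π.sum-cong-≋ {n} (λ i → unit-cong (element-index (x * element i))) ⟨
      Π.sum (λ i → unit (element (index (x * element i)))) ≈⟨ Π.sum-permute (unit ∘ element) scale ⟨
      Πunit                                              ≈⟨ *-identityʳ _ ⟨
      Πunit * 1#                                         ∎)

    on≈1 : ∀ j → j ≢ index 0# → on (element j) ≈ 1#
    on≈1 j j≢0 with element j ≟ 0#
    ... | yes eq = contradiction
      (≡.trans (≡.sym (Inverse.strictlyInverseˡ enumeration j)) (index-cong eq)) j≢0
    ... | no _ = refl

    on0≈x : on (element (index 0#)) ≈ x
    on0≈x with element (index 0#) ≟ 0#
    ... | yes _ = refl
    ... | no neq = contradiction (element-index 0#) neq

    Πon≈x : Π.sum (on ∘ element) ≈ x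
    Πon≈x = trans (sum-single *-commutativeMonoid (on ∘ element) (index 0#) on≈1) on0≈x

  -- The multiple of `1#` by 2 ^ k is a product of k factors `1# + 1#`, and it vanishes by `n×1≈0`;
  -- a field has no zero divisors.
  n≡2^k⇒1+1≈0 : ∀ {k} → n ≡ 2 ℕ.^ k → 1# + 1# ≈ 0#
  n≡2^k⇒1+1≈0 {k} n≡2^k =
    go k (trans (reflexive (≡.cong (_×# 1#) (≡.sym n≡2^k))) n×1≈0)
    where
    go : ∀ k → (2 ℕ.^ k) ×# 1# ≈ 0# → 1# + 1# ≈ 0#
    go zero    eq = contradiction (trans (sym (+-identityʳ 1#)) eq) 1≉0
    go (suc k) eq with xy≈0⇒x≈0∨y≈0 (trans (sym (×1-homo-* 2 (2 ℕ.^ k))) eq)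
    ... | inj₁ 1+[1+0]≈0 = trans (+-congˡ (sym (+-identityʳ 1#))) 1+[1+0]≈0
    ... | inj₂ 2^k≈0     = go k 2^k≈0

  cardinality : ∀ {p} {P : Pred Carrier p} → (∀ {x y} → x ≈ y → x ∈ P → y ∈ P) →
    Decidable P → ∃ (HasCardinality setoid P)
  cardinality {P = P} resp P? with enumerate (P? ∘ element)
  ... | m , f , f∈ , inj , surj = m , hasCardinality-↔ setoid P Perm.id (element ∘ f) f∈
    (λ i j eq → inj i j (element-injective _ _ eq))
    λ x x∈P → let i , eq = surj (index x) (resp (sym (element-index x)) x∈P) in
      i , trans (sym (element-index x)) (reflexive (≡.cong element eq))

  everything : HasCardinality setoid (λ _ → ⊤) n
  everything = hasCardinality-↔ setoid (λ _ → ⊤) Perm.id element (λ _ → tt)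
    element-injective (λ x _ → index x , sym (element-index x))

-- Evaluation of polynomials.

module PolynomialEvaluation {c ℓ} (R : CommutativeRing c ℓ) where
  open CommutativeRing R hiding (zero)
  open Polynomial R
  open SetoidReasoning setoid

  eval : Poly → Carrier → Carrier
  eval List.[]      x = 0#
  eval (a List.∷ f) x = a + x * eval f x

  eval-zero : ∀ f x → (∀ n → coeff f n ≈ 0#) → eval f x ≈ 0#
  eval-zero List.[]      x f≈0 = refl
  eval-zero (a List.∷ f) x f≈0 = trans
    (+-cong (f≈0 0) (trans (*-congˡ (eval-zero f x (f≈0 ∘ suc))) (zeroʳ x)))
    (+-identityˡ 0#)

  eval-cong : ∀ f g x → f ≈ₚ g → eval f x ≈ eval g x
  eval-cong List.[]      g             x f≈g = sym (eval-zero g x (sym ∘ f≈g))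
  eval-cong (a List.∷ f) List.[]       x f≈g = eval-zero (a List.∷ f) x f≈g
  eval-cong (a List.∷ f) (b List.∷ g)  x f≈g =
    +-cong (f≈g 0) (*-congˡ (eval-cong f g x (f≈g ∘ suc)))

  eval-+ : ∀ f g x → eval (f +ₚ g) x ≈ eval f x + eval g x
  eval-+ List.[]      g            x = sym (+-identityˡ _)
  eval-+ (a List.∷ f) List.[]      x = sym (+-identityʳ _)
  eval-+ (a List.∷ f) (b List.∷ g) x = begin
    (a + b) + x * eval (f +ₚ g) x                ≈⟨ +-congˡ (*-congˡ (eval-+ f g x)) ⟩
    (a + b) + x * (eval f x + eval g x)          ≈⟨ +-congˡ (distribˡ x _ _) ⟩
    (a + b) + (x * eval f x + x * eval g x)      ≈⟨ +-assoc a b _ ⟩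
    a + (b + (x * eval f x + x * eval g x))      ≈⟨ +-congˡ (x∙yz≈y∙xz b _ _) ⟩
    a + (x * eval f x + (b + x * eval g x))      ≈⟨ +-assoc a _ _ ⟨
    (a + x * eval f x) + (b + x * eval g x)      ∎
    where open CommutativeSemigroup
            (CommutativeMonoid.commutativeSemigroup +-commutativeMonoid) using (x∙yz≈y∙xz)

  eval-scale : ∀ a g x → eval (List.map (a *_) g) x ≈ a * eval g x
  eval-scale a List.[]      x = sym (zeroʳ a)
  eval-scale a (b List.∷ g) x = begin
    a * b + x * eval (List.map (a *_) g) x   ≈⟨ +-congˡ (*-congˡ (eval-scale a g x)) ⟩
    a * b + x * (a * eval g x)               ≈⟨ +-congˡ (x∙yz≈y∙xz x a _) ⟩
    a * b + a * (x * eval g x)               ≈⟨ distribˡ a b _ ⟨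
    a * (b + x * eval g x)                   ∎
    where open CommutativeSemigroup
            (CommutativeMonoid.commutativeSemigroup *-commutativeMonoid) using (x∙yz≈y∙xz)

  eval-* : ∀ f g x → eval (f *ₚ g) x ≈ eval f x * eval g x
  eval-* List.[]      g x = sym (zeroˡ _)
  eval-* (a List.∷ f) g x = begin
    eval (List.map (a *_) g +ₚ (0# List.∷ (f *ₚ g))) x
      ≈⟨ eval-+ (List.map (a *_) g) _ x ⟩
    eval (List.map (a *_) g) x + (0# + x * eval (f *ₚ g) x)
      ≈⟨ +-cong (eval-scale a g x) (trans (+-identityˡ _) (*-congˡ (eval-* f g x))) ⟩
    a * eval g x + x * (eval f x * eval g x)
      ≈⟨ +-congˡ (sym (*-assoc x _ _)) ⟩
    a * eval g x + x * eval f x * eval g x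
      ≈⟨ distribʳ (eval g x) a _ ⟨
    (a + x * eval f x) * eval g x ∎

  -- Evaluating g f = 1 at a root of f would give 0 = 1. This shows that the linear factors split
  -- off by a root are not units.
  root⇒∤1 : 1# ≉ 0# → ∀ f x → eval f x ≈ 0# → ¬ (∃[ g ] g *ₚ f ≈ₚ 1# List.∷ List.[])
  root⇒∤1 1≉0 f x fx≈0 (g , gf≈1) = 1≉0 (begin
    1#                    ≈⟨ +-identityʳ 1# ⟨
    1# + 0#               ≈⟨ +-congˡ (zeroʳ x) ⟨
    1# + x * 0#           ≈⟨ eval-cong (g *ₚ f) (1# List.∷ List.[]) x gf≈1 ⟨
    eval (g *ₚ f) x       ≈⟨ eval-* g f x ⟩
    eval g x * eval f x   ≈⟨ *-congˡ fx≈0 ⟩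
    eval g x * 0#         ≈⟨ zeroʳ _ ⟩
    0#                    ∎)

-- The field of order q² with q even: conjugation, trace, square roots.

module EvenSquareField {c ℓ₁ ℓ₂ : Level} (q : ℕ) (q-primePower : IsPrimePower q) (2∣q : 2 ∣ q)
  (K : FiniteField c ℓ₁ ℓ₂ (q ℕ.^ 2)) where

  open FiniteField K hiding (zero)
  open FiniteFieldProperties K public
  open Geometry q K using (𝔽q; Irreducible)
  open Exp semiring using (^-congˡ; ^-assocʳ)
  open CommutativeExp commutativeSemiring using (^-distrib-*)
  open SetoidReasoning setoid

  private
    e = proj₁ (even-prime-power q-primePower 2∣q)
    q≡2^e = proj₂ (even-prime-power q-primePower 2∣q)
    q/2 = ∣.quotient 2∣q

    1+1≈0 : 1# + 1# ≈ 0#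
    1+1≈0 = n≡2^k⇒1+1≈0 {e ℕ.* 2} (≡.trans (≡.cong (ℕ._^ 2) q≡2^e) (ℕ.^-*-assoc 2 e 2))

  open CharacteristicTwo commutativeRing 1+1≈0 public

  conj : Carrier → Carrier
  conj x = x ^ q

  conj-cong : ∀ {x y} → x ≈ y → conj x ≈ conj y
  conj-cong = ^-congˡ q

  conj-involutive : ∀ x → conj (conj x) ≈ x
  conj-involutive x = trans (^-assocʳ x q q)
    (trans (reflexive (≡.cong (x ^_) (≡.cong (q ℕ.*_) (≡.sym (ℕ.*-identityʳ q))))) (x^n≈x x))

  conj-* : ∀ x y → conj (x * y) ≈ conj x * conj y
  conj-* x y = ^-distrib-* x y q

  conj-+ : ∀ x y → conj (x + y) ≈ conj x + conj y
  conj-+ x y = ≡.subst (λ r → (x + y) ^ r ≈ x ^ r + y ^ r) (≡.sym q≡2^e) (frobenius e x y)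
    where
    square-+ : ∀ x y → (x + y) ^ 2 ≈ x ^ 2 + y ^ 2
    square-+ = solve 2 (λ x y → (x :+ y) :^ 2 := x :^ 2 :+ y :^ 2) refl
    frobenius : ∀ k x y → (x + y) ^ (2 ℕ.^ k) ≈ x ^ (2 ℕ.^ k) + y ^ (2 ℕ.^ k)
    frobenius zero    x y = solve 2 (λ x y → (x :+ y) :^ 1 := x :^ 1 :+ y :^ 1) refl x y
    frobenius (suc k) x y = begin
      (x + y) ^ (2 ℕ.* 2 ℕ.^ k)                ≈⟨ ^-assocʳ (x + y) 2 (2 ℕ.^ k) ⟨
      ((x + y) ^ 2) ^ (2 ℕ.^ k)                ≈⟨ ^-congˡ (2 ℕ.^ k) (square-+ x y) ⟩
      (x ^ 2 + y ^ 2) ^ (2 ℕ.^ k)              ≈⟨ frobenius k _ _ ⟩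
      (x ^ 2) ^ (2 ℕ.^ k) + (y ^ 2) ^ (2 ℕ.^ k)  ≈⟨ +-cong (^-assocʳ x 2 (2 ℕ.^ k)) (^-assocʳ y 2 (2 ℕ.^ k)) ⟩
      x ^ (2 ℕ.* 2 ℕ.^ k) + y ^ (2 ℕ.* 2 ℕ.^ k)  ∎

  square-injective : ∀ {x y} → x * x ≈ y * y → x ≈ y
  square-injective {x} {y} eq = x+y≈0⇒x≈y (x*x≈0⇒x≈0 (trans
    (solve 2 (λ x y → (x :+ y) :* (x :+ y) := x :* x :+ y :* y) refl x y)
    (x≈y⇒x+y≈0 eq)))

  conj-0 : conj 0# ≈ 0#
  conj-0 = begin
    conj 0#                    ≈⟨ conj-cong (+-identityˡ 0#) ⟨
    conj (0# + 0#)             ≈⟨ conj-+ 0# 0# ⟩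
    conj 0# + conj 0#          ≈⟨ x+x≈0 _ ⟩
    0#                         ∎

  conj-≉0 : ∀ {x} → x ≉ 0# → conj x ≉ 0#
  conj-≉0 x≉0 x̄≈0 = x≉0 (trans (sym (conj-involutive _)) (trans (conj-cong x̄≈0) conj-0))

  conj-1 : conj 1# ≈ 1#
  conj-1 = *-cancelˡ (conj-≉0 1≉0) (begin
    conj 1# * conj 1#    ≈⟨ conj-* 1# 1# ⟨
    conj (1# * 1#)       ≈⟨ conj-cong (*-identityˡ 1#) ⟩
    conj 1#              ≈⟨ *-identityʳ _ ⟨
    conj 1# * 1#         ∎)

  -- `conj` is a ring endomorphism, so it commutes with every polynomial over 𝔽₂. Working on the
  -- syntax of the ring solver, this conjugates a long expression in one step from the conjugates of
  -- its variables.
  conj-⟦⟧ : ∀ {n} (p : Polynomial n) {ρ ρ̄ : Vec Carrier n} →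
    Pointwise (λ x x̄ → conj x ≈ x̄) ρ ρ̄ → conj (⟦ p ⟧ ρ) ≈ ⟦ p ⟧ ρ̄
  conj-⟦⟧ (op [+] p r)  ρ̄ = trans (conj-+ _ _) (+-cong (conj-⟦⟧ p ρ̄) (conj-⟦⟧ r ρ̄))
  conj-⟦⟧ (op [*] p r)  ρ̄ = trans (conj-* _ _) (*-cong (conj-⟦⟧ p ρ̄) (conj-⟦⟧ r ρ̄))
  conj-⟦⟧ (con true)    ρ̄ = conj-1
  conj-⟦⟧ (con false)   ρ̄ = conj-0
  conj-⟦⟧ (var i)       ρ̄ = Pointwise.lookup ρ̄ i
  conj-⟦⟧ (p :^ zero)   ρ̄ = conj-1
  conj-⟦⟧ (p :^ suc n)  ρ̄ = trans (conj-* _ _) (*-cong (conj-⟦⟧ p ρ̄) (conj-⟦⟧ (p :^ n) ρ̄))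
  conj-⟦⟧ (:- p)        ρ̄ = trans (conj-cong -x≈x) (trans (conj-⟦⟧ p ρ̄) (sym -x≈x))
    where
    -x≈x : ∀ {x} → - x ≈ x
    -x≈x {x} = x+y≈0⇒x≈y (-‿inverseˡ x)

  𝔽q-resp : ∀ {x y} → x ≈ y → x ∈ 𝔽q → y ∈ 𝔽q
  𝔽q-resp x≈y x∈ = trans (conj-cong (sym x≈y)) (trans x∈ x≈y)

  𝔽q-+ : ∀ {x y} → x ∈ 𝔽q → y ∈ 𝔽q → x + y ∈ 𝔽q
  𝔽q-+ x∈ y∈ = trans (conj-+ _ _) (+-cong x∈ y∈)

  𝔽q-* : ∀ {x y} → x ∈ 𝔽q → y ∈ 𝔽q → x * y ∈ 𝔽q
  𝔽q-* x∈ y∈ = trans (conj-* _ _) (*-cong x∈ y∈)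

  𝔽q-cancel : ∀ {x y} → x ≉ 0# → x ∈ 𝔽q → x * y ∈ 𝔽q → y ∈ 𝔽q
  𝔽q-cancel {x} {y} x≉0 x∈ xy∈ = *-cancelˡ x≉0 (begin
    x * conj y        ≈⟨ *-congʳ x∈ ⟨
    conj x * conj y   ≈⟨ conj-* x y ⟨
    conj (x * y)      ≈⟨ xy∈ ⟩
    x * y             ∎)

  𝔽q-⁻¹ : ∀ {x} → x ≉ 0# → x ∈ 𝔽q → x ⁻¹ ∈ 𝔽q
  𝔽q-⁻¹ x≉0 x∈ = 𝔽q-cancel x≉0 x∈ (𝔽q-resp (sym (*-inverseʳ x≉0)) conj-1)

  Tr : Carrier → Carrier
  Tr x = x + conj x

  Tr-∈𝔽q : ∀ x → Tr x ∈ 𝔽q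
  Tr-∈𝔽q x = begin
    conj (x + conj x)         ≈⟨ conj-+ x _ ⟩
    conj x + conj (conj x)    ≈⟨ +-congˡ (conj-involutive x) ⟩
    conj x + x                ≈⟨ +-comm _ _ ⟩
    x + conj x                ∎

  Tr≈0⇒∈𝔽q : ∀ {x} → Tr x ≈ 0# → x ∈ 𝔽q
  Tr≈0⇒∈𝔽q eq = sym (x+y≈0⇒x≈y eq)

  ∈𝔽q⇒Tr≈0 : ∀ {x} → x ∈ 𝔽q → Tr x ≈ 0#
  ∈𝔽q⇒Tr≈0 x∈ = x≈y⇒x+y≈0 (sym x∈)

  -- The square of this power is the q-th power of `conj x`, which is x again.
  sqrt : Carrier → Carrier
  sqrt x = conj x ^ q/2

  sqrt-square : ∀ x → sqrt x * sqrt x ≈ x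
  sqrt-square x = begin
    conj x ^ q/2 * conj x ^ q/2    ≈⟨ *-congˡ (*-identityʳ _) ⟨
    (conj x ^ q/2) ^ 2             ≈⟨ ^-assocʳ (conj x) q/2 2 ⟩
    conj x ^ (q/2 ℕ.* 2)           ≈⟨ reflexive (≡.cong (conj x ^_) (≡.sym (_∣_.equality 2∣q))) ⟩
    conj (conj x)                  ≈⟨ conj-involutive x ⟩
    x                              ∎

  sqrt-∈𝔽q : ∀ {x} → x ∈ 𝔽q → sqrt x ∈ 𝔽q
  sqrt-∈𝔽q {x} x∈ = square-injective (begin
    conj (sqrt x) * conj (sqrt x)   ≈⟨ conj-* _ _ ⟨
    conj (sqrt x * sqrt x)          ≈⟨ conj-cong (sqrt-square x) ⟩
    conj x                          ≈⟨ x∈ ⟩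
    x                               ≈⟨ sqrt-square x ⟨
    sqrt x * sqrt x                 ∎)

  -- A root t splits X² + X + γ as (X + t)(X + t + 1). Irreducibility would make one factor a unit,
  -- but each has a root.
  Irreducible⇒rootless : ∀ {γ} → Irreducible (γ List.∷ 1# List.∷ 1# List.∷ List.[]) →
    ∀ t → t * t + t + γ ≉ 0#
  Irreducible⇒rootless {γ} irreducible t t²+t+γ≈0
    with SemiringDefs.Irreducible.split-∣1 irreducible
           {t List.∷ 1# List.∷ List.[]} {(t + 1#) List.∷ 1# List.∷ List.[]} factorisation
    where
    factorisation : ∀ i → _
    factorisation 0 = x+y≈0⇒x≈y (trans
      (solve 2 (λ t γ → γ :+ (t :* (t :+ con true) :+ con false) := t :* t :+ t :+ γ) refl t γ) t²+t+γ≈0)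
    factorisation 1 = solve 1 (λ t →
      con true := t :* con true :+ (con true :* (t :+ con true) :+ con false)) refl t
    factorisation 2 = sym (*-identityˡ 1#)
    factorisation (suc (suc (suc _))) = refl
  ... | inj₁ f∣1 = PolynomialEvaluation.root⇒∤1 commutativeRing 1≉0 _ t
    (solve 1 (λ t → t :+ t :* (con true :+ t :* con false) := con false) refl t)
    (_∣ʳ_.quotient f∣1 , _∣ʳ_.equality f∣1)
  ... | inj₂ f∣1 = PolynomialEvaluation.root⇒∤1 commutativeRing 1≉0 _ (t + 1#)
    (solve 1 (λ t → (t :+ con true) :+ (t :+ con true) :* (con true :+ (t :+ con true) :* con false)
      := con false) refl t)
    (_∣ʳ_.quotient f∣1 , _∣ʳ_.equality f∣1)

  -- The basis 1, ω over 𝔽q and the Artin-Schreier map.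

  module Basis (ω : Carrier) (ω∉𝔽q : ¬ (ω ∈ 𝔽q)) (ω+ω̄≈1 : ω + conj ω ≈ 1#) where

    ω≉0 : ω ≉ 0#
    ω≉0 ω≈0 = ω∉𝔽q (𝔽q-resp (sym ω≈0) conj-0)

    ω̄≈ω+1 : conj ω ≈ ω + 1#
    ω̄≈ω+1 = x+y≈0⇒x≈y (trans
      (solve 2 (λ x y → x :+ (y :+ con true) := (y :+ x) :+ con true) refl (conj ω) ω)
      (x≈y⇒x+y≈0 ω+ω̄≈1))

    Tr-ω* : ∀ {x} → x ∈ 𝔽q → Tr (ω * x) ≈ x
    Tr-ω* {x} x∈ = begin
      ω * x + conj (ω * x)   ≈⟨ +-congˡ (trans (conj-* ω x) (*-cong ω̄≈ω+1 x∈)) ⟩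
      ω * x + (ω + 1#) * x   ≈⟨ solve 2 (λ w x → w :* x :+ (w :+ con true) :* x := x) refl ω x ⟩
      x                      ∎

    Tr-basis : ∀ {x y} → x ∈ 𝔽q → y ∈ 𝔽q → Tr (x + y * ω) ≈ y
    Tr-basis {x} {y} x∈ y∈ = begin
      x + y * ω + conj (x + y * ω)
        ≈⟨ +-congˡ (trans (conj-+ _ _) (+-cong x∈ (trans (conj-* y ω) (*-cong y∈ ω̄≈ω+1)))) ⟩
      x + y * ω + (x + y * (ω + 1#))
        ≈⟨ solve 3 (λ x y w → x :+ y :* w :+ (x :+ y :* (w :+ con true)) := y) refl x y ω ⟩
      y ∎

    basis-injective : ∀ {x y x′ y′} → x ∈ 𝔽q → y ∈ 𝔽q → x′ ∈ 𝔽q → y′ ∈ 𝔽q →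
      x + y * ω ≈ x′ + y′ * ω → x ≈ x′ × y ≈ y′
    basis-injective {x} {y} {x′} {y′} x∈ y∈ x′∈ y′∈ eq = x≈x′ , y≈y′
      where
      y≈y′ : y ≈ y′
      y≈y′ = trans (sym (Tr-basis x∈ y∈))
        (trans (+-cong eq (conj-cong eq)) (Tr-basis x′∈ y′∈))
      x≈x′ : x ≈ x′
      x≈x′ = x+y≈0⇒x≈y (begin
        x + x′                               ≈⟨ solve 4 (λ x x′ y w →
          x :+ x′ := (x :+ y :* w) :+ (x′ :+ y :* w)) refl x x′ y ω ⟩
        (x + y * ω) + (x′ + y * ω)           ≈⟨ +-cong eq (+-congˡ (*-congʳ y≈y′)) ⟩
        (x′ + y′ * ω) + (x′ + y′ * ω)        ≈⟨ x+x≈0 _ ⟩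
        0#                                   ∎)

    -- As Tr 1 = 0 and Tr ω = 1, the coefficient of ω in the basis 1, ω is the trace; `re x` is the
    -- other coefficient.
    re : Carrier → Carrier
    re x = x + Tr x * ω

    re-∈𝔽q : ∀ x → re x ∈ 𝔽q
    re-∈𝔽q x = begin
      conj (x + Tr x * ω)             ≈⟨ conj-+ _ _ ⟩
      conj x + conj (Tr x * ω)        ≈⟨ +-congˡ (trans (conj-* _ ω) (*-cong (Tr-∈𝔽q x) ω̄≈ω+1)) ⟩
      conj x + Tr x * (ω + 1#)        ≈⟨ solve 3 (λ x x̄ w →
        x̄ :+ (x :+ x̄) :* (w :+ con true) := x :+ (x :+ x̄) :* w) refl x (conj x) ω ⟩
      x + Tr x * ω                    ∎

    re+Tr*ω : ∀ x → x ≈ re x + Tr x * ω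
    re+Tr*ω x = solve 2 (λ x y → x := x :+ y :+ y) refl x (Tr x * ω)

    -- If `conj` has m fixed points, the basis 1, ω gives the field m² elements, so m² = q².
    𝔽q-cardinality : HasCardinality setoid 𝔽q q
    𝔽q-cardinality with cardinality 𝔽q-resp (λ x → conj x ≟ x)
    ... | m , card = ≡.subst (HasCardinality setoid 𝔽q) m≡q card
      where
      open FromCardinality setoid 𝔽q card
      K₂ : HasCardinality setoid (λ _ → ⊤) (m ℕ.* m)
      K₂ = hasCardinality-↔ setoid (λ _ → ⊤) (↔-sym (Fin.*↔× {m} {m}))
        (λ (i , j) → member i + member j * ω) (λ _ → tt)
        (λ (i , j) (i′ , j′) eq → let
            x≈ , y≈ = basis-injective (member-∈ i) (member-∈ j) (member-∈ i′) (member-∈ j′) eq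
          in ≡.cong₂ _,_ (member-injective i i′ x≈) (member-injective j j′ y≈))
        (λ x _ → let
            i , re≈ = member-surjective (re x) (re-∈𝔽q x)
            j , Tr≈ = member-surjective (Tr x) (Tr-∈𝔽q x)
          in (i , j) , trans (re+Tr*ω x) (+-cong re≈ (*-congʳ Tr≈)))
      m*m≡q*q : m ℕ.* m ≡ q ℕ.* q
      m*m≡q*q = ≡.trans (cardinality-unique setoid (λ _ → ⊤) K₂ everything)
        (≡.cong (q ℕ.*_) (ℕ.*-identityʳ q))
      m≡q : m ≡ q
      m≡q with ℕ.<-cmp m q
      ... | tri< m<q _ _ = contradiction m*m≡q*q (ℕ.<⇒≢ (ℕ.*-mono-< m<q m<q))
      ... | tri≈ _ m≡q _ = m≡q
      ... | tri> _ _ q<m = contradiction (≡.sym m*m≡q*q) (ℕ.<⇒≢ (ℕ.*-mono-< q<m q<m))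

    private
      open CommutativeSemigroup (CommutativeMonoid.commutativeSemigroup +-commutativeMonoid) using (xy∙z≈xz∙y)
      open GroupProperties +-group using () renaming (∙-cancelʳ to +-cancelʳ)

      ℘ : Carrier → Carrier
      ℘ z = z * z + z

      ℘-cong : ∀ {x y} → x ≈ y → ℘ x ≈ ℘ y
      ℘-cong eq = +-cong (*-cong eq eq) eq

      ℘-+ : ∀ x y → ℘ (x + y) ≈ ℘ x + ℘ y
      ℘-+ = solve 2 (λ x y → (x :+ y) :* (x :+ y) :+ (x :+ y)
        := (x :* x :+ x) :+ (y :* y :+ y)) refl

      ℘≈0 : ∀ {z} → ℘ z ≈ 0# → z ≈ 0# ⊎ z + 1# ≈ 0#
      ℘≈0 {z} eq = xy≈0⇒x≈0∨y≈0 (trans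
        (solve 1 (λ z → z :* (z :+ con true) := z :* z :+ z) refl z) eq)

      ℘ω-∈𝔽q : ℘ ω ∈ 𝔽q
      ℘ω-∈𝔽q = begin
        conj (ω * ω + ω)                  ≈⟨ conj-⟦⟧ (var 0F :* var 0F :+ var 0F) (ω̄≈ω+1 ∷ []) ⟩
        ℘ (ω + 1#)                        ≈⟨ solve 1 (λ w →
          (w :+ con true) :* (w :+ con true) :+ (w :+ con true) := w :* w :+ w) refl ω ⟩
        ω * ω + ω                         ∎

      -- The only solutions of ℘ z = ℘ ω are ω and ω + 1, both outside 𝔽q. Thus ℘ ω lies in 𝔽q but
      -- not in the image of 𝔽q under ℘.
      ℘ω∉℘𝔽q : ∀ {z} → z ∈ 𝔽q → ℘ z ≉ ℘ ω
      ℘ω∉℘𝔽q {z} z∈ eq = ω∉𝔽q ([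
          (λ z+ω≈0 → 𝔽q-resp (x+y≈0⇒x≈y z+ω≈0) z∈) ,
          (λ z+ω+1≈0 → 𝔽q-resp (x+y≈0⇒x≈y (trans (xy∙z≈xz∙y z 1# ω) z+ω+1≈0)) (𝔽q-+ z∈ conj-1))
        ]′ (℘≈0 (trans (℘-+ z ω) (x≈y⇒x+y≈0 eq))))

    -- z ↦ ℘ z on 𝔽q identifies exactly z and z + 1; adding ℘ ω at one element of
    -- each such pair separates them, which gives an injection, hence a bijection.
    artin-schreier : ∀ {x} → x ∈ 𝔽q → ∃[ z ] z * z + z ≈ x
    artin-schreier {x} x∈ = z₀ (injective⇒surjective φ φ-injective (proj₁ (member-surjective x x∈)))
      where
      open FromCardinality setoid 𝔽q 𝔽q-cardinality
      First : Pred Carrier _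
      First z = index z Fin.< index (z + 1#)

      offset : ∀ z → Dec (First z) → Carrier
      offset z (yes _) = ω
      offset z (no _)  = 0#

      ℘offset-∈𝔽q : ∀ z d → ℘ (offset z d) ∈ 𝔽q
      ℘offset-∈𝔽q z (yes _) = ℘ω-∈𝔽q
      ℘offset-∈𝔽q z (no _)  = 𝔽q-resp (solve 0 (con false := con false :* con false :+ con false) refl) conj-0

      first? : ∀ z → Dec (First z)
      first? z = index z Fin.<? index (z + 1#)

      ψ : Fin q → Carrier
      ψ i = ℘ (member i + offset (member i) (first? (member i)))

      ψ-∈𝔽q : ∀ i → ψ i ∈ 𝔽q
      ψ-∈𝔽q i = 𝔽q-resp (sym (℘-+ _ _))
        (𝔽q-+ (𝔽q-+ (𝔽q-* (member-∈ i) (member-∈ i)) (member-∈ i)) (℘offset-∈𝔽q _ (first? (member i))))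

      φ : Fin q → Fin q
      φ i = proj₁ (member-surjective (ψ i) (ψ-∈𝔽q i))

      ψ≈φ : ∀ i → ψ i ≈ member (φ i)
      ψ≈φ i = proj₂ (member-surjective (ψ i) (ψ-∈𝔽q i))

      partner : ∀ {z w} → z + w + 1# ≈ 0# → index (z + 1#) ≡ index w
      partner {z} {w} eq = index-cong (x+y≈0⇒x≈y (trans (xy∙z≈xz∙y z 1# w) eq))

      partner-sym : ∀ {z w} → z + w + 1# ≈ 0# → w + z + 1# ≈ 0#
      partner-sym = trans (+-congʳ (+-comm _ _))

      ℘-sum : ∀ {z w o} → ℘ (z + o) ≈ ℘ (w + o) → ℘ (z + w) ≈ 0#
      ℘-sum {z} {w} {o} eq = trans (℘-+ z w) (x≈y⇒x+y≈0 (+-cancelʳ (℘ o) _ _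
        (trans (sym (℘-+ z o)) (trans eq (℘-+ w o)))))

      ℘-shift : ∀ {z w} → ℘ (z + ω) ≈ ℘ (w + 0#) → ℘ (z + w) ≈ ℘ ω
      ℘-shift {z} {w} eq = x+y≈0⇒x≈y (trans (sym (℘-+ (z + w) ω)) (trans (℘-cong (xy∙z≈xz∙y z w ω))
        (trans (℘-+ (z + ω) w) (x≈y⇒x+y≈0 (trans eq (℘-cong (+-identityʳ w)))))))

      -- Equal offsets cancel by additivity and leave w = z or w = z + 1; in the second case the
      -- order of the indices contradicts the common choice of offset or forces z = w. Unequal
      -- offsets would make ℘ ω a value of ℘ on 𝔽q.
      separated : ∀ z w → z ∈ 𝔽q → w ∈ 𝔽q → (d : Dec (First z)) (d′ : Dec (First w)) →
        ℘ (z + offset z d) ≈ ℘ (w + offset w d′) → z ≈ w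
      separated z w z∈ w∈ (yes z<) (yes w<) eq = [ x+y≈0⇒x≈y , (λ z+w+1≈0 → contradiction
          (≡.subst (index z Fin.<_) (partner z+w+1≈0) z<)
          (Fin.<-asym (≡.subst (index w Fin.<_) (partner (partner-sym z+w+1≈0)) w<))) ]′
        (℘≈0 (℘-sum eq))
      separated z w z∈ w∈ (no z≮) (no w≮) eq = [ x+y≈0⇒x≈y , (λ z+w+1≈0 →
          trans (sym (element-index z)) (trans (reflexive (≡.cong element (Fin.≤-antisym
            (ℕ.≮⇒≥ (≡.subst (λ i → ¬ (index w Fin.< i)) (partner (partner-sym z+w+1≈0)) w≮))
            (ℕ.≮⇒≥ (≡.subst (λ i → ¬ (index z Fin.< i)) (partner z+w+1≈0) z≮)))))
          (element-index w))) ]′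
        (℘≈0 (℘-sum eq))
      separated z w z∈ w∈ (yes _) (no _) eq =
        contradiction (℘-shift eq) (℘ω∉℘𝔽q (𝔽q-+ z∈ w∈))
      separated z w z∈ w∈ (no _) (yes _) eq =
        contradiction (℘-shift (sym eq)) (℘ω∉℘𝔽q (𝔽q-+ w∈ z∈))

      φ-injective : ∀ i j → φ i ≡ φ j → i ≡ j
      φ-injective i j eq = member-injective i j
        (separated _ _ (member-∈ i) (member-∈ j) (first? _) (first? _)
          (trans (ψ≈φ i) (trans (reflexive (≡.cong member eq)) (sym (ψ≈φ j)))))

      z₀ : ∃ (λ i → φ i ≡ proj₁ (member-surjective x x∈)) → ∃[ z ] z * z + z ≈ x
      z₀ (i , eq) = _ , trans (ψ≈φ i) (trans (reflexive (≡.cong member eq))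
        (sym (proj₂ (member-surjective x x∈))))

module BaerGeometry {c ℓ₁ ℓ₂ : Level} (q : ℕ) (q-primePower : IsPrimePower q) (2∣q : 2 ∣ q)
  (K : FiniteField c ℓ₁ ℓ₂ (q ℕ.^ 2)) where

  open FiniteField K hiding (zero)
  open Geometry q K
  open EvenSquareField q q-primePower 2∣q K
  open SetoidReasoning setoid
  open Exp semiring using (^-assocʳ; ^-congʳ)

  Coords⁴ : Set c
  Coords⁴ = Vector Carrier 4

  infix  4 _≋_
  infixl 6 _⊕_
  infixr 7 _⊙_

  _≋_ : ∀ {n} → Vector Carrier n → Vector Carrier n → Set ℓ₁
  u ≋ w = ∀ i → u i ≈ w i

  _⊕_ : ∀ {n} → Vector Carrier n → Vector Carrier n → Vector Carrier n
  (u ⊕ w) i = u i + w i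

  _⊙_ : ∀ {n} → Carrier → Vector Carrier n → Vector Carrier n
  (k ⊙ u) i = k * u i

  Nonzero : ∀ {n} → Vector Carrier n → Set ℓ₁
  Nonzero u = ∃[ i ] u i ≉ 0#

  -- The elliptic form `f` over K and its polar form `B`.

  module LiftedOvoid (ω : Carrier) (ω∉𝔽q : ¬ (ω ∈ 𝔽q)) (ω+ω̄≈1 : ω + conj ω ≈ 1#)
    (γ : Carrier) (rootless : ∀ t → t * t + t + γ ≉ 0#) where

    open Basis ω ω∉𝔽q ω+ω̄≈1
    open Form ω

    -- μ is the third coordinate of `S γ`. With this choice `baer` sends the singular vector (γ/ω,
    -- 1, 0, 1) to `S γ`.
    γ/ω μ : Carrier
    γ/ω = γ ÷ ω
    μ = Tr ((ω + 1#) * γ/ω)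

    ω*γ/ω≈γ : ω * γ/ω ≈ γ
    ω*γ/ω≈γ = begin
      ω * (γ * ω ⁻¹)     ≈⟨ solve 3 (λ w g v → w :* (g :* v) := (w :* v) :* g) refl ω γ (ω ⁻¹) ⟩
      (ω * ω ⁻¹) * γ     ≈⟨ *-congʳ (*-inverseʳ ω≉0) ⟩
      1# * γ             ≈⟨ *-identityˡ γ ⟩
      γ                  ∎

    f : Coords⁴ → Carrier
    f u = u 0F * (ω * u 1F + (ω + 1#) * u 3F) + (ω * (u 2F * u 2F) + u 2F * u 3F + γ/ω * (u 3F * u 3F))

    B : Coords⁴ → Coords⁴ → Carrier
    B u w = u 0F * (ω * w 1F + (ω + 1#) * w 3F) + w 0F * (ω * u 1F + (ω + 1#) * u 3F)
      + (u 2F * w 3F + w 2F * u 3F)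

    f-cong : ∀ {u w} → u ≋ w → f u ≈ f w
    f-cong u≋w = +-cong (*-cong (u≋w 0F) (+-cong (*-congˡ (u≋w 1F)) (*-congˡ (u≋w 3F))))
      (+-cong (+-cong (*-congˡ (*-cong (u≋w 2F) (u≋w 2F))) (*-cong (u≋w 2F) (u≋w 3F)))
        (*-congˡ (*-cong (u≋w 3F) (u≋w 3F))))

    B-congʳ : ∀ u {v w} → v ≋ w → B u v ≈ B u w
    B-congʳ u v≋w = +-cong
      (+-cong (*-congˡ (+-cong (*-congˡ (v≋w 1F)) (*-congˡ (v≋w 3F)))) (*-congʳ (v≋w 0F)))
      (+-cong (*-congˡ (v≋w 3F)) (*-congʳ (v≋w 2F)))

    f-⊕ : ∀ u w → f (u ⊕ w) ≈ f u + f w + B u w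
    f-⊕ u w = solve 10 (λ u₀ u₁ u₂ u₃ w₀ w₁ w₂ w₃ o g →
      (u₀ :+ w₀) :* (o :* (u₁ :+ w₁) :+ (o :+ con true) :* (u₃ :+ w₃))
        :+ (o :* ((u₂ :+ w₂) :* (u₂ :+ w₂)) :+ (u₂ :+ w₂) :* (u₃ :+ w₃) :+ g :* ((u₃ :+ w₃) :* (u₃ :+ w₃)))
      := (u₀ :* (o :* u₁ :+ (o :+ con true) :* u₃) :+ (o :* (u₂ :* u₂) :+ u₂ :* u₃ :+ g :* (u₃ :* u₃)))
        :+ (w₀ :* (o :* w₁ :+ (o :+ con true) :* w₃) :+ (o :* (w₂ :* w₂) :+ w₂ :* w₃ :+ g :* (w₃ :* w₃)))
        :+ (u₀ :* (o :* w₁ :+ (o :+ con true) :* w₃) :+ w₀ :* (o :* u₁ :+ (o :+ con true) :* u₃)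
          :+ (u₂ :* w₃ :+ w₂ :* u₃)))
      refl (u 0F) (u 1F) (u 2F) (u 3F) (w 0F) (w 1F) (w 2F) (w 3F) ω γ/ω

    f-⊙ : ∀ k u → f (k ⊙ u) ≈ k * k * f u
    f-⊙ k u = solve 7 (λ k u₀ u₁ u₂ u₃ o g →
      (k :* u₀) :* (o :* (k :* u₁) :+ (o :+ con true) :* (k :* u₃))
        :+ (o :* ((k :* u₂) :* (k :* u₂)) :+ (k :* u₂) :* (k :* u₃) :+ g :* ((k :* u₃) :* (k :* u₃)))
      := k :* k :* (u₀ :* (o :* u₁ :+ (o :+ con true) :* u₃)
        :+ (o :* (u₂ :* u₂) :+ u₂ :* u₃ :+ g :* (u₃ :* u₃))))
      refl k (u 0F) (u 1F) (u 2F) (u 3F) ω γ/ω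

    B-⊕ʳ : ∀ u v w → B u (v ⊕ w) ≈ B u v + B u w
    B-⊕ʳ u v w = solve 13 (λ u₀ u₁ u₂ u₃ v₀ v₁ v₂ v₃ w₀ w₁ w₂ w₃ o →
      u₀ :* (o :* (v₁ :+ w₁) :+ (o :+ con true) :* (v₃ :+ w₃))
        :+ (v₀ :+ w₀) :* (o :* u₁ :+ (o :+ con true) :* u₃) :+ (u₂ :* (v₃ :+ w₃) :+ (v₂ :+ w₂) :* u₃)
      := (u₀ :* (o :* v₁ :+ (o :+ con true) :* v₃) :+ v₀ :* (o :* u₁ :+ (o :+ con true) :* u₃)
          :+ (u₂ :* v₃ :+ v₂ :* u₃))
        :+ (u₀ :* (o :* w₁ :+ (o :+ con true) :* w₃) :+ w₀ :* (o :* u₁ :+ (o :+ con true) :* u₃)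
          :+ (u₂ :* w₃ :+ w₂ :* u₃)))
      refl (u 0F) (u 1F) (u 2F) (u 3F) (v 0F) (v 1F) (v 2F) (v 3F) (w 0F) (w 1F) (w 2F) (w 3F) ω

    B-⊙ʳ : ∀ u k w → B u (k ⊙ w) ≈ k * B u w
    B-⊙ʳ u k w = solve 10 (λ u₀ u₁ u₂ u₃ w₀ w₁ w₂ w₃ o k →
      u₀ :* (o :* (k :* w₁) :+ (o :+ con true) :* (k :* w₃))
        :+ (k :* w₀) :* (o :* u₁ :+ (o :+ con true) :* u₃) :+ (u₂ :* (k :* w₃) :+ (k :* w₂) :* u₃)
      := k :* (u₀ :* (o :* w₁ :+ (o :+ con true) :* w₃) :+ w₀ :* (o :* u₁ :+ (o :+ con true) :* u₃)
          :+ (u₂ :* w₃ :+ w₂ :* u₃)))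
      refl (u 0F) (u 1F) (u 2F) (u 3F) (w 0F) (w 1F) (w 2F) (w 3F) ω k

    B-sym : ∀ u w → B u w ≈ B w u
    B-sym u w = +-cong (+-comm _ _) (+-comm _ _)

    B-self : ∀ u → B u u ≈ 0#
    B-self u = trans (+-cong (x+x≈0 _) (x+x≈0 _)) (+-identityˡ 0#)

    -- For nonzero d the substitution t = ω s / d turns ω times the form into d² (t² + t + γ), and
    -- t² + t + γ has no root.
    anisotropic : ∀ s d → ω * (s * s) + s * d + γ/ω * (d * d) ≈ 0# → s ≈ 0# × d ≈ 0#
    anisotropic s d eq with d ≟ 0#
    ... | yes d≈0 = x*x≈0⇒x≈0 (x≉0∧xy≈0⇒y≈0 ω≉0 (begin
      ω * (s * s)                                   ≈⟨ solve 3 (λ w s g →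
        w :* (s :* s) := w :* (s :* s) :+ s :* con false :+ g :* (con false :* con false)) refl ω s γ/ω ⟩
      ω * (s * s) + s * 0# + γ/ω * (0# * 0#)        ≈⟨ +-cong (+-congˡ (*-congˡ d≈0)) (*-congˡ (*-cong d≈0 d≈0)) ⟨
      ω * (s * s) + s * d + γ/ω * (d * d)           ≈⟨ eq ⟩
      0#                                            ∎)) , d≈0
    ... | no d≉0 = contradiction (x≉0∧xy≈0⇒y≈0 (*-≉0 d≉0 d≉0) (begin
      d * d * (t * t + t + γ)
        ≈⟨ solve 3 (λ d t g → d :* d :* (t :* t :+ t :+ g)
          := (d :* t) :* (d :* t) :+ (d :* t) :* d :+ g :* (d :* d)) refl d t γ ⟩
      (d * t) * (d * t) + (d * t) * d + γ * (d * d)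
        ≈⟨ +-cong (+-cong (*-cong dt≈ωs dt≈ωs) (*-congʳ dt≈ωs)) (*-congʳ (sym ω*γ/ω≈γ)) ⟩
      (ω * s) * (ω * s) + (ω * s) * d + (ω * γ/ω) * (d * d)
        ≈⟨ solve 4 (λ w s d g → (w :* s) :* (w :* s) :+ (w :* s) :* d :+ (w :* g) :* (d :* d)
          := w :* (w :* (s :* s) :+ s :* d :+ g :* (d :* d))) refl ω s d γ/ω ⟩
      ω * (ω * (s * s) + s * d + γ/ω * (d * d))     ≈⟨ *-congˡ eq ⟩
      ω * 0#                                        ≈⟨ zeroʳ ω ⟩
      0#                                            ∎)) (rootless t)
      where
      t = d ⁻¹ * (ω * s)
      dt≈ωs : d * t ≈ ω * s
      dt≈ωs = trans (sym (*-assoc _ _ _)) (trans (*-congʳ (*-inverseʳ d≉0)) (*-identityˡ _))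

    -- The hyperplane u₀ = 0 is tangent to the quadric: on it f reduces to the anisotropic binary
    -- form, so (0, 1, 0, 0) spans its only singular point.
    isotropic-u₀≈0 : ∀ u → f u ≈ 0# → u 0F ≈ 0# → u 2F ≈ 0# × u 3F ≈ 0#
    isotropic-u₀≈0 u fu≈0 u₀≈0 = anisotropic (u 2F) (u 3F)
      (trans (sym (trans (+-congʳ (trans (*-congʳ u₀≈0) (zeroˡ _))) (+-identityˡ _))) fu≈0)

    B-u₂,u₃≈0 : ∀ u w → w 0F ≈ 0# → w 2F ≈ 0# → w 3F ≈ 0# → B u w ≈ u 0F * (ω * w 1F)
    B-u₂,u₃≈0 u w w₀≈0 w₂≈0 w₃≈0 = begin
      B u w ≈⟨ B-congʳ u {w} {w′} (λ { 0F → w₀≈0 ; 1F → refl ; 2F → w₂≈0 ; 3F → w₃≈0 }) ⟩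
      B u w′ ≈⟨ solve 6 (λ u₀ u₁ u₂ u₃ w₁ o →
        u₀ :* (o :* w₁ :+ (o :+ con true) :* con false)
          :+ con false :* (o :* u₁ :+ (o :+ con true) :* u₃) :+ (u₂ :* con false :+ con false :* u₃)
        := u₀ :* (o :* w₁)) refl (u 0F) (u 1F) (u 2F) (u 3F) (w 1F) ω ⟩
      u 0F * (ω * w 1F) ∎
      where
      w′ : Coords⁴
      w′ = 0# Vector.∷ w 1F Vector.∷ 0# Vector.∷ 0# Vector.∷ Vector.[]

    -- f is an elliptic quadratic form on Coords⁴, so its quadric contains no lines.
    no-isotropic-lines : ∀ u w → f u ≈ 0# → f w ≈ 0# → B u w ≈ 0# → Nonzero u →
      ∃[ k ] w ≋ k ⊙ u
    no-isotropic-lines u w fu≈0 fw≈0 Buw≈0 (i , uᵢ≉0) with u 0F ≟ 0#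
    ... | yes u₀≈0 = u 1F ⁻¹ * w 1F , λ where
            0F → both-0 w₀≈0 u₀≈0
            1F → sym (trans (solve 3 (λ a b c → a :* b :* c := c :* a :* b) refl _ _ (u 1F))
                   (trans (*-congʳ (*-inverseʳ u₁≉0)) (*-identityˡ _)))
            2F → both-0 (proj₁ w₂₃≈0) (proj₁ u₂₃≈0)
            3F → both-0 (proj₂ w₂₃≈0) (proj₂ u₂₃≈0)
      where
      both-0 : ∀ {x y k} → x ≈ 0# → y ≈ 0# → x ≈ k * y
      both-0 x≈0 y≈0 = trans x≈0 (sym (trans (*-congˡ y≈0) (zeroʳ _)))
      u₂₃≈0 = isotropic-u₀≈0 u fu≈0 u₀≈0
      u₁≉0 : u 1F ≉ 0#
      u₁≉0 u₁≈0 = uᵢ≉0 (all-0 i)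
        where
        all-0 : ∀ i → u i ≈ 0#
        all-0 0F = u₀≈0
        all-0 1F = u₁≈0
        all-0 2F = proj₁ u₂₃≈0
        all-0 3F = proj₂ u₂₃≈0
      w₀≈0 : w 0F ≈ 0#
      w₀≈0 = x≉0∧xy≈0⇒y≈0 (*-≉0 ω≉0 u₁≉0) (trans (*-comm _ _)
        (trans (sym (B-u₂,u₃≈0 w u u₀≈0 (proj₁ u₂₃≈0) (proj₂ u₂₃≈0))) (trans (B-sym w u) Buw≈0)))
      w₂₃≈0 = isotropic-u₀≈0 w fw≈0 w₀≈0
    -- k is chosen so that v = w + k u has v₀ = 0. As v is still singular, it is a multiple of (0,
    -- 1, 0, 0), and B u v = u₀ ω v₁ = 0 removes the last coordinate.
    ... | no u₀≉0 = k , λ j → x+y≈0⇒x≈y (v≈0 j)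
      where
      k = w 0F * u 0F ⁻¹
      v = w ⊕ k ⊙ u
      v₀≈0 : v 0F ≈ 0#
      v₀≈0 = x≈y⇒x+y≈0 (sym (trans (*-assoc _ _ _)
        (trans (*-congˡ (*-inverseˡ u₀≉0)) (*-identityʳ _))))
      fv≈0 : f v ≈ 0#
      fv≈0 = begin
        f (w ⊕ k ⊙ u)                          ≈⟨ f-⊕ w (k ⊙ u) ⟩
        f w + f (k ⊙ u) + B w (k ⊙ u)          ≈⟨ +-cong (+-cong fw≈0 (f-⊙ k u)) (B-⊙ʳ w k u) ⟩
        0# + k * k * f u + k * B w u           ≈⟨ +-cong (+-congˡ (*-congˡ fu≈0)) (*-congˡ (trans (B-sym w u) Buw≈0)) ⟩
        0# + k * k * 0# + k * 0#               ≈⟨ solve 1 (λ k →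
          con false :+ k :* k :* con false :+ k :* con false := con false) refl k ⟩
        0#                                     ∎
      v₂₃≈0 = isotropic-u₀≈0 v fv≈0 v₀≈0
      v₁≈0 : v 1F ≈ 0#
      v₁≈0 = x≉0∧xy≈0⇒y≈0 ω≉0 (x≉0∧xy≈0⇒y≈0 u₀≉0 (begin
        u 0F * (ω * v 1F)       ≈⟨ B-u₂,u₃≈0 u v v₀≈0 (proj₁ v₂₃≈0) (proj₂ v₂₃≈0) ⟨
        B u v                   ≈⟨ B-⊕ʳ u w (k ⊙ u) ⟩
        B u w + B u (k ⊙ u)     ≈⟨ +-cong Buw≈0 (trans (B-⊙ʳ u k u) (trans (*-congˡ (B-self u)) (zeroʳ k))) ⟩
        0# + 0#                 ≈⟨ +-identityˡ 0# ⟩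
        0#                      ∎))
      v≈0 : ∀ j → v j ≈ 0#
      v≈0 0F = v₀≈0
      v≈0 1F = v₁≈0
      v≈0 2F = proj₁ v₂₃≈0
      v≈0 3F = proj₂ v₂₃≈0

    -- The map `baer` and the normalised lifts of Baer vectors.

    baer : Coords⁴ → Coords
    baer u = u 0F Vector.∷ conj (u 0F) Vector.∷ Tr (u 2F) + u 3F * μ
      Vector.∷ conj (u 1F) Vector.∷ u 1F Vector.∷ u 3F Vector.∷ Vector.[]

    μ-∈𝔽q : μ ∈ 𝔽q
    μ-∈𝔽q = Tr-∈𝔽q _

    Tr-cong : ∀ {x y} → x ≈ y → Tr x ≈ Tr y
    Tr-cong x≈y = +-cong x≈y (conj-cong x≈y)

    Tr-+ : ∀ x y → Tr (x + y) ≈ Tr x + Tr y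
    Tr-+ x y = trans (+-congˡ (conj-+ x y))
      (solve 4 (λ x y x̄ ȳ → x :+ y :+ (x̄ :+ ȳ) := x :+ x̄ :+ (y :+ ȳ)) refl x y (conj x) (conj y))

    Tr-* : ∀ {k} x → k ∈ 𝔽q → Tr (k * x) ≈ k * Tr x
    Tr-* {k} x k∈ = trans (+-congˡ (trans (conj-* k x) (*-congʳ k∈))) (sym (distribˡ k x _))

    baer-cong : ∀ {u w} → u ≋ w → baer u ≋ baer w
    baer-cong u≋w = λ where
      0F → u≋w 0F
      1F → conj-cong (u≋w 0F)
      2F → +-cong (Tr-cong (u≋w 2F)) (*-congʳ (u≋w 3F))
      3F → conj-cong (u≋w 1F)
      4F → u≋w 1F
      5F → u≋w 3F

    baer-⊕ : ∀ u w → baer (u ⊕ w) ≋ baer u ⊕ baer w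
    baer-⊕ u w = λ where
      0F → refl
      1F → conj-+ _ _
      2F → trans (+-congʳ (Tr-+ _ _)) (solve 5 (λ s t d e m →
        s :+ t :+ (d :+ e) :* m := s :+ d :* m :+ (t :+ e :* m)) refl _ _ (u 3F) (w 3F) μ)
      3F → conj-+ _ _
      4F → refl
      5F → refl

    baer-⊙ : ∀ {k} → k ∈ 𝔽q → ∀ u → baer (k ⊙ u) ≋ k ⊙ baer u
    baer-⊙ {k} k∈ u = λ where
      0F → refl
      1F → trans (conj-* _ _) (*-congʳ k∈)
      2F → trans (+-congʳ (Tr-* _ k∈)) (solve 4 (λ k t d m →
        k :* t :+ k :* d :* m := k :* (t :+ d :* m)) refl k _ (u 3F) μ)
      3F → trans (conj-* _ _) (*-congʳ k∈)
      4F → refl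
      5F → refl

    baer-∈ : ∀ u → u 3F ∈ 𝔽q → baer u ∈ BaerVector
    baer-∈ u u₃∈ = u 0F , conj (u 1F) , _ , u 3F ,
      𝔽q-+ (Tr-∈𝔽q (u 2F)) (𝔽q-* u₃∈ μ-∈𝔽q) , u₃∈ , λ where
      0F → refl
      1F → refl
      2F → refl
      3F → refl
      4F → sym (conj-involutive _)
      5F → refl

    -- The permutation that conjugation induces on the coordinates of a Baer vector.
    swap : Fin 6 → Fin 6
    swap 0F = 1F
    swap 1F = 0F
    swap 2F = 2F
    swap 3F = 4F
    swap 4F = 3F
    swap 5F = 5F

    conj-baer : ∀ u → u 3F ∈ 𝔽q → ∀ i → conj (baer u i) ≈ baer u (swap i)
    conj-baer u u₃∈ 0F = refl
    conj-baer u u₃∈ 1F = conj-involutive _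
    conj-baer u u₃∈ 2F = 𝔽q-+ (Tr-∈𝔽q _) (𝔽q-* u₃∈ μ-∈𝔽q)
    conj-baer u u₃∈ 3F = conj-involutive _
    conj-baer u u₃∈ 4F = refl
    conj-baer u u₃∈ 5F = u₃∈

    -- Conjugating uᵢ = k wᵢ and comparing with the same relation at the swapped index shows that k
    -- and its conjugate agree. Proportionality over K of Baer vectors is therefore proportionality
    -- over 𝔽q.
    scalar-∈𝔽q : ∀ {k} u w → u 3F ∈ 𝔽q → w 3F ∈ 𝔽q → Nonzero (baer u) → baer u ≋ k ⊙ baer w → k ∈ 𝔽q
    scalar-∈𝔽q {k} u w u₃∈ w₃∈ (i , uᵢ≉0) u≋kw = *-cancelˡ w̄ᵢ≉0 (begin
      conj (baer w i) * conj k     ≈⟨ trans (*-comm _ _) (sym (conj-* k _)) ⟩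
      conj (k * baer w i)          ≈⟨ conj-cong (u≋kw i) ⟨
      conj (baer u i)              ≈⟨ conj-baer u u₃∈ i ⟩
      baer u (swap i)              ≈⟨ u≋kw (swap i) ⟩
      k * baer w (swap i)          ≈⟨ *-congˡ (conj-baer w w₃∈ i) ⟨
      k * conj (baer w i)          ≈⟨ *-comm _ _ ⟩
      conj (baer w i) * k          ∎)
      where
      w̄ᵢ≉0 : conj (baer w i) ≉ 0#
      w̄ᵢ≉0 = conj-≉0 λ wᵢ≈0 → uᵢ≉0 (trans (u≋kw i) (trans (*-congˡ wᵢ≈0) (zeroʳ k)))

    -- The second condition is what makes the preimage of a vector under baer unique.
    Lift : Pred Coords⁴ ℓ₁
    Lift u = u 3F ∈ 𝔽q × f u ∈ 𝔽q

    -- Two preimages differ only by some σ ∈ 𝔽q in the third coordinate. If both values of f are in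
    -- 𝔽q, so is ω σ², whose trace is σ²; hence σ = 0.
    lift-unique : ∀ u w → Lift u → Lift w → baer u ≋ baer w → u ≋ w
    lift-unique u w (u₃∈ , fu∈) (w₃∈ , fw∈) eq = λ where
        0F → eq 0F
        1F → eq 4F
        2F → x+y≈0⇒x≈y σ≈0
        3F → eq 5F
      where
      σ = u 2F + w 2F
      σ∈ : σ ∈ 𝔽q
      σ∈ = Tr≈0⇒∈𝔽q (begin
        Tr (u 2F + w 2F)             ≈⟨ Tr-+ _ _ ⟩
        Tr (u 2F) + Tr (w 2F)        ≈⟨ solve 3 (λ x y z → x :+ y := x :+ z :+ (y :+ z)) refl _ _ (w 3F * μ) ⟩
        (Tr (u 2F) + w 3F * μ) + baer w 2F   ≈⟨ +-congʳ (+-congˡ (*-congʳ (eq 5F))) ⟨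
        baer u 2F + baer w 2F        ≈⟨ x≈y⇒x+y≈0 (eq 2F) ⟩
        0#                           ∎)
      w′ : Coords⁴
      w′ = u 0F Vector.∷ u 1F Vector.∷ w 2F Vector.∷ u 3F Vector.∷ Vector.[]
      ωσ² : ω * (σ * σ) ≈ f u + f w + σ * u 3F
      ωσ² = begin
        ω * (σ * σ)            ≈⟨ solve 7 (λ u₀ u₁ u₂ u₃ w₂ o g →
          o :* ((u₂ :+ w₂) :* (u₂ :+ w₂))
          := (u₀ :* (o :* u₁ :+ (o :+ con true) :* u₃) :+ (o :* (u₂ :* u₂) :+ u₂ :* u₃ :+ g :* (u₃ :* u₃)))
            :+ (u₀ :* (o :* u₁ :+ (o :+ con true) :* u₃) :+ (o :* (w₂ :* w₂) :+ w₂ :* u₃ :+ g :* (u₃ :* u₃)))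
            :+ (u₂ :+ w₂) :* u₃) refl (u 0F) (u 1F) (u 2F) (u 3F) (w 2F) ω γ/ω ⟩
        f u + f w′ + σ * u 3F
          ≈⟨ +-congʳ (+-congˡ (f-cong {w′} {w} λ { 0F → eq 0F ; 1F → eq 4F ; 2F → refl ; 3F → eq 5F })) ⟩
        f u + f w + σ * u 3F   ∎
      σ≈0 : σ ≈ 0#
      σ≈0 = x*x≈0⇒x≈0 (trans (sym (Tr-ω* (𝔽q-* σ∈ σ∈))) (∈𝔽q⇒Tr≈0
        (𝔽q-resp (sym ωσ²) (𝔽q-+ (𝔽q-+ fu∈ fw∈) (𝔽q-* σ∈ u₃∈)))))

    -- s₀ is ω times the trace that the third coordinate requires. Adding σ ∈ 𝔽q keeps that trace
    -- and adds σ² to the trace of f, so σ is taken to be the square root of τ, the trace at the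
    -- first attempt u₀.
    lift : ∀ {v} → v ∈ BaerVector → ∃[ u ] Lift u × baer u ≋ v
    lift {v} (α , β , δ₀ , δ₁ , δ₀∈ , δ₁∈ , v≈) = u , (δ₁∈ , fu∈) , λ where
        0F → sym (v≈ 0F)
        1F → sym (v≈ 1F)
        2F → trans 2F≈ (sym (v≈ 2F))
        3F → trans (conj-involutive β) (sym (v≈ 3F))
        4F → sym (v≈ 4F)
        5F → sym (v≈ 5F)
      where
      s₀ = ω * (δ₀ + δ₁ * μ)
      u₀ u : Coords⁴
      u₀ = α Vector.∷ conj β Vector.∷ s₀ Vector.∷ δ₁ Vector.∷ Vector.[]
      τ = Tr (f u₀)
      σ = sqrt τ
      u = α Vector.∷ conj β Vector.∷ s₀ + σ Vector.∷ δ₁ Vector.∷ Vector.[]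
      σ∈ : σ ∈ 𝔽q
      σ∈ = sqrt-∈𝔽q (Tr-∈𝔽q _)
      fu∈ : f u ∈ 𝔽q
      fu∈ = Tr≈0⇒∈𝔽q (begin
        Tr (f u)                                    ≈⟨ Tr-cong (solve 7 (λ u₀ u₁ u₂ u₃ w₂ o g →
          u₀ :* (o :* u₁ :+ (o :+ con true) :* u₃)
            :+ (o :* ((u₂ :+ w₂) :* (u₂ :+ w₂)) :+ (u₂ :+ w₂) :* u₃ :+ g :* (u₃ :* u₃))
          := (u₀ :* (o :* u₁ :+ (o :+ con true) :* u₃) :+ (o :* (u₂ :* u₂) :+ u₂ :* u₃ :+ g :* (u₃ :* u₃)))
            :+ (o :* (w₂ :* w₂) :+ w₂ :* u₃)) refl α (conj β) s₀ δ₁ σ ω γ/ω) ⟩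
        Tr (f u₀ + (ω * (σ * σ) + σ * δ₁))          ≈⟨ trans (Tr-+ _ _) (+-congˡ (Tr-+ _ _)) ⟩
        τ + (Tr (ω * (σ * σ)) + Tr (σ * δ₁))
          ≈⟨ +-congˡ (+-cong (Tr-ω* (𝔽q-* σ∈ σ∈)) (∈𝔽q⇒Tr≈0 (𝔽q-* σ∈ δ₁∈))) ⟩
        τ + (σ * σ + 0#)                            ≈⟨ +-congˡ (+-identityʳ _) ⟩
        τ + σ * σ                                   ≈⟨ x≈y⇒x+y≈0 (sym (sqrt-square τ)) ⟩
        0#                                          ∎)
      2F≈ : Tr (s₀ + σ) + δ₁ * μ ≈ δ₀
      2F≈ = begin
        Tr (s₀ + σ) + δ₁ * μ             ≈⟨ +-congʳ (Tr-+ s₀ σ) ⟩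
        Tr s₀ + Tr σ + δ₁ * μ            ≈⟨ +-congʳ (+-cong (Tr-ω* (𝔽q-+ δ₀∈ (𝔽q-* δ₁∈ μ-∈𝔽q))) (∈𝔽q⇒Tr≈0 σ∈)) ⟩
        δ₀ + δ₁ * μ + 0# + δ₁ * μ        ≈⟨ solve 2 (λ x y → x :+ y :+ con false :+ y := x) refl δ₀ (δ₁ * μ) ⟩
        δ₀                               ∎

    -- Once the conjugated coordinates of `baer w` are replaced by swapped ones, the two terms with
    -- μ cancel and the others fall into B u w and its conjugate. The sum ω + 1 + 1 stands for the
    -- conjugate of ω + 1.
    h-baer : ∀ u w → u 3F ∈ 𝔽q → w 3F ∈ 𝔽q → h (baer u) (baer w) ≈ Tr (B u w)
    h-baer u w u₃∈ w₃∈ = begin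
      h (baer u) (baer w)
        ≈⟨ +-cong (+-cong (+-cong (+-cong (+-cong (+-cong (+-cong (+-cong (+-cong
             (*-congˡ (w̄ 3F)) (*-cong (*-congʳ ω̄≈ω+1) (w̄ 5F))) (*-cong (*-congʳ ω̄≈ω+1) (w̄ 4F)))
             (*-congˡ (w̄ 5F))) (*-congˡ (w̄ 5F))) (*-cong (*-congʳ ω̄≈ω+1) (w̄ 0F))) (*-congˡ (w̄ 1F)))
             (*-congˡ (w̄ 0F))) (*-cong (*-congʳ ω̄≈ω+1) (w̄ 1F))) (*-congˡ (w̄ 2F)) ⟩
      ω * u 0F * w 1F + (ω + 1#) * u 0F * w 3F + (ω + 1#) * conj (u 0F) * conj (w 1F)
        + ω * conj (u 0F) * w 3F + baer u 2F * w 3F + (ω + 1#) * conj (u 1F) * conj (w 0F)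
        + ω * u 1F * w 0F + ω * u 3F * conj (w 0F) + (ω + 1#) * u 3F * w 0F + u 3F * baer w 2F
        ≈⟨ solve 16 (λ u₀ u₁ u₂ u₃ w₀ w₁ w₂ w₃ ū₀ ū₁ ū₂ w̄₀ w̄₁ w̄₂ o m →
             o :* u₀ :* w₁ :+ (o :+ con true) :* u₀ :* w₃ :+ (o :+ con true) :* ū₀ :* w̄₁
             :+ o :* ū₀ :* w₃ :+ (u₂ :+ ū₂ :+ u₃ :* m) :* w₃ :+ (o :+ con true) :* ū₁ :* w̄₀
             :+ o :* u₁ :* w₀ :+ o :* u₃ :* w̄₀ :+ (o :+ con true) :* u₃ :* w₀ :+ u₃ :* (w₂ :+ w̄₂ :+ w₃ :* m)
             := (u₀ :* (o :* w₁ :+ (o :+ con true) :* w₃) :+ w₀ :* (o :* u₁ :+ (o :+ con true) :* u₃)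
                  :+ (u₂ :* w₃ :+ w₂ :* u₃))
             :+ (ū₀ :* ((o :+ con true) :* w̄₁ :+ (o :+ con true :+ con true) :* w₃)
                  :+ w̄₀ :* ((o :+ con true) :* ū₁ :+ (o :+ con true :+ con true) :* u₃)
                  :+ (ū₂ :* w₃ :+ w̄₂ :* u₃))) refl
             (u 0F) (u 1F) (u 2F) (u 3F) (w 0F) (w 1F) (w 2F) (w 3F)
             (conj (u 0F)) (conj (u 1F)) (conj (u 2F)) (conj (w 0F)) (conj (w 1F)) (conj (w 2F)) ω μ ⟩
      B u w + (conj (u 0F) * ((ω + 1#) * conj (w 1F) + (ω + 1# + 1#) * w 3F)
        + conj (w 0F) * ((ω + 1#) * conj (u 1F) + (ω + 1# + 1#) * u 3F)
        + (conj (u 2F) * w 3F + conj (w 2F) * u 3F))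
        ≈⟨ +-congˡ (conj-⟦⟧
             (var 0F :* (var 8F :* var 5F :+ (var 8F :+ con true) :* var 7F)
               :+ var 4F :* (var 8F :* var 1F :+ (var 8F :+ con true) :* var 3F)
               :+ (var 2F :* var 7F :+ var 6F :* var 3F))
             (refl ∷ refl ∷ refl ∷ u₃∈ ∷ refl ∷ refl ∷ refl ∷ w₃∈ ∷ ω̄≈ω+1 ∷ [])) ⟨
      Tr (B u w) ∎
      where
      w̄ : ∀ i → conj (baer w i) ≈ baer w (swap i)
      w̄ = conj-baer w w₃∈

    -- The group orbit of `S γ` as a set of singular vectors.

    ι ῑ : Carrier
    ι = ω ⁻¹
    ῑ = conj ω ⁻¹

    ω̄≉0 : conj ω ≉ 0#
    ω̄≉0 = conj-≉0 ω≉0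

    ῑ≈conj-ι : conj ι ≈ ῑ
    ῑ≈conj-ι = *-cancelˡ ω̄≉0 (begin
      conj ω * conj ι    ≈⟨ conj-* ω ι ⟨
      conj (ω * ι)       ≈⟨ conj-cong (*-inverseʳ ω≉0) ⟩
      conj 1#            ≈⟨ conj-1 ⟩
      1#                 ≈⟨ *-inverseʳ ω̄≉0 ⟨
      conj ω * ῑ         ∎)

    ωι+1≈0 : ω * ι + 1# ≈ 0#
    ωι+1≈0 = x≈y⇒x+y≈0 (*-inverseʳ ω≉0)

    [ω+1]ῑ+1≈0 : (ω + 1#) * ῑ + 1# ≈ 0#
    [ω+1]ῑ+1≈0 = x≈y⇒x+y≈0 (trans (*-congʳ (sym ω̄≈ω+1)) (*-inverseʳ ω̄≉0))

    -- Divide ω + ω̄ = 1 by ω ω̄. This splits the entry `1# ÷ ω ^ suc q` of `matrix` into two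
    -- conjugate halves.
    [ωω̄]⁻¹≈ι+ῑ : (ω * conj ω) ⁻¹ ≈ ι + ῑ
    [ωω̄]⁻¹≈ι+ῑ = *-cancelˡ (*-≉0 ω≉0 ω̄≉0) (begin
      ω * conj ω * (ω * conj ω) ⁻¹    ≈⟨ *-inverseʳ (*-≉0 ω≉0 ω̄≉0) ⟩
      1#                              ≈⟨ ω+ω̄≈1 ⟨
      ω + conj ω                      ≈⟨ +-cong (trans (sym (*-identityʳ ω)) (*-congˡ (sym (*-inverseʳ ω̄≉0))))
                                           (trans (sym (*-identityʳ _)) (*-congˡ (sym (*-inverseʳ ω≉0)))) ⟩
      ω * (conj ω * ῑ) + conj ω * (ω * ι)  ≈⟨ solve 4 (λ w w̄ i ī →
        w :* (w̄ :* ī) :+ w̄ :* (w :* i) := w :* w̄ :* (i :+ ī)) refl ω (conj ω) ι ῑ ⟩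
      ω * conj ω * (ι + ῑ)            ∎)

    -- For identities that hold only modulo a relation z = 0, such as ω ι = 1 or a d + b c = 1: the
    -- ring solver checks the identity with an explicit cofactor e, and the relation discards the
    -- extra term.
    modulo : ∀ {x y e z} → z ≈ 0# → x ≈ y + e * z → x ≈ y
    modulo {e = e} z≈0 eq = trans eq (trans (+-congˡ (trans (*-congˡ z≈0) (zeroʳ e))) (+-identityʳ _))

    -- Let β be the bilinear form with β((a, c), (b, d)) = γ a b + b c + c d, and N x = β(x, x). For
    -- x = (a, c) and y = (b, d) the coordinates are N x / ω, (N y + ω̄) / ω, β(x, y) / ω and 1. The
    -- identity of the group gives (γ/ω, 1, 0, 1), the lift of `S γ`.
    orbitLift : (a b c d : Carrier) → Coords⁴
    orbitLift a b c d = a * a * γ/ω + (a * c + c * c) * ι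
      Vector.∷ b * b * γ/ω + (b * d + d * d + (ω + 1#)) * ι
      Vector.∷ a * b * γ/ω + (b * c + c * d) * ι
      Vector.∷ 1# Vector.∷ Vector.[]

    -- With T = β(x, y) and Δ = a d + b c, the Gram determinant of β gives N x N y = T² + T Δ + γ
    -- Δ². For Δ = 1 this is the vanishing of ω f.
    f-orbitLift : ∀ a b c d → a * d + b * c ≈ 1# → f (orbitLift a b c d) ≈ 0#
    f-orbitLift a b c d Δ≈1 = x≉0∧xy≈0⇒y≈0 ω≉0 (begin
      ω * f (orbitLift a b c d)
        ≈⟨ solve 8 (λ a b c d g i p o →
          o :* ((a :* a :* p :+ (a :* c :+ c :* c) :* i)
            :* (o :* (b :* b :* p :+ (b :* d :+ d :* d :+ (o :+ con true)) :* i) :+ (o :+ con true) :* con true)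
            :+ (o :* ((a :* b :* p :+ (b :* c :+ c :* d) :* i) :* (a :* b :* p :+ (b :* c :+ c :* d) :* i))
              :+ (a :* b :* p :+ (b :* c :+ c :* d) :* i) :* con true :+ p :* (con true :* con true)))
          := (a :* a :* (o :* p) :+ (a :* c :+ c :* c) :* (o :* i))
            :* (b :* b :* (o :* p) :+ (b :* d :+ d :* d :+ (o :+ con true)) :* (o :* i) :+ (o :+ con true))
            :+ (a :* b :* (o :* p) :+ (b :* c :+ c :* d) :* (o :* i))
              :* (a :* b :* (o :* p) :+ (b :* c :+ c :* d) :* (o :* i))
            :+ (a :* b :* (o :* p) :+ (b :* c :+ c :* d) :* (o :* i)) :+ o :* p)
          refl a b c d γ ι γ/ω ω ⟩
      F (ω * γ/ω) (ω * ι)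
        ≈⟨ +-cong (+-cong (+-cong (*-cong (+-cong (*-congˡ ω*γ/ω≈γ) (*-congˡ ωι≈1))
             (+-congʳ (+-cong (*-congˡ ω*γ/ω≈γ) (*-congˡ ωι≈1)))) (*-cong T≈ T≈)) T≈) ω*γ/ω≈γ ⟩
      F γ 1#
        ≈⟨ modulo (x≈y⇒x+y≈0 Δ≈1) (solve 6 (λ a b c d g o →
          (a :* a :* g :+ (a :* c :+ c :* c) :* con true)
            :* (b :* b :* g :+ (b :* d :+ d :* d :+ (o :+ con true)) :* con true :+ (o :+ con true))
            :+ (a :* b :* g :+ (b :* c :+ c :* d) :* con true) :* (a :* b :* g :+ (b :* c :+ c :* d) :* con true)
            :+ (a :* b :* g :+ (b :* c :+ c :* d) :* con true) :+ g
          := con false :+ ((a :* b :* g :+ b :* c :+ c :* d) :+ g :* (a :* d :+ b :* c :+ con true))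
            :* (a :* d :+ b :* c :+ con true)) refl a b c d γ ω) ⟩
      0# ∎)
      where
      ωι≈1 = *-inverseʳ ω≉0
      T : Carrier → Carrier → Carrier
      T x y = a * b * x + (b * c + c * d) * y
      F : Carrier → Carrier → Carrier
      F x y = (a * a * x + (a * c + c * c) * y)
        * (b * b * x + (b * d + d * d + (ω + 1#)) * y + (ω + 1#)) + T x y * T x y + T x y + x
      T≈ : T (ω * γ/ω) (ω * ι) ≈ T γ 1#
      T≈ = +-cong (*-congˡ ω*γ/ω≈γ) (*-congˡ ωι≈1)

    x^2q≈x̄^2 : ∀ x → x ^ (2 ℕ.* q) ≈ conj x ^ 2
    x^2q≈x̄^2 x = trans (^-congʳ x (ℕ.*-comm 2 q)) (sym (^-assocʳ x q 2))

    -- In the first row c² + c² ω̄ / ω = c² / ω, because ω + ω̄ = 1, and the fifth row works in the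
    -- same way; the second and fourth are their conjugates. In the third row a d + b c = 1 and its
    -- conjugate trade a d / ω + 1 / ω for b c / ω, and likewise for the conjugate terms.
    matrix·S : ∀ a b c d → a * d + b * c ≈ 1# → matrix a b c d · S γ ≋ baer (orbitLift a b c d)
    matrix·S a b c d Δ≈1 = λ where
        0F → row₀
        1F → row₁
        2F → row₂
        3F → row₃
        4F → row₄
        5F → solve 3 (λ s₀ s₁ s₂ → con false :* s₀ :+ (con false :* s₁ :+ (con false :* s₂ :+
          (con false :* con true :+ (con false :* con true :+ (con true :* con true :+ con false)))))
          := con true) refl _ _ _
      where
      ā b̄ c̄ d̄ γ̄ : Carrier
      ā = conj a
      b̄ = conj b
      c̄ = conj c
      d̄ = conj d
      γ̄ = conj γ

      row : ∀ {m₀ m₁ m₂ m₃ m₄ m₅ s₀ s₁ s₂ n₀ n₁ n₂ n₃ n₄ n₅ t₀ t₁ t₂} →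
        m₀ ≈ n₀ → m₁ ≈ n₁ → m₂ ≈ n₂ → m₃ ≈ n₃ → m₄ ≈ n₄ → m₅ ≈ n₅ → s₀ ≈ t₀ → s₁ ≈ t₁ → s₂ ≈ t₂ →
        m₀ * s₀ + (m₁ * s₁ + (m₂ * s₂ + (m₃ * 1# + (m₄ * 1# + (m₅ * 1# + 0#)))))
        ≈ n₀ * t₀ + n₁ * t₁ + n₂ * t₂ + n₃ + n₄ + n₅
      row {n₀ = n₀} {n₁} {n₂} {n₃} {n₄} {n₅} {t₀} {t₁} {t₂} e₀ e₁ e₂ e₃ e₄ e₅ e₆ e₇ e₈ = trans
        (+-cong (*-cong e₀ e₆) (+-cong (*-cong e₁ e₇) (+-cong (*-cong e₂ e₈)
          (+-cong (*-congʳ e₃) (+-cong (*-congʳ e₄) (+-congʳ (*-congʳ e₅)))))))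
        (solve 9 (λ n₀ n₁ n₂ n₃ n₄ n₅ t₀ t₁ t₂ → n₀ :* t₀ :+ (n₁ :* t₁ :+ (n₂ :* t₂ :+
          (n₃ :* con true :+ (n₄ :* con true :+ (n₅ :* con true :+ con false)))))
          := n₀ :* t₀ :+ n₁ :* t₁ :+ n₂ :* t₂ :+ n₃ :+ n₄ :+ n₅) refl n₀ n₁ n₂ n₃ n₄ n₅ t₀ t₁ t₂)

      row₀ : (matrix a b c d · S γ) 0F ≈ orbitLift a b c d 0F
      row₀ = trans
        (row refl refl refl refl refl (*-congʳ (*-congˡ (+-congˡ (*-congˡ ω̄≈ω+1)))) refl refl refl)
        (modulo ωι+1≈0 (solve 7 (λ a c p i o s₁ s₂ →
          a :^ 2 :* p :+ con false :* s₁ :+ con false :* s₂ :+ con false :+ c :^ 2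
            :+ c :* (a :+ c :* (o :+ con true)) :* i
          := a :* a :* p :+ (a :* c :+ c :* c) :* i :+ c :* c :* (o :* i :+ con true))
          refl a c γ/ω ι ω _ _))

      row₄ : (matrix a b c d · S γ) 4F ≈ orbitLift a b c d 1F
      row₄ = trans
        (row refl refl refl refl refl (*-congʳ (+-cong (*-congˡ (+-congˡ (*-congˡ ω̄≈ω+1))) ω̄≈ω+1)) refl refl refl)
        (modulo ωι+1≈0 (solve 7 (λ b d p i o s₁ s₂ →
          b :^ 2 :* p :+ con false :* s₁ :+ con false :* s₂ :+ con false :+ d :^ 2
            :+ (d :* (b :+ d :* (o :+ con true)) :+ (o :+ con true)) :* i
          := b :* b :* p :+ (b :* d :+ d :* d :+ (o :+ con true)) :* i :+ d :* d :* (o :* i :+ con true))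
          refl b d γ/ω ι ω _ _))

      row₁ : (matrix a b c d · S γ) 1F ≈ conj (orbitLift a b c d 0F)
      row₁ = trans
        (row refl (x^2q≈x̄^2 a) refl (x^2q≈x̄^2 c) refl refl refl refl refl)
        (trans (modulo [ω+1]ῑ+1≈0 (solve 7 (λ a c g i o s₀ s₂ →
          con false :* s₀ :+ a :^ 2 :* (g :* i) :+ con false :* s₂ :+ c :^ 2 :+ con false
            :+ c :* (a :+ c :* o) :* i
          := a :* a :* (g :* i) :+ (a :* c :+ c :* c) :* i :+ c :* c :* ((o :+ con true) :* i :+ con true))
          refl ā c̄ γ̄ ῑ ω _ _))
        (sym (conj-⟦⟧ (var 0F :* var 0F :* (var 2F :* var 3F) :+ (var 0F :* var 1F :+ var 1F :* var 1F) :* var 3F)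
          (refl ∷ refl ∷ refl ∷ ῑ≈conj-ι ∷ []))))

      row₃ : (matrix a b c d · S γ) 3F ≈ conj (orbitLift a b c d 1F)
      row₃ = trans
        (row refl (x^2q≈x̄^2 b) refl (x^2q≈x̄^2 d) refl refl refl refl refl)
        (trans (modulo [ω+1]ῑ+1≈0 (solve 7 (λ b d g i o s₀ s₂ →
          con false :* s₀ :+ b :^ 2 :* (g :* i) :+ con false :* s₂ :+ d :^ 2 :+ con false
            :+ (d :* (b :+ d :* o) :+ o) :* i
          := b :* b :* (g :* i) :+ (b :* d :+ d :* d :+ (o :+ con true :+ con true)) :* i
            :+ d :* d :* ((o :+ con true) :* i :+ con true))
          refl b̄ d̄ γ̄ ῑ ω _ _))
        (sym (conj-⟦⟧ (var 0F :* var 0F :* (var 2F :* var 3F)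
            :+ (var 0F :* var 1F :+ var 1F :* var 1F :+ (var 4F :+ con true)) :* var 3F)
          (refl ∷ refl ∷ refl ∷ ῑ≈conj-ι ∷ ω̄≈ω+1 ∷ []))))

      Δ̄≈1 : ā * d̄ + b̄ * c̄ ≈ 1#
      Δ̄≈1 = trans (sym (conj-⟦⟧ (var 0F :* var 1F :+ var 2F :* var 3F) (refl ∷ refl ∷ refl ∷ refl ∷ [])))
        (trans (conj-cong Δ≈1) conj-1)

      row₂ : (matrix a b c d · S γ) 2F ≈ baer (orbitLift a b c d) 2F
      row₂ = begin
        (matrix a b c d · S γ) 2F
          ≈⟨ row refl refl refl refl refl
               (+-cong (+-congʳ (*-congʳ (*-congˡ (+-congˡ (*-congˡ ω̄≈ω+1)))))
                 (trans (*-identityˡ _) [ωω̄]⁻¹≈ι+ῑ))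
               refl refl (+-congʳ (*-congʳ (*-congʳ ω̄≈ω+1))) ⟩
        a * b * γ/ω + ā * b̄ * (γ̄ * ῑ) + 1# * ((ω + 1#) * γ * ι + ω * γ̄ * ῑ) + c̄ * d̄ + c * d
          + (d * (a + c * (ω + 1#)) * ι + d̄ * (ā + c̄ * ω) * ῑ + (ι + ῑ))
          ≈⟨ solve 13 (λ a b c d g i ā b̄ c̄ d̄ ḡ ī o →
            a :* b :* (g :* i) :+ ā :* b̄ :* (ḡ :* ī)
              :+ con true :* ((o :+ con true) :* g :* i :+ o :* ḡ :* ī) :+ c̄ :* d̄ :+ c :* d
              :+ (d :* (a :+ c :* (o :+ con true)) :* i :+ d̄ :* (ā :+ c̄ :* o) :* ī :+ (i :+ ī))
            := a :* b :* (g :* i) :+ (b :* c :+ c :* d) :* i :+ (ā :* b̄ :* (ḡ :* ī) :+ (b̄ :* c̄ :+ c̄ :* d̄) :* ī)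
              :+ con true :* ((o :+ con true) :* (g :* i) :+ (o :+ con true :+ con true) :* (ḡ :* ī))
              :+ ī :* (ā :* d̄ :+ b̄ :* c̄ :+ con true) :+ i :* (a :* d :+ b :* c :+ con true)
              :+ c̄ :* d̄ :* ((o :+ con true) :* ī :+ con true) :+ c :* d :* (o :* i :+ con true))
            refl a b c d γ ι ā b̄ c̄ d̄ γ̄ ῑ ω ⟩
        a * b * γ/ω + (b * c + c * d) * ι + (ā * b̄ * (γ̄ * ῑ) + (b̄ * c̄ + c̄ * d̄) * ῑ)
          + 1# * ((ω + 1#) * γ/ω + (ω + 1# + 1#) * (γ̄ * ῑ))
          + ῑ * (ā * d̄ + b̄ * c̄ + 1#) + ι * (a * d + b * c + 1#)
          + c̄ * d̄ * ((ω + 1#) * ῑ + 1#) + c * d * (ω * ι + 1#)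
          ≈⟨ modulo (x≈y⇒x+y≈0 Δ̄≈1) (modulo (x≈y⇒x+y≈0 Δ≈1)
               (modulo [ω+1]ῑ+1≈0 (modulo ωι+1≈0 refl))) ⟩
        a * b * γ/ω + (b * c + c * d) * ι + (ā * b̄ * (γ̄ * ῑ) + (b̄ * c̄ + c̄ * d̄) * ῑ)
          + 1# * ((ω + 1#) * γ/ω + (ω + 1# + 1#) * (γ̄ * ῑ))
          ≈⟨ +-cong (+-congˡ (conj-⟦⟧
                 (var 0F :* var 1F :* (var 4F :* var 5F) :+ (var 1F :* var 2F :+ var 2F :* var 3F) :* var 5F)
                 (refl ∷ refl ∷ refl ∷ refl ∷ refl ∷ ῑ≈conj-ι ∷ [])))
               (*-congˡ (+-congˡ (conj-⟦⟧ ((var 2F :+ con true) :* (var 0F :* var 1F))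
                 (refl ∷ ῑ≈conj-ι ∷ ω̄≈ω+1 ∷ [])))) ⟨
        baer (orbitLift a b c d) 2F ∎

    -- f is affine in u₁ with leading coefficient ω u₀.
    u₁-determined : ∀ u w → f u ≈ 0# → f w ≈ 0# → u 0F ≉ 0# →
      u 0F ≈ w 0F → u 2F ≈ w 2F → u 3F ≈ w 3F → u 1F ≈ w 1F
    u₁-determined u w fu≈0 fw≈0 u₀≉0 u₀≈ u₂≈ u₃≈ = *-cancelˡ (*-≉0 u₀≉0 ω≉0) (x+y≈0⇒x≈y (begin
      u 0F * ω * u 1F + u 0F * ω * w 1F        ≈⟨ solve 7 (λ u₀ u₁ u₂ u₃ w₁ o g →
        u₀ :* o :* u₁ :+ u₀ :* o :* w₁
        := (u₀ :* (o :* u₁ :+ (o :+ con true) :* u₃) :+ (o :* (u₂ :* u₂) :+ u₂ :* u₃ :+ g :* (u₃ :* u₃)))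
          :+ (u₀ :* (o :* w₁ :+ (o :+ con true) :* u₃) :+ (o :* (u₂ :* u₂) :+ u₂ :* u₃ :+ g :* (u₃ :* u₃))))
        refl (u 0F) (u 1F) (u 2F) (u 3F) (w 1F) ω γ/ω ⟩
      f u + f w′                               ≈⟨ +-cong fu≈0 (trans
        (f-cong {w′} {w} λ { 0F → u₀≈ ; 1F → refl ; 2F → u₂≈ ; 3F → u₃≈ }) fw≈0) ⟩
      0# + 0#                                  ≈⟨ +-identityˡ 0# ⟩
      0#                                       ∎))
      where
      w′ : Coords⁴
      w′ = u 0F Vector.∷ w 1F Vector.∷ u 2F Vector.∷ u 3F Vector.∷ Vector.[]

    -- Matrices with a = 0 and b = 1 / c already suffice. Then `orbitLift` has first coordinate c² /
    -- ω, which determines c, and third coordinate (1 + c d) / ω, which determines d; f = 0 settles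
    -- the second. Anisotropy gives u₀ ≠ 0 and so makes c invertible.
    orbit-surjective : ∀ u → f u ≈ 0# → u 3F ≈ 1# →
      ∃[ a ] ∃[ b ] ∃[ c ] ∃[ d ] a * d + b * c ≈ 1# × u ≋ orbitLift a b c d
    orbit-surjective u fu≈0 u₃≈1 = 0# , b , c₀ , d , Δ≈1 , u≋w
      where
      u₀≉0 : u 0F ≉ 0#
      u₀≉0 u₀≈0 = 1≉0 (trans (sym u₃≈1) (proj₂ (isotropic-u₀≈0 u fu≈0 u₀≈0)))
      c₀ = sqrt (ω * u 0F)
      c₀²≈ : c₀ * c₀ ≈ ω * u 0F
      c₀²≈ = sqrt-square _
      c₀≉0 : c₀ ≉ 0#
      c₀≉0 c₀≈0 = *-≉0 ω≉0 u₀≉0 (trans (sym c₀²≈) (trans (*-congʳ c₀≈0) (zeroˡ _)))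
      b = c₀ ⁻¹
      d = (ω * u 2F + 1#) * c₀ ⁻¹
      w = orbitLift 0# b c₀ d
      bc≈1 : b * c₀ ≈ 1#
      bc≈1 = *-inverseˡ c₀≉0
      Δ≈1 : 0# * d + b * c₀ ≈ 1#
      Δ≈1 = trans (+-congʳ (zeroˡ d)) (trans (+-identityˡ _) bc≈1)
      fw≈0 : f w ≈ 0#
      fw≈0 = f-orbitLift 0# b c₀ d Δ≈1
      u₀≈ : u 0F ≈ w 0F
      u₀≈ = sym (begin
        0# * 0# * γ/ω + (0# * c₀ + c₀ * c₀) * ι   ≈⟨ solve 3 (λ c p i →
          con false :* con false :* p :+ (con false :* c :+ c :* c) :* i := c :* c :* i) refl c₀ γ/ω ι ⟩
        c₀ * c₀ * ι                              ≈⟨ *-congʳ c₀²≈ ⟩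
        ω * u 0F * ι                             ≈⟨ modulo ωι+1≈0 (solve 3 (λ o x i →
          o :* x :* i := x :+ x :* (o :* i :+ con true)) refl ω (u 0F) ι) ⟩
        u 0F                                     ∎)
      u₂≈ : u 2F ≈ w 2F
      u₂≈ = sym (begin
        0# * b * γ/ω + (b * c₀ + c₀ * d) * ι      ≈⟨ solve 6 (λ b c p i o x →
          con false :* b :* p :+ (b :* c :+ c :* ((o :* x :+ con true) :* b)) :* i
          := o :* x :* i :* (b :* c)) refl b c₀ γ/ω ι ω (u 2F) ⟩
        ω * u 2F * ι * (b * c₀)                  ≈⟨ trans (*-congˡ bc≈1) (*-identityʳ _) ⟩
        ω * u 2F * ι                             ≈⟨ modulo ωι+1≈0 (solve 3 (λ o x i →
          o :* x :* i := x :+ x :* (o :* i :+ con true)) refl ω (u 2F) ι) ⟩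
        u 2F                                     ∎)
      u≋w : u ≋ w
      u≋w 0F = u₀≈
      u≋w 1F = u₁-determined u w fu≈0 fw≈0 u₀≉0 u₀≈ u₂≈ u₃≈1
      u≋w 2F = u₂≈
      u≋w 3F = u₃≈1

    -- Points of `𝒪 γ` and singular vectors.

    quad : Coords → Carrier
    quad X = X 2F ^ 2 + X 0F * X 4F + X 1F * X 3F

    quad-⊙ : ∀ k {X v} → X ≋ k ⊙ v → quad X ≈ k * k * quad v
    quad-⊙ k {X} {v} X≋kv = trans
      (+-cong (+-cong (*-cong (X≋kv 2F) (*-congʳ (X≋kv 2F))) (*-cong (X≋kv 0F) (X≋kv 4F)))
        (*-cong (X≋kv 1F) (X≋kv 3F)))
      (solve 6 (λ k v₀ v₁ v₂ v₃ v₄ →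
        k :* v₂ :* (k :* v₂ :* con true) :+ k :* v₀ :* (k :* v₄) :+ k :* v₁ :* (k :* v₃)
        := k :* k :* (v₂ :^ 2 :+ v₀ :* v₄ :+ v₁ :* v₃)) refl k (v 0F) (v 1F) (v 2F) (v 3F) (v 4F))

    -- Ties the equation of `𝒬` to `f`: on u₃ = 0 one is the trace of u₂² + u₀ u₁, the other is ω
    -- times the same element.
    quad-baer : ∀ u → u 3F ≈ 0# → quad (baer u) ≈ Tr (u 2F * u 2F + u 0F * u 1F)
    quad-baer u u₃≈0 = begin
      quad (baer u)
        ≈⟨ +-congʳ (+-congʳ (*-cong baer₂≈ (*-congʳ baer₂≈))) ⟩
      Tr (u 2F) ^ 2 + u 0F * u 1F + conj (u 0F) * conj (u 1F)
        ≈⟨ solve 6 (λ u₀ u₁ u₂ ū₀ ū₁ ū₂ → (u₂ :+ ū₂) :^ 2 :+ u₀ :* u₁ :+ ū₀ :* ū₁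
          := u₂ :* u₂ :+ u₀ :* u₁ :+ (ū₂ :* ū₂ :+ ū₀ :* ū₁)) refl (u 0F) (u 1F) (u 2F) _ _ _ ⟩
      u 2F * u 2F + u 0F * u 1F + (conj (u 2F) * conj (u 2F) + conj (u 0F) * conj (u 1F))
        ≈⟨ +-congˡ (conj-⟦⟧ (var 0F :* var 0F :+ var 1F :* var 2F) (refl ∷ refl ∷ refl ∷ [])) ⟨
      Tr (u 2F * u 2F + u 0F * u 1F) ∎
      where
      baer₂≈ : baer u 2F ≈ Tr (u 2F)
      baer₂≈ = trans (+-congˡ (trans (*-congʳ u₃≈0) (zeroˡ μ))) (+-identityʳ _)

    f-u₃≈0 : ∀ u → u 3F ≈ 0# → f u ≈ ω * (u 2F * u 2F + u 0F * u 1F)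
    f-u₃≈0 u u₃≈0 = trans
      (f-cong {u} {u 0F Vector.∷ u 1F Vector.∷ u 2F Vector.∷ 0# Vector.∷ Vector.[]}
        (λ { 0F → refl ; 1F → refl ; 2F → refl ; 3F → u₃≈0 }))
      (solve 5 (λ u₀ u₁ u₂ o g →
        u₀ :* (o :* u₁ :+ (o :+ con true) :* con false)
          :+ (o :* (u₂ :* u₂) :+ u₂ :* con false :+ g :* (con false :* con false))
        := o :* (u₂ :* u₂ :+ u₀ :* u₁)) refl (u 0F) (u 1F) (u 2F) ω γ/ω)

    SingularVector : Pred Coords⁴ ℓ₁
    SingularVector u = u 3F ∈ 𝔽q × f u ≈ 0#

    singular⇒lift : ∀ u → SingularVector u → Lift u
    singular⇒lift u (u₃∈ , fu≈0) = u₃∈ , 𝔽q-resp (sym fu≈0) conj-0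

    singular-⊙ : ∀ {k} u → k ∈ 𝔽q → SingularVector u → SingularVector (k ⊙ u)
    singular-⊙ {k} u k∈ (u₃∈ , fu≈0) =
      𝔽q-* k∈ u₃∈ , trans (f-⊙ k u) (trans (*-congˡ fu≈0) (zeroʳ _))

    ∼-≋ : ∀ {u v w} → u ∼ v → v ≋ w → u ∼ w
    ∼-≋ (k , k≉0 , u≋kv) v≋w = k , k≉0 , λ i → trans (u≋kv i) (*-congˡ (v≋w i))

    𝒪⇒singular : ∀ P → P ∈ 𝒪 γ → ∃[ u ] SingularVector u × coords P ∼ baer u
    𝒪⇒singular P (inj₂ (a , b , c , d , Δ≈1 , P∼MS)) =
      orbitLift a b c d , (conj-1 , f-orbitLift a b c d Δ≈1) , ∼-≋ P∼MS (matrix·S a b c d Δ≈1)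
    𝒪⇒singular P (inj₁ ((v , v∈ , P∼v@(k , k≉0 , P≋kv)) , P₅≈0 , quadP≈0)) = u , (u₃∈ , fu≈0) , P∼u
      where
      u = proj₁ (lift v∈)
      u₃∈ = proj₁ (proj₁ (proj₂ (lift v∈)))
      fu∈ = proj₂ (proj₁ (proj₂ (lift v∈)))
      baer-u≋v = proj₂ (proj₂ (lift v∈))
      P∼u : coords P ∼ baer u
      P∼u = ∼-≋ P∼v (sym ∘ baer-u≋v)
      P≋ku = proj₂ (proj₂ P∼u)
      u₃≈0 : u 3F ≈ 0#
      u₃≈0 = x≉0∧xy≈0⇒y≈0 k≉0 (trans (sym (P≋ku 5F)) P₅≈0)
      x∈ : u 2F * u 2F + u 0F * u 1F ∈ 𝔽q
      x∈ = Tr≈0⇒∈𝔽q (trans (sym (quad-baer u u₃≈0))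
        (x≉0∧xy≈0⇒y≈0 (*-≉0 k≉0 k≉0) (trans (sym (quad-⊙ k P≋ku)) quadP≈0)))
      -- Put x = u₂² + u₀ u₁. The equation of `𝒬` puts x into 𝔽q, and u being a normalised lift puts
      -- ω x into 𝔽q; hence x = Tr(ω x) = 0.
      fu≈0 : f u ≈ 0#
      fu≈0 = trans (f-u₃≈0 u u₃≈0) (trans (*-congˡ
        (trans (sym (Tr-ω* x∈)) (∈𝔽q⇒Tr≈0 (𝔽q-resp (f-u₃≈0 u u₃≈0) fu∈)))) (zeroʳ ω))

    singular-u₃≈0⇒𝒬 : ∀ P u → SingularVector u → coords P ∼ baer u → u 3F ≈ 0# → P ∈ 𝒬
    singular-u₃≈0⇒𝒬 P u (u₃∈ , fu≈0) P∼u@(k , k≉0 , P≋ku) u₃≈0 = (baer u , baer-∈ u u₃∈ , P∼u) ,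
      trans (P≋ku 5F) (trans (*-congˡ u₃≈0) (zeroʳ k)) ,
      trans (quad-⊙ k P≋ku) (trans (*-congˡ (trans (quad-baer u u₃≈0) (trans (Tr-cong x≈0) (∈𝔽q⇒Tr≈0 conj-0))))
        (zeroʳ _))
      where
      x≈0 : u 2F * u 2F + u 0F * u 1F ≈ 0#
      x≈0 = x≉0∧xy≈0⇒y≈0 ω≉0 (trans (sym (f-u₃≈0 u u₃≈0)) fu≈0)

    singular-u₃≉0⇒orbit : ∀ P u → SingularVector u → coords P ∼ baer u → u 3F ≉ 0# → P ∈ orbit (S γ)
    singular-u₃≉0⇒orbit P u (u₃∈ , fu≈0) P∼u@(k , k≉0 , P≋ku) u₃≉0 =
      let a , b , c , d , Δ≈1 , u′≋w = orbit-surjective (u 3F ⁻¹ ⊙ u)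
             (proj₂ (singular-⊙ u (𝔽q-⁻¹ u₃≉0 u₃∈) (u₃∈ , fu≈0))) (*-inverseˡ u₃≉0) in
      a , b , c , d , Δ≈1 , k * u 3F , *-≉0 k≉0 u₃≉0 , λ i → begin
        coords P i                                      ≈⟨ P≋ku i ⟩
        k * baer u i                                    ≈⟨ *-congˡ (trans (*-congʳ (*-inverseʳ u₃≉0)) (*-identityˡ _)) ⟨
        k * (u 3F * u 3F ⁻¹ * baer u i)                 ≈⟨ solve 4 (λ k x y z →
          k :* (x :* y :* z) := k :* x :* (y :* z)) refl k (u 3F) (u 3F ⁻¹) (baer u i) ⟩
        k * u 3F * (u 3F ⁻¹ * baer u i)                 ≈⟨ *-congˡ (baer-⊙ (𝔽q-⁻¹ u₃≉0 u₃∈) u i) ⟨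
        k * u 3F * baer (u 3F ⁻¹ ⊙ u) i                 ≈⟨ *-congˡ (baer-cong u′≋w i) ⟩
        k * u 3F * baer (orbitLift a b c d) i           ≈⟨ *-congˡ (matrix·S a b c d Δ≈1 i) ⟨
        k * u 3F * (matrix a b c d · S γ) i             ∎

    singular⇒𝒪 : ∀ P u → SingularVector u → coords P ∼ baer u → P ∈ 𝒪 γ
    singular⇒𝒪 P u sing P∼u = case u 3F ≟ 0# of λ where
      (yes u₃≈0) → inj₁ (singular-u₃≈0⇒𝒬 P u sing P∼u u₃≈0)
      (no  u₃≉0) → inj₂ (singular-u₃≉0⇒orbit P u sing P∼u u₃≉0)

    -- Counting: scalar classes modulo 𝔽q and the size of `𝒪 γ`.

    private
      module 𝔽 = FromCardinality setoid 𝔽q 𝔽q-cardinality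

    -- The projective line over 𝔽q: `inj₁ i` is (1 : yᵢ) and `inj₂ tt` is (0 : 1). It indexes both
    -- the classes of nonzero scalars of K modulo 𝔽q and the lines through a point of a generator.
    ℙ¹ : Set
    ℙ¹ = Fin q ⊎ ⊤

    ℙ¹↔Fin : ℙ¹ ↔ Fin (q ℕ.+ 1)
    ℙ¹↔Fin = ↔-trans (Perm.id ⊎-↔ ↔-sym Fin.1↔⊤) (↔-sym Fin.+↔⊎)

    -- Representatives of the classes of nonzero scalars modulo those of 𝔽q.
    slope : ℙ¹ → Carrier
    slope (inj₁ i) = 1# + 𝔽.member i * ω
    slope (inj₂ _) = ω

    slope₀ slope₁ : ℙ¹ → Carrier
    slope₀ (inj₁ i) = 1#
    slope₀ (inj₂ _) = 0#
    slope₁ (inj₁ i) = 𝔽.member i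
    slope₁ (inj₂ _) = 1#

    slope₀-∈ : ∀ j → slope₀ j ∈ 𝔽q
    slope₀-∈ (inj₁ _) = conj-1
    slope₀-∈ (inj₂ _) = conj-0

    slope₁-∈ : ∀ j → slope₁ j ∈ 𝔽q
    slope₁-∈ (inj₁ i) = 𝔽.member-∈ i
    slope₁-∈ (inj₂ _) = conj-1

    slope-basis : ∀ j → slope j ≈ slope₀ j + slope₁ j * ω
    slope-basis (inj₁ i) = refl
    slope-basis (inj₂ _) = solve 1 (λ w → w := con false :+ con true :* w) refl ω

    ℙ¹-injective : ∀ {k} i j → slope₀ i ≈ k * slope₀ j → slope₁ i ≈ k * slope₁ j → i ≡ j × k ≈ 1#
    ℙ¹-injective (inj₁ i) (inj₁ j) eq₀ eq₁ = ≡.cong inj₁ (𝔽.member-injective i j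
      (trans eq₁ (trans (*-congʳ k≈1) (*-identityˡ _)))) , k≈1
      where k≈1 = sym (trans eq₀ (*-identityʳ _))
    ℙ¹-injective (inj₁ i) (inj₂ _) eq₀ eq₁ = contradiction (trans eq₀ (zeroʳ _)) 1≉0
    ℙ¹-injective (inj₂ _) (inj₁ j) eq₀ eq₁ = contradiction
      (trans eq₁ (trans (*-congʳ (trans (sym (*-identityʳ _)) (sym eq₀))) (zeroˡ _))) 1≉0
    ℙ¹-injective (inj₂ _) (inj₂ _) eq₀ eq₁ = ≡.refl , sym (trans eq₁ (*-identityʳ _))

    ℙ¹-surjective : ∀ {x y} → x ∈ 𝔽q → y ∈ 𝔽q → ¬ (x ≈ 0# × y ≈ 0#) →
      ∃[ k ] ∃[ j ] k ∈ 𝔽q × k ≉ 0# × x ≈ k * slope₀ j × y ≈ k * slope₁ j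
    ℙ¹-surjective {x} {y} x∈ y∈ ≉0 = go (x ≟ 0#)
      where
      Result : Set _
      Result = ∃[ k ] ∃[ j ] k ∈ 𝔽q × k ≉ 0# × x ≈ k * slope₀ j × y ≈ k * slope₁ j

      go : Dec (x ≈ 0#) → Result
      go (yes x≈0) = y , inj₂ tt , y∈ , (λ y≈0 → ≉0 (x≈0 , y≈0)) ,
        trans x≈0 (sym (zeroʳ y)) , sym (*-identityʳ y)
      go (no x≉0) = x , inj₁ (proj₁ y/x) , x∈ , x≉0 , sym (*-identityʳ x) ,
        sym (trans (*-congˡ (sym (proj₂ y/x))) (trans (sym (*-assoc _ _ _))
          (trans (*-congʳ (*-inverseʳ x≉0)) (*-identityˡ y))))
        where y/x = 𝔽.member-surjective (x ⁻¹ * y) (𝔽q-* (𝔽q-⁻¹ x≉0 x∈) y∈)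

    slope-injective : ∀ {k} i j → k ∈ 𝔽q → slope i ≈ k * slope j → i ≡ j × k ≈ 1#
    slope-injective {k} i j k∈ eq =
      let eq₀ , eq₁ = basis-injective (slope₀-∈ i) (slope₁-∈ i)
            (𝔽q-* k∈ (slope₀-∈ j)) (𝔽q-* k∈ (slope₁-∈ j)) (begin
              slope₀ i + slope₁ i * ω             ≈⟨ slope-basis i ⟨
              slope i                             ≈⟨ eq ⟩
              k * slope j                         ≈⟨ *-congˡ (slope-basis j) ⟩
              k * (slope₀ j + slope₁ j * ω)       ≈⟨ solve 4 (λ k x y w →
                k :* (x :+ y :* w) := k :* x :+ k :* y :* w) refl k _ _ ω ⟩
              k * slope₀ j + k * slope₁ j * ω     ∎)
      in ℙ¹-injective i j eq₀ eq₁

    slope-surjective : ∀ {x} → x ≉ 0# → ∃[ k ] ∃[ j ] k ∈ 𝔽q × k ≉ 0# × x ≈ k * slope j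
    slope-surjective {x} x≉0 =
      let k , j , k∈ , k≉0 , re≈ , Tr≈ = ℙ¹-surjective (re-∈𝔽q x) (Tr-∈𝔽q x) λ (re≈0 , Tr≈0) →
            x≉0 (trans (re+Tr*ω x) (trans (+-cong re≈0 (*-congʳ Tr≈0))
              (trans (+-identityˡ _) (zeroˡ ω))))
      in k , j , k∈ , k≉0 , (begin
        x                                   ≈⟨ re+Tr*ω x ⟩
        re x + Tr x * ω                     ≈⟨ +-cong re≈ (*-congʳ Tr≈) ⟩
        k * slope₀ j + k * slope₁ j * ω     ≈⟨ solve 4 (λ k x y w →
          k :* x :+ k :* y :* w := k :* (x :+ y :* w)) refl k _ _ ω ⟩
        k * (slope₀ j + slope₁ j * ω)       ≈⟨ *-congˡ (slope-basis j) ⟨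
        k * slope j                         ∎)

    slope≉0 : ∀ j → slope j ≉ 0#
    slope≉0 j eq = absurd j (basis-injective (slope₀-∈ j) (slope₁-∈ j) conj-0 conj-0
      (trans (sym (slope-basis j)) (trans eq (solve 1 (λ w → con false := con false :+ con false :* w) refl ω))))
      where
      absurd : ∀ j → ¬ (slope₀ j ≈ 0# × slope₁ j ≈ 0#)
      absurd (inj₁ _) (eq₀ , _) = 1≉0 eq₀
      absurd (inj₂ _) (_ , eq₁) = 1≉0 eq₁

    private
      NonzeroScalar : Pred Carrier ℓ₁
      NonzeroScalar x = x ≉ 0#

      K*-cardinality : ∃ (HasCardinality setoid NonzeroScalar)
      K*-cardinality = cardinality (λ x≈y x≉0 y≈0 → x≉0 (trans x≈y y≈0))
        λ x → case x ≟ 0# of λ where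
          (yes x≈0) → no λ x≉0 → x≉0 x≈0
          (no  x≉0) → yes x≉0

      |K*| : ℕ
      |K*| = proj₁ K*-cardinality

      module K* = FromCardinality setoid NonzeroScalar (proj₂ K*-cardinality)

      1+|K*|≡q² : 1 ℕ.+ |K*| ≡ q ℕ.^ 2
      1+|K*|≡q² = cardinality-unique setoid (λ _ → ⊤)
        (hasCardinality-↔ setoid (λ _ → ⊤) (↔-trans (↔-sym Fin.1↔⊤ ⊎-↔ Perm.id) (↔-sym Fin.+↔⊎))
          scalar (λ _ → tt) scalar-injective λ x _ → scalar-surjective x (x ≟ 0#))
        everything
        where
        scalar : ⊤ ⊎ Fin |K*| → Carrier
        scalar (inj₁ _) = 0#
        scalar (inj₂ i) = K*.member i
        scalar-injective : ∀ i j → scalar i ≈ scalar j → i ≡ j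
        scalar-injective (inj₁ _) (inj₁ _) eq = ≡.refl
        scalar-injective (inj₁ _) (inj₂ j) eq = contradiction (sym eq) (K*.member-∈ j)
        scalar-injective (inj₂ i) (inj₁ _) eq = contradiction eq (K*.member-∈ i)
        scalar-injective (inj₂ i) (inj₂ j) eq = ≡.cong inj₂ (K*.member-injective i j eq)
        scalar-surjective : ∀ x → Dec (x ≈ 0#) → ∃ λ i → x ≈ scalar i
        scalar-surjective x (yes x≈0) = inj₁ tt , x≈0
        scalar-surjective x (no x≉0)  = let i , eq = K*.member-surjective x x≉0 in inj₂ i , eq

      -- Singular vectors up to 𝔽q-scalars, in three families: u₃ = 0 with u₀ ≠ 0, where u₀ counts
      -- up to scalars and u₁ is free; the multiples of (0, 1, 0, 0); and u₃ = 1, where u₀ ≠ 0 and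
      -- u₂ are free.
      Index : Set
      Index = (ℙ¹ × Fin (q ℕ.^ 2)) ⊎ (ℙ¹ ⊎ (Fin |K*| × Fin (q ℕ.^ 2)))

      Index↔Fin : Index ↔ Fin ((q ℕ.+ 1) ℕ.* (q ℕ.^ 3 ℕ.+ 1))
      Index↔Fin = ≡.subst (λ n → Index ↔ Fin n) count (↔-trans
        (↔-trans (ℙ¹↔Fin ×-↔ Perm.id) (↔-sym Fin.*↔×)
          ⊎-↔ ↔-trans (ℙ¹↔Fin ⊎-↔ ↔-sym Fin.*↔×) (↔-sym Fin.+↔⊎))
        (↔-sym Fin.+↔⊎))
        where
        open ℕSolver.+-*-Solver using () renaming (solve to solveℕ; _:+_ to _⊞_; _:*_ to _⊠_; con to nat; _:=_ to _≐_)
        -- q² is added to both sides so that 1 + `|K*|` appears and can be replaced by q² without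
        -- subtraction.
        count : (q ℕ.+ 1) ℕ.* q ℕ.^ 2 ℕ.+ ((q ℕ.+ 1) ℕ.+ |K*| ℕ.* q ℕ.^ 2) ≡ (q ℕ.+ 1) ℕ.* (q ℕ.^ 3 ℕ.+ 1)
        count = ℕ.+-cancelʳ-≡ (q ℕ.^ 2) _ _ (≡.trans
          (solveℕ 3 (λ q n k → (q ⊞ nat 1) ⊠ n ⊞ ((q ⊞ nat 1) ⊞ k ⊠ n) ⊞ n
            ≐ (q ⊞ nat 1) ⊠ n ⊞ ((q ⊞ nat 1) ⊞ (nat 1 ⊞ k) ⊠ n)) ≡.refl q (q ℕ.^ 2) |K*|)
          (≡.trans (≡.cong (λ r → (q ℕ.+ 1) ℕ.* q ℕ.^ 2 ℕ.+ ((q ℕ.+ 1) ℕ.+ r ℕ.* q ℕ.^ 2)) 1+|K*|≡q²)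
          (solveℕ 1 (λ q → let q² = q ⊠ (q ⊠ nat 1) in
            (q ⊞ nat 1) ⊠ q² ⊞ ((q ⊞ nat 1) ⊞ q² ⊠ q²) ≐ (q ⊞ nat 1) ⊠ (q ⊠ q² ⊞ nat 1) ⊞ q²) ≡.refl q)))

      -- The coordinate left open is found from f = 0: u₂ as a square root in the first family, u₁
      -- from an affine equation in the third.
      vector : Index → Coords⁴
      vector (inj₁ (j , x)) = slope j Vector.∷ element x
        Vector.∷ sqrt (slope j * element x) Vector.∷ 0# Vector.∷ Vector.[]
      vector (inj₂ (inj₁ j)) = 0# Vector.∷ slope j Vector.∷ 0# Vector.∷ 0# Vector.∷ Vector.[]
      vector (inj₂ (inj₂ (i , x))) = K*.member i
        Vector.∷ ((ω * (element x * element x) + element x + γ/ω) * K*.member i ⁻¹ + (ω + 1#)) * ι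
        Vector.∷ element x Vector.∷ 1# Vector.∷ Vector.[]

      vector-singular : ∀ i → SingularVector (vector i)
      vector-singular (inj₁ (j , x)) = conj-0 , trans (f-u₃≈0 (vector (inj₁ (j , x))) refl)
        (trans (*-congˡ (x≈y⇒x+y≈0 (sqrt-square _))) (zeroʳ ω))
      vector-singular (inj₂ (inj₁ j)) = conj-0 , trans (f-u₃≈0 (vector (inj₂ (inj₁ j))) refl)
        (solve 2 (λ w e → w :* (con false :* con false :+ con false :* e) := con false) refl ω (slope j))
      vector-singular (inj₂ (inj₂ (i , x))) = conj-1 ,
        modulo ωι+1≈0 (modulo (x≈y⇒x+y≈0 (*-inverseʳ (K*.member-∈ i)))
          (solve 6 (λ a b s p i w →
            a :* (w :* (((w :* (s :* s) :+ s :+ p) :* b :+ (w :+ con true)) :* i) :+ (w :+ con true) :* con true)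
              :+ (w :* (s :* s) :+ s :* con true :+ p :* (con true :* con true))
            := con false
              :+ a :* ((w :* (s :* s) :+ s :+ p) :* b :+ (w :+ con true)) :* (w :* i :+ con true)
              :+ (w :* (s :* s) :+ s :+ p) :* (a :* b :+ con true))
            refl (K*.member i) (K*.member i ⁻¹) (element x) γ/ω ι ω))

      vector-nonzero : ∀ i → Nonzero (baer (vector i))
      vector-nonzero (inj₁ (j , x))        = 0F , slope≉0 j
      vector-nonzero (inj₂ (inj₁ j))       = 4F , slope≉0 j
      vector-nonzero (inj₂ (inj₂ (i , x))) = 5F , 1≉0

      point : Index → Point
      point i = record { coords = baer (vector i) ; nonzero = vector-nonzero i }

    -- Since k is in 𝔽q, `k ⊙ w` is a normalised lift of the same Baer vector as u, so uniqueness
    -- carries the proportionality up from the images to the lifts.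
    lifts-proportional : ∀ {k} u w → Lift u → Lift w → Nonzero (baer u) →
      baer u ≋ k ⊙ baer w → k ∈ 𝔽q × (f w ≈ 0# → u ≋ k ⊙ w)
    lifts-proportional {k} u w (u₃∈ , fu∈) (w₃∈ , fw∈) u≉0 u≋kw = k∈ , λ fw≈0 →
      lift-unique u (k ⊙ w) (u₃∈ , fu∈) (singular⇒lift (k ⊙ w) (singular-⊙ w k∈ (w₃∈ , fw≈0)))
        (λ i → trans (u≋kw i) (sym (baer-⊙ k∈ w i)))
      where
      k∈ = scalar-∈𝔽q u w u₃∈ w₃∈ u≉0 u≋kw

    ∼-baer-⊙ : ∀ {v k u w} → v ∼ baer u → k ∈ 𝔽q → k ≉ 0# → u ≋ k ⊙ w → v ∼ baer w
    ∼-baer-⊙ {v} {k} {u} {w} (l , l≉0 , v≋lu) k∈ k≉0 u≋kw = l * k , *-≉0 l≉0 k≉0 , λ i → begin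
      v i                    ≈⟨ v≋lu i ⟩
      l * baer u i           ≈⟨ *-congˡ (trans (baer-cong u≋kw i) (baer-⊙ k∈ w i)) ⟩
      l * (k * baer w i)     ≈⟨ *-assoc l k _ ⟨
      l * k * baer w i       ∎

    private
      vector-injective : ∀ i j → baer (vector i) ∼ baer (vector j) → i ≡ j
      vector-injective i j (k , k≉0 , eq) = go i j (proj₂ proportional (proj₂ (vector-singular j)))
        where
        proportional = lifts-proportional (vector i) (vector j)
          (singular⇒lift (vector i) (vector-singular i)) (singular⇒lift (vector j) (vector-singular j)) (vector-nonzero i) eq
        k∈ = proj₁ proportional

        ≈k0⇒≈0 : ∀ {x y} → x ≈ k * y → y ≈ 0# → x ≈ 0#
        ≈k0⇒≈0 x≈ky y≈0 = trans x≈ky (trans (*-congˡ y≈0) (zeroʳ k))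

        0≉k* : ∀ {y} → y ≉ 0# → ¬ (0# ≈ k * y)
        0≉k* y≉0 eq = *-≉0 k≉0 y≉0 (sym eq)

        1*-cancel : ∀ {x y} → k ≈ 1# → x ≈ k * y → x ≈ y
        1*-cancel k≈1 eq = trans eq (trans (*-congʳ k≈1) (*-identityˡ _))

        go : ∀ i j → vector i ≋ k ⊙ vector j → i ≡ j
        go (inj₁ (i , x)) (inj₁ (j , y)) eq =
          let i≡j , k≈1 = slope-injective i j k∈ (eq 0F) in
          ≡.cong inj₁ (≡.cong₂ _,_ i≡j (element-injective x y (1*-cancel k≈1 (eq 1F))))
        go (inj₁ (i , _)) (inj₂ (inj₁ _)) eq = contradiction (≈k0⇒≈0 (eq 0F) refl) (slope≉0 i)
        go (inj₁ _) (inj₂ (inj₂ _)) eq = contradiction (eq 3F) (0≉k* 1≉0)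
        go (inj₂ (inj₁ _)) (inj₁ (j , _)) eq = contradiction (eq 0F) (0≉k* (slope≉0 j))
        go (inj₂ (inj₁ i)) (inj₂ (inj₁ j)) eq = ≡.cong (inj₂ ∘ inj₁) (proj₁ (slope-injective i j k∈ (eq 1F)))
        go (inj₂ (inj₁ _)) (inj₂ (inj₂ _)) eq = contradiction (eq 3F) (0≉k* 1≉0)
        go (inj₂ (inj₂ _)) (inj₁ _) eq = contradiction (≈k0⇒≈0 (eq 3F) refl) 1≉0
        go (inj₂ (inj₂ _)) (inj₂ (inj₁ _)) eq = contradiction (≈k0⇒≈0 (eq 3F) refl) 1≉0
        go (inj₂ (inj₂ (i , x))) (inj₂ (inj₂ (j , y))) eq = ≡.cong (inj₂ ∘ inj₂) (≡.cong₂ _,_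
          (K*.member-injective i j (1*-cancel k≈1 (eq 0F)))
          (element-injective x y (1*-cancel k≈1 (eq 2F))))
          where k≈1 = sym (trans (eq 3F) (*-identityʳ k))

      x≈k[k⁻¹x] : ∀ {k x} → k ≉ 0# → x ≈ k * (k ⁻¹ * x)
      x≈k[k⁻¹x] k≉0 = sym (trans (sym (*-assoc _ _ _)) (trans (*-congʳ (*-inverseʳ k≉0)) (*-identityˡ _)))

      u₃≈0⇒u₂²≈u₀u₁ : ∀ u → f u ≈ 0# → u 3F ≈ 0# → u 2F * u 2F ≈ u 0F * u 1F
      u₃≈0⇒u₂²≈u₀u₁ u fu≈0 u₃≈0 = x+y≈0⇒x≈y (x≉0∧xy≈0⇒y≈0 ω≉0 (trans (sym (f-u₃≈0 u u₃≈0)) fu≈0))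

      -- A scalar from 𝔽q normalises u₃ if it is nonzero, otherwise u₀, otherwise u₁; f = 0
      -- determines what is left.
      vector-surjective : ∀ u → SingularVector u → Nonzero (baer u) →
        ∃[ k ] ∃[ i ] k ∈ 𝔽q × k ≉ 0# × u ≋ k ⊙ vector i
      vector-surjective u u-sing@(u₃∈ , fu≈0) (n , uₙ≉0) = case u 3F ≟ 0# of λ where
          (no u₃≉0) → affine u₃≉0
          (yes u₃≈0) → case u 0F ≟ 0# of λ where
            (no u₀≉0)  → at-infinity u₃≈0 u₀≉0
            (yes u₀≈0) → tangent u₃≈0 u₀≈0
        where
        Result : Set _
        Result = ∃[ k ] ∃[ i ] k ∈ 𝔽q × k ≉ 0# × u ≋ k ⊙ vector i

        affine : u 3F ≉ 0# → Result
        affine u₃≉0 = u 3F , i , u₃∈ , u₃≉0 , u≋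
          where
          w = u 3F ⁻¹ ⊙ u
          u₀≉0 : u 0F ≉ 0#
          u₀≉0 u₀≈0 = u₃≉0 (proj₂ (isotropic-u₀≈0 u fu≈0 u₀≈0))
          w₀ = K*.member-surjective (w 0F) (*-≉0 (⁻¹-≉0 u₃≉0) u₀≉0)
          i : Index
          i = inj₂ (inj₂ (proj₁ w₀ , index (w 2F)))
          u₀≈ : u 0F ≈ u 3F * vector i 0F
          u₀≈ = trans (x≈k[k⁻¹x] u₃≉0) (*-congˡ (proj₂ w₀))
          u₂≈ : u 2F ≈ u 3F * vector i 2F
          u₂≈ = trans (x≈k[k⁻¹x] u₃≉0) (*-congˡ (sym (element-index _)))
          u≋ : u ≋ u 3F ⊙ vector i
          u≋ 0F = u₀≈
          u≋ 1F = u₁-determined u (u 3F ⊙ vector i) fu≈0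
            (proj₂ (singular-⊙ (vector i) u₃∈ (vector-singular i))) u₀≉0 u₀≈ u₂≈ (sym (*-identityʳ _))
          u≋ 2F = u₂≈
          u≋ 3F = sym (*-identityʳ _)

        at-infinity : u 3F ≈ 0# → u 0F ≉ 0# → Result
        at-infinity u₃≈0 u₀≉0 = k , i , k∈ , k≉0 , u≋
          where
          sl = slope-surjective u₀≉0
          k = proj₁ sl
          j = proj₁ (proj₂ sl)
          k∈ = proj₁ (proj₂ (proj₂ sl))
          k≉0 = proj₁ (proj₂ (proj₂ (proj₂ sl)))
          u₀≈ = proj₂ (proj₂ (proj₂ (proj₂ sl)))
          i : Index
          i = inj₁ (j , index (k ⁻¹ * u 1F))
          u₁≈ : u 1F ≈ k * vector i 1F
          u₁≈ = trans (x≈k[k⁻¹x] k≉0) (*-congˡ (sym (element-index _)))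
          u≋ : u ≋ k ⊙ vector i
          u≋ 0F = u₀≈
          u≋ 1F = u₁≈
          u≋ 2F = square-injective (begin
            u 2F * u 2F                                 ≈⟨ u₃≈0⇒u₂²≈u₀u₁ u fu≈0 u₃≈0 ⟩
            u 0F * u 1F                                 ≈⟨ *-cong u₀≈ u₁≈ ⟩
            (k * vector i 0F) * (k * vector i 1F)
              ≈⟨ u₃≈0⇒u₂²≈u₀u₁ (k ⊙ vector i) (proj₂ (singular-⊙ (vector i) k∈ (vector-singular i))) (zeroʳ k) ⟨
            (k * vector i 2F) * (k * vector i 2F)       ∎)
          u≋ 3F = trans u₃≈0 (sym (zeroʳ k))

        tangent : u 3F ≈ 0# → u 0F ≈ 0# → Result
        tangent u₃≈0 u₀≈0 =
          let k , j , k∈ , k≉0 , u₁≈ = slope-surjective u₁≉0 in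
          k , inj₂ (inj₁ j) , k∈ , k≉0 , λ where
            0F → trans u₀≈0 (sym (zeroʳ k))
            1F → u₁≈
            2F → trans u₂≈0 (sym (zeroʳ k))
            3F → trans u₃≈0 (sym (zeroʳ k))
          where
          u₂≈0 : u 2F ≈ 0#
          u₂≈0 = proj₁ (isotropic-u₀≈0 u fu≈0 u₀≈0)
          u₁≉0 : u 1F ≉ 0#
          u₁≉0 u₁≈0 = uₙ≉0 (trans (baer-cong {u} {0# ⊙ u} (λ where
              0F → trans u₀≈0 (sym (zeroˡ _))
              1F → trans u₁≈0 (sym (zeroˡ _))
              2F → trans u₂≈0 (sym (zeroˡ _))
              3F → trans u₃≈0 (sym (zeroˡ _))) n)
            (trans (baer-⊙ conj-0 u n) (zeroˡ _)))

    nonzero-∼ : ∀ P {v} → coords P ∼ v → Nonzero v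
    nonzero-∼ P (k , k≉0 , P≋kv) = proj₁ (nonzero P) ,
      λ v≈0 → proj₂ (nonzero P) (trans (P≋kv _) (trans (*-congˡ v≈0) (zeroʳ k)))

    𝒪-size : Size (𝒪 γ) ((q ℕ.+ 1) ℕ.* (q ℕ.^ 3 ℕ.+ 1))
    𝒪-size = hasCardinality-↔ pointSetoid (𝒪 γ) Index↔Fin point
      (λ i → singular⇒𝒪 (point i) (vector i) (vector-singular i) (1# , 1≉0 , λ n → sym (*-identityˡ _)))
      vector-injective
      λ P P∈𝒪 →
        let u , u-singular , P∼u = 𝒪⇒singular P P∈𝒪
            k , i , k∈ , k≉0 , u≋ = vector-surjective u u-singular (nonzero-∼ P P∼u)
        in i , ∼-baer-⊙ P∼u k∈ k≉0 u≋

    -- Singular points of the ternary form on a lifted generator.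

    lin : (x y z : Carrier) (u v w : Coords⁴) → Coords⁴
    lin x y z u v w = x ⊙ u ⊕ (y ⊙ v ⊕ z ⊙ w)

    B-lin : ∀ s x y z u v w → B s (lin x y z u v w) ≈ x * B s u + (y * B s v + z * B s w)
    B-lin s x y z u v w = begin
      B s (x ⊙ u ⊕ (y ⊙ v ⊕ z ⊙ w))              ≈⟨ B-⊕ʳ s (x ⊙ u) (y ⊙ v ⊕ z ⊙ w) ⟩
      B s (x ⊙ u) + B s (y ⊙ v ⊕ z ⊙ w)          ≈⟨ +-cong (B-⊙ʳ s x u) (B-⊕ʳ s (y ⊙ v) (z ⊙ w)) ⟩
      x * B s u + (B s (y ⊙ v) + B s (z ⊙ w))    ≈⟨ +-congˡ (+-cong (B-⊙ʳ s y v) (B-⊙ʳ s z w)) ⟩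
      x * B s u + (y * B s v + z * B s w)        ∎

    f-pair : ∀ y z v w → f (y ⊙ v ⊕ z ⊙ w) ≈ y * y * f v + z * z * f w + z * y * B v w
    f-pair y z v w = begin
      f (y ⊙ v ⊕ z ⊙ w)                                    ≈⟨ f-⊕ (y ⊙ v) (z ⊙ w) ⟩
      f (y ⊙ v) + f (z ⊙ w) + B (y ⊙ v) (z ⊙ w)            ≈⟨ +-cong (+-cong (f-⊙ y v) (f-⊙ z w)) (begin
        B (y ⊙ v) (z ⊙ w)                                  ≈⟨ B-⊙ʳ (y ⊙ v) z w ⟩
        z * B (y ⊙ v) w                                    ≈⟨ *-congˡ (trans (B-sym (y ⊙ v) w) (B-⊙ʳ w y v)) ⟩
        z * (y * B w v)                                    ≈⟨ *-assoc z y _ ⟨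
        z * y * B w v                                      ≈⟨ *-congˡ (B-sym w v) ⟩
        z * y * B v w                                      ∎) ⟩
      y * y * f v + z * z * f w + z * y * B v w            ∎

    f-lin : ∀ x y z u v w → f (lin x y z u v w)
      ≈ x * x * f u + (y * y * f v + z * z * f w + z * y * B v w) + x * (y * B u v + z * B u w)
    f-lin x y z u v w = begin
      f (x ⊙ u ⊕ (y ⊙ v ⊕ z ⊙ w))
        ≈⟨ f-⊕ (x ⊙ u) (y ⊙ v ⊕ z ⊙ w) ⟩
      f (x ⊙ u) + f (y ⊙ v ⊕ z ⊙ w) + B (x ⊙ u) (y ⊙ v ⊕ z ⊙ w)
        ≈⟨ +-cong (+-cong (f-⊙ x u) (f-pair y z v w)) (begin
          B (x ⊙ u) (y ⊙ v ⊕ z ⊙ w)                ≈⟨ B-sym (x ⊙ u) (y ⊙ v ⊕ z ⊙ w) ⟩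
          B (y ⊙ v ⊕ z ⊙ w) (x ⊙ u)                ≈⟨ B-⊙ʳ (y ⊙ v ⊕ z ⊙ w) x u ⟩
          x * B (y ⊙ v ⊕ z ⊙ w) u                  ≈⟨ *-congˡ (B-sym (y ⊙ v ⊕ z ⊙ w) u) ⟩
          x * B u (y ⊙ v ⊕ z ⊙ w)                  ≈⟨ *-congˡ (trans (B-⊕ʳ u (y ⊙ v) (z ⊙ w)) (+-cong (B-⊙ʳ u y v) (B-⊙ʳ u z w))) ⟩
          x * (y * B u v + z * B u w)              ∎) ⟩
      x * x * f u + (y * y * f v + z * z * f w + z * y * B v w) + x * (y * B u v + z * B u w) ∎

    baer-lin : ∀ {x y z} → x ∈ 𝔽q → y ∈ 𝔽q → z ∈ 𝔽q → ∀ u v w →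
      baer (lin x y z u v w) ≋ x ⊙ baer u ⊕ (y ⊙ baer v ⊕ z ⊙ baer w)
    baer-lin {x} {y} {z} x∈ y∈ z∈ u v w i = trans (baer-⊕ (x ⊙ u) (y ⊙ v ⊕ z ⊙ w) i)
      (+-cong (baer-⊙ x∈ u i) (trans (baer-⊕ (y ⊙ v) (z ⊙ w) i)
        (+-cong (baer-⊙ y∈ v i) (baer-⊙ z∈ w i))))

    IsZero : ∀ {n} → Vector Carrier n → Set ℓ₁
    IsZero u = ∀ i → u i ≈ 0#

    zero⊎nonzero : ∀ {n} (u : Vector Carrier n) → IsZero u ⊎ Nonzero u
    zero⊎nonzero u = case Fin.any? (λ i → ¬? (u i ≟ 0#)) of λ where
      (yes u≉0) → inj₂ u≉0
      (no ¬u≉0) → inj₁ λ i → case u i ≟ 0# of λ where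
        (yes uᵢ≈0) → uᵢ≈0
        (no  uᵢ≉0) → contradiction (i , uᵢ≉0) ¬u≉0

    baer-zero : ∀ {u} → IsZero u → IsZero (baer u)
    baer-zero {u} u≈0 i = trans (baer-cong {u} {0# ⊙ u} (λ j → trans (u≈0 j) (sym (zeroˡ _))) i)
      (trans (baer-⊙ conj-0 u i) (zeroˡ _))

    -- A basis of a lifted generator. All values of f and B on it lie in 𝔽q, so f restricts to a
    -- ternary quadratic form over 𝔽q on its 𝔽q-span. Independence is required of the images under
    -- `baer`, where the points are.
    record IsotropicTriple (u v w : Coords⁴) : Set (c ⊔ ℓ₁) where
      field
        lift-u : Lift u
        lift-v : Lift v
        lift-w : Lift w
        Buv∈   : B u v ∈ 𝔽q
        Buw∈   : B u w ∈ 𝔽q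
        Bvw∈   : B v w ∈ 𝔽q
        independent : ∀ {x y z} → x ∈ 𝔽q → y ∈ 𝔽q → z ∈ 𝔽q →
          IsZero (baer (lin x y z u v w)) → x ≈ 0# × y ≈ 0# × z ≈ 0#

      lift-lin : ∀ {x y z} → x ∈ 𝔽q → y ∈ 𝔽q → z ∈ 𝔽q → Lift (lin x y z u v w)
      lift-lin {x} {y} {z} x∈ y∈ z∈ =
        𝔽q-+ (𝔽q-* x∈ (proj₁ lift-u)) (𝔽q-+ (𝔽q-* y∈ (proj₁ lift-v)) (𝔽q-* z∈ (proj₁ lift-w))) ,
        𝔽q-resp (sym (f-lin x y z u v w)) (𝔽q-+
          (𝔽q-+ (𝔽q-* (𝔽q-* x∈ x∈) (proj₂ lift-u)) (𝔽q-+ (𝔽q-+ (𝔽q-* (𝔽q-* y∈ y∈) (proj₂ lift-v))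
            (𝔽q-* (𝔽q-* z∈ z∈) (proj₂ lift-w))) (𝔽q-* (𝔽q-* z∈ y∈) Bvw∈)))
          (𝔽q-* x∈ (𝔽q-+ (𝔽q-* y∈ Buv∈) (𝔽q-* z∈ Buw∈))))

      lin-proportional : ∀ {x y z x′ y′ z′ k} → x ∈ 𝔽q → y ∈ 𝔽q → z ∈ 𝔽q →
        x′ ∈ 𝔽q → y′ ∈ 𝔽q → z′ ∈ 𝔽q → k ∈ 𝔽q →
        baer (lin x y z u v w) ≋ k ⊙ baer (lin x′ y′ z′ u v w) →
        x ≈ k * x′ × y ≈ k * y′ × z ≈ k * z′
      lin-proportional {x} {y} {z} {x′} {y′} {z′} {k} x∈ y∈ z∈ x′∈ y′∈ z′∈ k∈ eq =
        let x≈ , y≈ , z≈ = independent (𝔽q-+ x∈ (𝔽q-* k∈ x′∈)) (𝔽q-+ y∈ (𝔽q-* k∈ y′∈))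
              (𝔽q-+ z∈ (𝔽q-* k∈ z′∈)) vanishes
        in x+y≈0⇒x≈y x≈ , x+y≈0⇒x≈y y≈ , x+y≈0⇒x≈y z≈
        where
        l = lin x y z u v w
        l′ = lin x′ y′ z′ u v w
        vanishes : IsZero (baer (lin (x + k * x′) (y + k * y′) (z + k * z′) u v w))
        vanishes i = begin
          baer (lin (x + k * x′) (y + k * y′) (z + k * z′) u v w) i
            ≈⟨ baer-cong {w = l ⊕ k ⊙ l′} (λ j → solve 10 (λ x y z x′ y′ z′ k u v w →
                 (x :+ k :* x′) :* u :+ ((y :+ k :* y′) :* v :+ (z :+ k :* z′) :* w)
                 := (x :* u :+ (y :* v :+ z :* w)) :+ k :* (x′ :* u :+ (y′ :* v :+ z′ :* w)))
                 refl x y z x′ y′ z′ k (u j) (v j) (w j)) i ⟩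
          baer (l ⊕ k ⊙ l′) i               ≈⟨ baer-⊕ l (k ⊙ l′) i ⟩
          baer l i + baer (k ⊙ l′) i        ≈⟨ +-congˡ (baer-⊙ k∈ l′ i) ⟩
          baer l i + k * baer l′ i          ≈⟨ x≈y⇒x+y≈0 (eq i) ⟩
          0#                                ∎

    SingularSpan : (u v w : Coords⁴) → PointSet
    SingularSpan u v w P = ∃[ x ] ∃[ y ] ∃[ z ] x ∈ 𝔽q × y ∈ 𝔽q × z ∈ 𝔽q ×
      f (lin x y z u v w) ≈ 0# × coords P ∼ baer (lin x y z u v w)

    -- f (v + x r) ≈ f v + x² f r has exactly one root x for each direction v modulo r.
    nucleus-size : ∀ {r u v} → IsotropicTriple r u v → f r ≉ 0# → B r u ≈ 0# → B r v ≈ 0# →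
      Size (SingularSpan r u v) (q ℕ.+ 1)
    nucleus-size {r} {u} {v} triple fr≉0 Bru≈0 Brv≈0 =
      hasCardinality-↔ pointSetoid (SingularSpan r u v) ℙ¹↔Fin point′ point′-∈ point′-injective
        λ P (x , y , z , x∈ , y∈ , z∈ , fl≈0 , P∼l) →
          let k , j , k∈ , k≉0 , l≋ = direction P x∈ y∈ z∈ fl≈0 P∼l in
          j , ∼-baer-⊙ {w = vec j} P∼l k∈ k≉0 l≋
      where
      open IsotropicTriple triple

      g : Carrier → Carrier → Carrier
      g y z = y * y * f u + z * z * f v + z * y * B u v

      f-split : ∀ x y z → f (lin x y z r u v) ≈ x * x * f r + g y z
      f-split x y z = trans (f-lin x y z r u v) (trans
        (+-congˡ (trans (*-congˡ (+-cong (*-congˡ Bru≈0) (*-congˡ Brv≈0)))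
          (solve 3 (λ x y z → x :* (y :* con false :+ z :* con false) := con false) refl x y z)))
        (+-identityʳ _))

      radial : ℙ¹ → Carrier
      radial j = sqrt (g (slope₀ j) (slope₁ j) * f r ⁻¹)

      radial-∈ : ∀ j → radial j ∈ 𝔽q
      radial-∈ j = sqrt-∈𝔽q (𝔽q-* (𝔽q-+ (𝔽q-+ (𝔽q-* (𝔽q-* y∈ y∈) (proj₂ lift-v))
        (𝔽q-* (𝔽q-* z∈ z∈) (proj₂ lift-w))) (𝔽q-* (𝔽q-* z∈ y∈) Bvw∈)) (𝔽q-⁻¹ fr≉0 (proj₂ lift-u)))
        where
        y∈ = slope₀-∈ j
        z∈ = slope₁-∈ j

      radial²fr : ∀ j → radial j * radial j * f r ≈ g (slope₀ j) (slope₁ j)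
      radial²fr j = trans (*-congʳ (sqrt-square _)) (trans (*-assoc _ _ _)
        (trans (*-congˡ (*-inverseˡ fr≉0)) (*-identityʳ _)))

      vec : ℙ¹ → Coords⁴
      vec j = lin (radial j) (slope₀ j) (slope₁ j) r u v

      f-vec : ∀ j → f (vec j) ≈ 0#
      f-vec j = trans (f-split _ _ _) (x≈y⇒x+y≈0 (radial²fr j))

      slopes≉0 : ∀ j → ¬ (slope₀ j ≈ 0# × slope₁ j ≈ 0#)
      slopes≉0 (inj₁ _) (eq₀ , _) = 1≉0 eq₀
      slopes≉0 (inj₂ _) (_ , eq₁) = 1≉0 eq₁

      vec-nonzero : ∀ j → Nonzero (baer (vec j))
      vec-nonzero j = case zero⊎nonzero (baer (vec j)) of λ where
        (inj₁ vec≈0) → contradiction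
          (proj₂ (independent (radial-∈ j) (slope₀-∈ j) (slope₁-∈ j) vec≈0)) (slopes≉0 j)
        (inj₂ vec≉0) → vec≉0

      point′ : ℙ¹ → Point
      point′ j = record { coords = baer (vec j) ; nonzero = vec-nonzero j }

      point′-∈ : ∀ j → point′ j ∈ SingularSpan r u v
      point′-∈ j = radial j , slope₀ j , slope₁ j , radial-∈ j , slope₀-∈ j , slope₁-∈ j , f-vec j ,
        1# , 1≉0 , λ n → sym (*-identityˡ _)

      vec-lift : ∀ j → Lift (vec j)
      vec-lift j = lift-lin (radial-∈ j) (slope₀-∈ j) (slope₁-∈ j)

      point′-injective : ∀ i j → baer (vec i) ∼ baer (vec j) → i ≡ j
      point′-injective i j (k , k≉0 , eq) =
        let k∈ = scalar-∈𝔽q (vec i) (vec j) (proj₁ (vec-lift i)) (proj₁ (vec-lift j)) (vec-nonzero i) eq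
            _ , y≈ , z≈ = lin-proportional (radial-∈ i) (slope₀-∈ i) (slope₁-∈ i)
              (radial-∈ j) (slope₀-∈ j) (slope₁-∈ j) k∈ eq
        in proj₁ (ℙ¹-injective i j y≈ z≈)

      direction : ∀ P {x y z} → x ∈ 𝔽q → y ∈ 𝔽q → z ∈ 𝔽q → f (lin x y z r u v) ≈ 0# →
        coords P ∼ baer (lin x y z r u v) →
        ∃[ k ] ∃[ j ] k ∈ 𝔽q × k ≉ 0# × lin x y z r u v ≋ k ⊙ vec j
      direction P {x} {y} {z} x∈ y∈ z∈ fl≈0 P∼l = k , j , k∈ , k≉0 , λ i → trans
          (+-cong (*-congʳ x≈) (+-cong (*-congʳ y≈) (*-congʳ z≈)))
          (solve 7 (λ k x y z r u v → k :* x :* r :+ (k :* y :* u :+ k :* z :* v)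
            := k :* (x :* r :+ (y :* u :+ z :* v))) refl k _ _ _ (r i) (u i) (v i))
        where
        x²fr≈g : x * x * f r ≈ g y z
        x²fr≈g = x+y≈0⇒x≈y (trans (sym (f-split x y z)) fl≈0)
        -- The point of r itself is not singular, so every singular point lies on a well-defined
        -- line through it.
        not-nucleus : ¬ (y ≈ 0# × z ≈ 0#)
        not-nucleus (y≈0 , z≈0) = proj₂ nonzero-l (baer-zero {lin x y z r u v} (λ i → trans
            (+-cong (*-congʳ x≈0) (+-cong (*-congʳ y≈0) (*-congʳ z≈0)))
            (solve 3 (λ r u v → con false :* r :+ (con false :* u :+ con false :* v) := con false) refl (r i) (u i) (v i)))
            (proj₁ nonzero-l))
          where
          nonzero-l = nonzero-∼ P P∼l
          x≈0 : x ≈ 0#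
          x≈0 = x*x≈0⇒x≈0 (x≉0∧xy≈0⇒y≈0 fr≉0 (trans (*-comm _ _) (trans x²fr≈g (trans
            (+-cong (+-cong (*-congʳ (*-cong y≈0 y≈0)) (*-congʳ (*-cong z≈0 z≈0))) (*-congʳ (*-cong z≈0 y≈0)))
            (solve 3 (λ a b c → con false :* con false :* a :+ con false :* con false :* b
              :+ con false :* con false :* c := con false) refl (f u) (f v) (B u v))))))
        dir = ℙ¹-surjective y∈ z∈ not-nucleus
        k = proj₁ dir
        j = proj₁ (proj₂ dir)
        k∈ = proj₁ (proj₂ (proj₂ dir))
        k≉0 = proj₁ (proj₂ (proj₂ (proj₂ dir)))
        y≈ = proj₁ (proj₂ (proj₂ (proj₂ (proj₂ dir))))
        z≈ = proj₂ (proj₂ (proj₂ (proj₂ (proj₂ dir))))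
        x≈ : x ≈ k * radial j
        x≈ = square-injective (*-cancelˡ fr≉0 (begin
          f r * (x * x)                                   ≈⟨ *-comm _ _ ⟩
          x * x * f r                                     ≈⟨ x²fr≈g ⟩
          g y z                                           ≈⟨ +-cong (+-cong (*-congʳ (*-cong y≈ y≈)) (*-congʳ (*-cong z≈ z≈)))
                                                               (*-congʳ (*-cong z≈ y≈)) ⟩
          g (k * slope₀ j) (k * slope₁ j)                 ≈⟨ solve 6 (λ k y z a b c →
            (k :* y) :* (k :* y) :* a :+ (k :* z) :* (k :* z) :* b :+ (k :* z) :* (k :* y) :* c
            := k :* k :* (y :* y :* a :+ z :* z :* b :+ z :* y :* c)) refl k _ _ (f u) (f v) (B u v) ⟩
          k * k * g (slope₀ j) (slope₁ j)                 ≈⟨ *-congˡ (radial²fr j) ⟨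
          k * k * (radial j * radial j * f r)             ≈⟨ solve 3 (λ k s t →
            k :* k :* (s :* s :* t) := t :* ((k :* s) :* (k :* s))) refl k _ (f r) ⟩
          f r * ((k * radial j) * (k * radial j))         ∎))

    -- `φ` is a change of coordinates over 𝔽q. It serves to permute a triple and to exchange one of
    -- its vectors for the radical vector.
    SingularSpan-⊆ : ∀ {u v w u′ v′ w′} (φ : Carrier → Carrier → Carrier → Carrier × Carrier × Carrier) →
      (∀ {x y z} → x ∈ 𝔽q → y ∈ 𝔽q → z ∈ 𝔽q → let x′ , y′ , z′ = φ x y z in
        (x′ ∈ 𝔽q × y′ ∈ 𝔽q × z′ ∈ 𝔽q) × lin x y z u v w ≋ lin x′ y′ z′ u′ v′ w′) →
      SingularSpan u v w ⊆ SingularSpan u′ v′ w′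
    SingularSpan-⊆ {u} {v} {w} {u′} {v′} {w′} φ φ-lin {P} (x , y , z , x∈ , y∈ , z∈ , fl≈0 , P∼l) =
      let x′ , y′ , z′ = φ x y z
          (x′∈ , y′∈ , z′∈) , l≋l′ = φ-lin x∈ y∈ z∈
          l = lin x y z u v w
          l′ = lin x′ y′ z′ u′ v′ w′
      in x′ , y′ , z′ , x′∈ , y′∈ , z′∈ , trans (f-cong {l′} {l} (λ i → sym (l≋l′ i))) fl≈0 ,
        ∼-≋ P∼l (baer-cong {l} {l′} l≋l′)

    module _ {u v w : Coords⁴} where

      lin-swap₁₂ : ∀ x y z → lin x y z u v w ≋ lin y x z v u w
      lin-swap₁₂ x y z i = solve 3 (λ a b c → a :+ (b :+ c) := b :+ (a :+ c)) refl _ _ _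

      lin-swap₁₃ : ∀ x y z → lin x y z u v w ≋ lin z y x w v u
      lin-swap₁₃ x y z i = solve 3 (λ a b c → a :+ (b :+ c) := c :+ (b :+ a)) refl _ _ _

    SingularSpan-swap₁₂ : ∀ {u v w} → SingularSpan u v w ⊆ SingularSpan v u w
    SingularSpan-swap₁₂ {u} {v} {w} {P} = SingularSpan-⊆ {u} {v} {w} {v} {u} {w} (λ x y z → y , x , z)
      (λ x∈ y∈ z∈ → (y∈ , x∈ , z∈) , lin-swap₁₂ {u} {v} {w} _ _ _) {P}

    SingularSpan-swap₁₃ : ∀ {u v w} → SingularSpan u v w ⊆ SingularSpan w v u
    SingularSpan-swap₁₃ {u} {v} {w} {P} = SingularSpan-⊆ {u} {v} {w} {w} {v} {u} (λ x y z → z , y , x)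
      (λ x∈ y∈ z∈ → (z∈ , y∈ , x∈) , lin-swap₁₃ {u} {v} {w} _ _ _) {P}

    triple-swap₁₂ : ∀ {u v w} → IsotropicTriple u v w → IsotropicTriple v u w
    triple-swap₁₂ {u} {v} {w} triple = record
      { lift-u = lift-v ; lift-v = lift-u ; lift-w = lift-w
      ; Buv∈ = 𝔽q-resp (B-sym u v) Buv∈ ; Buw∈ = Bvw∈ ; Bvw∈ = Buw∈
      ; independent = λ {x} {y} {z} x∈ y∈ z∈ l≈0 →
          let y≈ , x≈ , z≈ = independent y∈ x∈ z∈ (λ i → trans
                (baer-cong {lin y x z u v w} {lin x y z v u w} (lin-swap₁₂ {u} {v} {w} y x z) i) (l≈0 i))
          in x≈ , y≈ , z≈
      }
      where open IsotropicTriple triple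

    triple-swap₁₃ : ∀ {u v w} → IsotropicTriple u v w → IsotropicTriple w v u
    triple-swap₁₃ {u} {v} {w} triple = record
      { lift-u = lift-w ; lift-v = lift-v ; lift-w = lift-u
      ; Buv∈ = 𝔽q-resp (B-sym v w) Bvw∈ ; Buw∈ = 𝔽q-resp (B-sym u w) Buw∈ ; Bvw∈ = 𝔽q-resp (B-sym u v) Buv∈
      ; independent = λ {x} {y} {z} x∈ y∈ z∈ l≈0 →
          let z≈ , y≈ , x≈ = independent z∈ y∈ x∈ (λ i → trans
                (baer-cong {lin z y x u v w} {lin x y z w v u} (lin-swap₁₃ {u} {v} {w} z y x) i) (l≈0 i))
          in x≈ , y≈ , z≈
      }
      where open IsotropicTriple triple

    size-swap₁₂ : ∀ {u v w n} → Size (SingularSpan v u w) n → Size (SingularSpan u v w) n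
    size-swap₁₂ {u} {v} {w} = hasCardinality-⇔ pointSetoid (SingularSpan v u w) (SingularSpan u v w)
      (λ {P} → SingularSpan-swap₁₂ {v} {u} {w} {P}) (λ {P} → SingularSpan-swap₁₂ {u} {v} {w} {P})

    size-swap₁₃ : ∀ {u v w n} → Size (SingularSpan w v u) n → Size (SingularSpan u v w) n
    size-swap₁₃ {u} {v} {w} = hasCardinality-⇔ pointSetoid (SingularSpan w v u) (SingularSpan u v w)
      (λ {P} → SingularSpan-swap₁₃ {w} {v} {u} {P}) (λ {P} → SingularSpan-swap₁₃ {u} {v} {w} {P})

    module Triple {u v w : Coords⁴} (triple : IsotropicTriple u v w) where
      open IsotropicTriple triple

      module Nucleus (Bvw≉0 : B v w ≉ 0#) where

        a b d : Carrier
        a = B v w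
        b = B u w
        d = B u v

        -- The kernel of an alternating 3 × 3 matrix is spanned by its three entries, taken in
        -- complementary order; the usual signs disappear in characteristic two.
        r : Coords⁴
        r = lin a b d u v w

        lin-r : ∀ x y z → lin x y z r v w ≋ lin (x * a) (x * b + y) (x * d + z) u v w
        lin-r x y z i = solve 9 (λ x y z a b d u v w →
          x :* (a :* u :+ (b :* v :+ d :* w)) :+ (y :* v :+ z :* w)
          := x :* a :* u :+ ((x :* b :+ y) :* v :+ (x :* d :+ z) :* w)) refl x y z a b d (u i) (v i) (w i)

        Brv≈0 : B r v ≈ 0#
        Brv≈0 = begin
          B r v                                       ≈⟨ B-sym r v ⟩
          B v r                                       ≈⟨ B-lin v a b d u v w ⟩
          a * B v u + (b * B v v + d * B v w)         ≈⟨ +-cong (*-congˡ (B-sym v u)) (+-congʳ (*-congˡ (B-self v))) ⟩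
          a * d + (b * 0# + d * a)                    ≈⟨ solve 3 (λ a b d →
            a :* d :+ (b :* con false :+ d :* a) := con false) refl a b d ⟩
          0#                                          ∎

        Brw≈0 : B r w ≈ 0#
        Brw≈0 = begin
          B r w                                       ≈⟨ B-sym r w ⟩
          B w r                                       ≈⟨ B-lin w a b d u v w ⟩
          a * B w u + (b * B w v + d * B w w)         ≈⟨ +-cong (*-congˡ (B-sym w u))
                                                           (+-cong (*-congˡ (B-sym w v)) (*-congˡ (B-self w))) ⟩
          a * b + (b * a + d * 0#)                    ≈⟨ solve 3 (λ a b d →
            a :* b :+ (b :* a :+ d :* con false) := con false) refl a b d ⟩
          0#                                          ∎

        r-nonzero : Nonzero r
        r-nonzero = case zero⊎nonzero r of λ where
          (inj₁ r≈0) → contradiction (proj₁ (independent Bvw∈ Buw∈ Buv∈ (baer-zero {r} r≈0))) Bvw≉0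
          (inj₂ r≉0) → r≉0

        -- Over K the binary form f on ⟨v, w⟩ is isotropic, its coefficients being in 𝔽q;
        -- if f r ≈ 0# too, then the elliptic quadric would contain a line.
        isotropic-pair : ∃[ y ] ∃[ z ] ¬ (y ≈ 0# × z ≈ 0#) × f (y ⊙ v ⊕ z ⊙ w) ≈ 0#
        isotropic-pair = case f v ≟ 0# of λ where
            (yes fv≈0) → 1# , 0# , (λ (1≈0 , _) → 1≉0 1≈0) , trans (f-pair 1# 0# v w) (trans
              (+-congʳ (+-congʳ (*-congˡ fv≈0)))
              (solve 2 (λ x y → con true :* con true :* con false :+ con false :* con false :* x
                :+ con false :* con true :* y := con false) refl (f w) a))
            (no fv≉0) → general fv≉0
          where
          general : f v ≉ 0# → ∃[ y ] ∃[ z ] ¬ (y ≈ 0# × z ≈ 0#) × f (y ⊙ v ⊕ z ⊙ w) ≈ 0#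
          -- With z = 1 and y = a ζ / f v, the value of f is (a² / f v)(ζ² + ζ + f v f w / a²). The
          -- constant term lies in 𝔽q, so `artin-schreier` provides ζ in K.
          general fv≉0 = a * f v ⁻¹ * ζ , 1# , (λ (_ , 1≈0) → 1≉0 1≈0) ,
            trans (f-pair (a * f v ⁻¹ * ζ) 1# v w)
              (modulo (x≈y⇒x+y≈0 ζ²+ζ≈) (modulo (x≈y⇒x+y≈0 (*-inverseʳ fv≉0)) (modulo (x≈y⇒x+y≈0 (*-inverseʳ Bvw≉0))
                (solve 6 (λ a a⁻¹ t t⁻¹ s z →
                  (a :* t⁻¹ :* z) :* (a :* t⁻¹ :* z) :* t :+ con true :* con true :* s :+ con true :* (a :* t⁻¹ :* z) :* a
                  := con false
                    :+ a :* a :* t⁻¹ :* (z :* z :+ z :+ t :* s :* (a⁻¹ :* a⁻¹))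
                    :+ (a :* a :* z :* z :* t⁻¹ :+ a :* a :* a⁻¹ :* a⁻¹ :* s) :* (t :* t⁻¹ :+ con true)
                    :+ (a :* a⁻¹ :+ con true) :* s :* (a :* a⁻¹ :+ con true))
                  refl a (a ⁻¹) (f v) (f v ⁻¹) (f w) ζ))))
            where
            c₀ = f v * f w * (a ⁻¹ * a ⁻¹)
            a⁻¹∈ = 𝔽q-⁻¹ Bvw≉0 Bvw∈
            solution = artin-schreier (𝔽q-* (𝔽q-* (proj₂ lift-v) (proj₂ lift-w)) (𝔽q-* a⁻¹∈ a⁻¹∈))
            ζ = proj₁ solution
            ζ²+ζ≈ : ζ * ζ + ζ ≈ c₀
            ζ²+ζ≈ = proj₂ solution

        -- The isotropic vector s = y v + z w is orthogonal to r. Were r singular, s would be a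
        -- multiple of r and so orthogonal to v and w; but these products are z a and y a with a
        -- nonzero, forcing y = z = 0.
        fr≉0 : f r ≉ 0#
        fr≉0 fr≈0 = proj₁ (proj₂ (proj₂ isotropic-pair)) (y≈0 , z≈0)
          where
          y = proj₁ isotropic-pair
          z = proj₁ (proj₂ isotropic-pair)
          s = y ⊙ v ⊕ z ⊙ w
          Brs≈0 : B r s ≈ 0#
          Brs≈0 = trans (B-⊕ʳ r (y ⊙ v) (z ⊙ w)) (trans (+-cong
            (trans (B-⊙ʳ r y v) (trans (*-congˡ Brv≈0) (zeroʳ y)))
            (trans (B-⊙ʳ r z w) (trans (*-congˡ Brw≈0) (zeroʳ z)))) (+-identityˡ 0#))
          on-r : ∃[ k ] s ≋ k ⊙ r
          on-r = no-isotropic-lines r s fr≈0 (proj₂ (proj₂ (proj₂ isotropic-pair))) Brs≈0 r-nonzero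
          k = proj₁ on-r
          B-s : ∀ t → B r t ≈ 0# → y * B t v + z * B t w ≈ 0#
          B-s t Brt≈0 = begin
            y * B t v + z * B t w             ≈⟨ +-cong (B-⊙ʳ t y v) (B-⊙ʳ t z w) ⟨
            B t (y ⊙ v) + B t (z ⊙ w)         ≈⟨ B-⊕ʳ t (y ⊙ v) (z ⊙ w) ⟨
            B t s                             ≈⟨ B-congʳ t {s} {k ⊙ r} (proj₂ on-r) ⟩
            B t (k ⊙ r)                       ≈⟨ B-⊙ʳ t k r ⟩
            k * B t r                         ≈⟨ *-congˡ (trans (B-sym t r) Brt≈0) ⟩
            k * 0#                            ≈⟨ zeroʳ k ⟩
            0#                                ∎
          z≈0 : z ≈ 0#
          z≈0 = x≉0∧xy≈0⇒y≈0 Bvw≉0 (begin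
            a * z                       ≈⟨ solve 3 (λ y z a → a :* z := y :* con false :+ z :* a) refl y z a ⟩
            y * 0# + z * a              ≈⟨ +-congʳ (*-congˡ (B-self v)) ⟨
            y * B v v + z * a           ≈⟨ B-s v Brv≈0 ⟩
            0#                          ∎)
          y≈0 : y ≈ 0#
          y≈0 = x≉0∧xy≈0⇒y≈0 Bvw≉0 (begin
            a * y                       ≈⟨ solve 3 (λ y z a → a :* y := y :* a :+ z :* con false) refl y z a ⟩
            y * a + z * 0#              ≈⟨ +-cong (*-congˡ (B-sym w v)) (*-congˡ (B-self w)) ⟨
            y * B w v + z * B w w       ≈⟨ B-s w Brw≈0 ⟩
            0#                          ∎)

        nucleus-triple : IsotropicTriple r v w
        nucleus-triple = record
          { lift-u = lift-lin Bvw∈ Buw∈ Buv∈ ; lift-v = lift-v ; lift-w = lift-w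
          ; Buv∈ = 𝔽q-resp (sym Brv≈0) conj-0 ; Buw∈ = 𝔽q-resp (sym Brw≈0) conj-0 ; Bvw∈ = Bvw∈
          ; independent = λ {x} {y} {z} x∈ y∈ z∈ l≈0 →
              let xa≈0 , xb+y≈0 , xd+z≈0 = independent (𝔽q-* x∈ Bvw∈) (𝔽q-+ (𝔽q-* x∈ Buw∈) y∈)
                    (𝔽q-+ (𝔽q-* x∈ Buv∈) z∈) (λ i → trans
                      (sym (baer-cong {lin x y z r v w} {lin (x * a) (x * b + y) (x * d + z) u v w} (lin-r x y z) i))
                      (l≈0 i))
                  x≈0 = x≉0∧xy≈0⇒y≈0 Bvw≉0 (trans (*-comm a x) xa≈0)
              in x≈0 , cancel x≈0 xb+y≈0 , cancel x≈0 xd+z≈0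
          }
          where
          cancel : ∀ {x b y} → x ≈ 0# → x * b + y ≈ 0# → y ≈ 0#
          cancel x≈0 eq = trans (sym (+-identityˡ _)) (trans (+-congʳ (sym (trans (*-congʳ x≈0) (zeroˡ _)))) eq)

        size : Size (SingularSpan u v w) (q ℕ.+ 1)
        size = hasCardinality-⇔ pointSetoid (SingularSpan r v w) (SingularSpan u v w)
          (λ {P} → SingularSpan-⊆ {r} {v} {w} {u} {v} {w} (λ x y z → x * a , x * b + y , x * d + z)
            (λ x∈ y∈ z∈ → (𝔽q-* x∈ Bvw∈ , 𝔽q-+ (𝔽q-* x∈ Buw∈) y∈ , 𝔽q-+ (𝔽q-* x∈ Buv∈) z∈) , lin-r _ _ _) {P})
          (λ {P} → SingularSpan-⊆ {u} {v} {w} {r} {v} {w}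
            (λ x y z → x * a ⁻¹ , x * a ⁻¹ * b + y , x * a ⁻¹ * d + z)
            (λ x∈ y∈ z∈ → let x/a∈ = 𝔽q-* x∈ (𝔽q-⁻¹ Bvw≉0 Bvw∈) in
              (x/a∈ , 𝔽q-+ (𝔽q-* x/a∈ Buw∈) y∈ , 𝔽q-+ (𝔽q-* x/a∈ Buv∈) z∈) , lin-r⁻¹ _ _ _) {P})
          (nucleus-size nucleus-triple fr≉0 Brv≈0 Brw≈0)
          where
          lin-r⁻¹ : ∀ x y z → lin x y z u v w ≋ lin (x * a ⁻¹) (x * a ⁻¹ * b + y) (x * a ⁻¹ * d + z) r v w
          lin-r⁻¹ x y z i = sym (modulo (x≈y⇒x+y≈0 (*-inverseˡ Bvw≉0))
            (solve 10 (λ x y z a a⁻¹ b d u v w →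
              x :* a⁻¹ :* (a :* u :+ (b :* v :+ d :* w)) :+ ((x :* a⁻¹ :* b :+ y) :* v :+ (x :* a⁻¹ :* d :+ z) :* w)
              := x :* u :+ (y :* v :+ z :* w) :+ x :* u :* (a⁻¹ :* a :+ con true))
              refl x y z a (a ⁻¹) b d (u i) (v i) (w i)))

      u-nonzero : Nonzero u
      u-nonzero = case zero⊎nonzero u of λ where
        (inj₁ u≈0) → contradiction (proj₁ (independent conj-1 conj-0 conj-0 (baer-zero {lin 1# 0# 0# u v w} λ i →
          trans (+-congʳ (*-congˡ (u≈0 i)))
            (solve 2 (λ v w → con true :* con false :+ (con false :* v :+ con false :* w) := con false)
              refl (v i) (w i))))) 1≉0
        (inj₂ u≉0) → u≉0

      -- Otherwise u, v, w are proportional over K, which has dimension only 2 over 𝔽q.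
      not-all-singular : B u v ≈ 0# → B u w ≈ 0# → f u ≈ 0# → f v ≈ 0# → ¬ (f w ≈ 0#)
      not-all-singular Buv≈0 Buw≈0 fu≈0 fv≈0 fw≈0 = 1≉0 (proj₁ (proj₂ (independent k∈ conj-1 conj-0
          (baer-zero {lin k 1# 0# u v w} λ i → trans (+-congˡ (+-congʳ (*-congˡ (v≋ku i))))
            (solve 3 (λ k u w → k :* u :+ (con true :* (k :* u) :+ con false :* w) := con false)
              refl k (u i) (w i))))))
        where
        v-on-u = no-isotropic-lines u v fu≈0 fv≈0 Buv≈0 u-nonzero
        w-on-u = no-isotropic-lines u w fu≈0 fw≈0 Buw≈0 u-nonzero
        k l x : Carrier
        k = proj₁ v-on-u
        l = proj₁ w-on-u
        -- With v = k u and w = l u, this x in 𝔽q makes x u + Tr(l) v + Tr(k) w vanish. Independence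
        -- then gives Tr k = 0, so k is in 𝔽q, and k u + v = 0 is the contradiction.
        x = l * conj k + conj l * k
        v≋ku = proj₂ v-on-u
        w≋lu = proj₂ w-on-u
        x∈ : x ∈ 𝔽q
        x∈ = trans (conj-⟦⟧ (var 0F :* var 1F :+ var 2F :* var 3F)
            (refl ∷ conj-involutive k ∷ conj-involutive l ∷ refl ∷ []))
          (+-comm _ _)
        k∈ : k ∈ 𝔽q
        k∈ = Tr≈0⇒∈𝔽q (proj₂ (proj₂ (independent x∈ (Tr-∈𝔽q l) (Tr-∈𝔽q k)
          (baer-zero {lin x (Tr l) (Tr k) u v w} λ i → trans
            (+-congˡ (+-cong (*-congˡ (v≋ku i)) (*-congˡ (w≋lu i))))
            (solve 5 (λ k l k̄ l̄ u →
              (l :* k̄ :+ l̄ :* k) :* u :+ ((l :+ l̄) :* (k :* u) :+ (k :+ k̄) :* (l :* u)) := con false)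
              refl k l (conj k) (conj l) (u i))))))

    -- The triple is permuted so that a nonzero value of B sits on its last two vectors or, if B
    -- vanishes on all pairs, so that a nonsingular vector comes first.
    triple-size : ∀ {u v w} → IsotropicTriple u v w → Size (SingularSpan u v w) (q ℕ.+ 1)
    triple-size {u} {v} {w} triple = go (B v w ≟ 0#) (B u w ≟ 0#) (B u v ≟ 0#) (f u ≟ 0#) (f v ≟ 0#) (f w ≟ 0#)
      where
      go : Dec (B v w ≈ 0#) → Dec (B u w ≈ 0#) → Dec (B u v ≈ 0#) →
        Dec (f u ≈ 0#) → Dec (f v ≈ 0#) → Dec (f w ≈ 0#) → Size (SingularSpan u v w) (q ℕ.+ 1)
      go (no Bvw≉0) _ _ _ _ _ = Triple.Nucleus.size triple Bvw≉0
      go _ (no Buw≉0) _ _ _ _ = size-swap₁₂ {u} {v} {w} (Triple.Nucleus.size (triple-swap₁₂ triple) Buw≉0)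
      go _ _ (no Buv≉0) _ _ _ = size-swap₁₃ {u} {v} {w} (Triple.Nucleus.size (triple-swap₁₃ triple)
        (λ Bvu≈0 → Buv≉0 (trans (B-sym u v) Bvu≈0)))
      go (yes Bvw≈0) (yes Buw≈0) (yes Buv≈0) (no fu≉0) _ _ = nucleus-size triple fu≉0 Buv≈0 Buw≈0
      go (yes Bvw≈0) (yes Buw≈0) (yes Buv≈0) _ (no fv≉0) _ = size-swap₁₂ {u} {v} {w}
        (nucleus-size (triple-swap₁₂ triple) fv≉0 (trans (B-sym v u) Buv≈0) Bvw≈0)
      go (yes Bvw≈0) (yes Buw≈0) (yes Buv≈0) _ _ (no fw≉0) = size-swap₁₃ {u} {v} {w}
        (nucleus-size (triple-swap₁₃ triple) fw≉0 (trans (B-sym w v) Bvw≈0) (trans (B-sym w u) Buw≈0))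
      go (yes Bvw≈0) (yes Buw≈0) (yes Buv≈0) (yes fu≈0) (yes fv≈0) (yes fw≈0) =
        contradiction fw≈0 (Triple.not-all-singular triple Buv≈0 Buw≈0 fu≈0 fv≈0)

    -- Generators and their intersection with `𝒪 γ`.

    module _ (π : Plane) where
      open Plane π

      private
        basisLift : Fin 3 → Coords⁴
        basisLift i = proj₁ (lift (inBaer i))

        basisLift-Lift : ∀ i → Lift (basisLift i)
        basisLift-Lift i = proj₁ (proj₂ (lift (inBaer i)))

        baer-basisLift : ∀ i → baer (basisLift i) ≋ basis i
        baer-basisLift i = proj₂ (proj₂ (lift (inBaer i)))

        span : (Fin 3 → Carrier) → Coords⁴
        span t = lin (t 0F) (t 1F) (t 2F) (basisLift 0F) (basisLift 1F) (basisLift 2F)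

        baer-span : ∀ {t} → (∀ i → t i ∈ 𝔽q) → baer (span t) ≋ combination t basis
        baer-span {t} t∈ j = trans
          (baer-lin (t∈ 0F) (t∈ 1F) (t∈ 2F) (basisLift 0F) (basisLift 1F) (basisLift 2F) j)
          (+-cong (*-congˡ (baer-basisLift 0F j)) (+-cong (*-congˡ (baer-basisLift 1F j))
            (trans (*-congˡ (baer-basisLift 2F j)) (sym (+-identityʳ _)))))

      module _ (generator : IsGenerator π) where

        private
          vec3 : Carrier → Carrier → Carrier → Fin 3 → Carrier
          vec3 x y z = x Vector.∷ y Vector.∷ z Vector.∷ Vector.[]

          vec3-∈ : ∀ {x y z} → x ∈ 𝔽q → y ∈ 𝔽q → z ∈ 𝔽q → ∀ i → vec3 x y z i ∈ 𝔽q
          vec3-∈ x∈ y∈ z∈ 0F = x∈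
          vec3-∈ x∈ y∈ z∈ 1F = y∈
          vec3-∈ x∈ y∈ z∈ 2F = z∈

          span-independent : ∀ {x y z} → x ∈ 𝔽q → y ∈ 𝔽q → z ∈ 𝔽q →
            IsZero (baer (span (vec3 x y z))) → x ≈ 0# × y ≈ 0# × z ≈ 0#
          span-independent {x} {y} {z} x∈ y∈ z∈ l≈0 = t≈0 0F , t≈0 1F , t≈0 2F
            where t≈0 = independent (vec3 x y z) (vec3-∈ x∈ y∈ z∈)
                    (λ j → trans (sym (baer-span (vec3-∈ x∈ y∈ z∈) j)) (l≈0 j))

          unit : Fin 3 → Fin 3 → Carrier
          unit 0F = vec3 1# 0# 0#
          unit 1F = vec3 0# 1# 0#
          unit 2F = vec3 0# 0# 1#

          unit-∈ : ∀ i j → unit i j ∈ 𝔽q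
          unit-∈ 0F = vec3-∈ conj-1 conj-0 conj-0
          unit-∈ 1F = vec3-∈ conj-0 conj-1 conj-0
          unit-∈ 2F = vec3-∈ conj-0 conj-0 conj-1

          unit-diagonal : ∀ i → unit i i ≈ 1#
          unit-diagonal 0F = refl
          unit-diagonal 1F = refl
          unit-diagonal 2F = refl

          combination-unit : ∀ i j → combination (unit i) basis j ≈ basis i j
          combination-unit 0F j = solve 3 (λ x y z → con true :* x :+ (con false :* y :+ (con false :* z :+ con false))
            := x) refl (basis 0F j) (basis 1F j) (basis 2F j)
          combination-unit 1F j = solve 3 (λ x y z → con false :* x :+ (con true :* y :+ (con false :* z :+ con false))
            := y) refl (basis 0F j) (basis 1F j) (basis 2F j)
          combination-unit 2F j = solve 3 (λ x y z → con false :* x :+ (con false :* y :+ (con true :* z :+ con false))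
            := z) refl (basis 0F j) (basis 1F j) (basis 2F j)

          basis-nonzero : ∀ i → Nonzero (basis i)
          basis-nonzero i = case zero⊎nonzero (basis i) of λ where
            (inj₁ bᵢ≈0) → contradiction (trans (sym (unit-diagonal i))
              (independent (unit i) (unit-∈ i) (λ j → trans (combination-unit i j) (bᵢ≈0 j)) i)) 1≉0
            (inj₂ bᵢ≉0) → bᵢ≉0

          basisPoint : Fin 3 → Point
          basisPoint i = record
            { coords  = baer (basisLift i)
            ; nonzero = proj₁ (basis-nonzero i) ,
                λ eq → proj₂ (basis-nonzero i) (trans (sym (baer-basisLift i _)) eq) }

          basisPoint-∈ : ∀ i → basisPoint i ∈ pointsOf π
          basisPoint-∈ i = unit i , unit-∈ i , 1# , 1≉0 , λ j → trans (baer-basisLift i j)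
            (trans (sym (combination-unit i j)) (sym (*-identityˡ _)))

          -- By `h-baer`, orthogonality of two basis points says that the trace of B vanishes, and
          -- the elements of trace zero are those of 𝔽q.
          B-basis : ∀ i j → B (basisLift i) (basisLift j) ∈ 𝔽q
          B-basis i j = Tr≈0⇒∈𝔽q (trans
            (sym (h-baer (basisLift i) (basisLift j) (proj₁ (basisLift-Lift i)) (proj₁ (basisLift-Lift j))))
            (generator (basisPoint i) (basisPoint j) (basisPoint-∈ i) (basisPoint-∈ j)))

          basisTriple : IsotropicTriple (basisLift 0F) (basisLift 1F) (basisLift 2F)
          basisTriple = record
            { lift-u = basisLift-Lift 0F ; lift-v = basisLift-Lift 1F ; lift-w = basisLift-Lift 2F
            ; Buv∈ = B-basis 0F 1F ; Buw∈ = B-basis 0F 2F ; Bvw∈ = B-basis 1F 2F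
            ; independent = span-independent
            }
          open IsotropicTriple basisTriple using (lift-lin)

          Span : PointSet
          Span = SingularSpan (basisLift 0F) (basisLift 1F) (basisLift 2F)

          Span⊆ : Span ⊆ pointsOf π ∩ 𝒪 γ
          Span⊆ {P} (x , y , z , x∈ , y∈ , z∈ , fl≈0 , P∼l) =
            (vec3 x y z , vec3-∈ x∈ y∈ z∈ , ∼-≋ P∼l (baer-span (vec3-∈ x∈ y∈ z∈))) ,
            singular⇒𝒪 P (span (vec3 x y z)) (proj₁ (lift-lin x∈ y∈ z∈) , fl≈0) P∼l

          -- Such a point has two lifts: `span t`, normalised because the plane is isotropic, and a
          -- singular u, because the point is in `𝒪 γ`. Their images are proportional, so by
          -- uniqueness `span t` is a multiple of u and thus singular.
          ⊆Span : pointsOf π ∩ 𝒪 γ ⊆ Span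
          ⊆Span {P} ((t , t∈ , P∼t) , P∈𝒪) =
            t 0F , t 1F , t 2F , t∈ 0F , t∈ 1F , t∈ 2F ,
            trans (f-cong {span t} {k ⊙ u} l≋ku) (trans (f-⊙ k u) (trans (*-congˡ (proj₂ u-singular)) (zeroʳ _))) , P∼l
            where
            singular = 𝒪⇒singular P P∈𝒪
            u = proj₁ singular
            u-singular = proj₁ (proj₂ singular)
            P∼l : coords P ∼ baer (span t)
            P∼l = ∼-≋ P∼t (λ j → sym (baer-span t∈ j))
            l∼u : baer (span t) ∼ baer u
            l∼u = Setoid.trans pointSetoid {lPoint} {P} {uPoint}
              (Setoid.sym pointSetoid {P} {lPoint} P∼l) (proj₂ (proj₂ singular))
              where
              lPoint uPoint : Point
              lPoint = record { coords = baer (span t) ; nonzero = nonzero-∼ P P∼l }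
              uPoint = record { coords = baer u ; nonzero = nonzero-∼ P (proj₂ (proj₂ singular)) }
            k = proj₁ l∼u
            l≋ku : span t ≋ k ⊙ u
            l≋ku = proj₂ (lifts-proportional (span t) u (lift-lin (t∈ 0F) (t∈ 1F) (t∈ 2F))
              (singular⇒lift u u-singular) (nonzero-∼ P P∼l) (proj₂ (proj₂ l∼u))) (proj₂ u-singular)

        generator-size : Size (pointsOf π ∩ 𝒪 γ) (q ℕ.+ 1)
        generator-size = hasCardinality-⇔ pointSetoid Span (pointsOf π ∩ 𝒪 γ)
          (λ {P} → Span⊆ {P}) (λ {P} → ⊆Span {P}) (triple-size basisTriple)

    𝒪-isOvoid : IsOvoid (q ℕ.+ 1) (𝒪 γ)
    𝒪-isOvoid = (λ {P} → 𝒪⊆Baer {P}) , generator-size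
      where
      𝒪⊆Baer : 𝒪 γ ⊆ Baer
      𝒪⊆Baer {P} P∈𝒪 = let u , (u₃∈ , _) , P∼u = 𝒪⇒singular P P∈𝒪 in baer u , baer-∈ u u₃∈ , P∼u

mainTheorem18 : ∀ {c ℓ₁ ℓ₂ : Level} (q : ℕ) → IsPrimePower q → 2 ∣ q →
  (K : FiniteField c ℓ₁ ℓ₂ (q ℕ.^ 2)) →
  let open FiniteField K
      open Geometry q K in
  (ω : Carrier) → ¬ (ω ∈ 𝔽q) → ω + ω ^ q ≈ 1# →
  (γ : Carrier) → Irreducible (γ ∷ 1# ∷ 1# ∷ []) →
  let open Form ω in
  IsOvoid (q ℕ.+ 1) (𝒪 γ) × Size (𝒪 γ) ((q ℕ.+ 1) ℕ.* (q ℕ.^ 3 ℕ.+ 1))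
mainTheorem18 q q-primePower 2∣q K ω ω∉𝔽q ω+ω̄≈1 γ irreducible = 𝒪-isOvoid , 𝒪-size
  where
  open EvenSquareField q q-primePower 2∣q K using (Irreducible⇒rootless)
  open BaerGeometry.LiftedOvoid q q-primePower 2∣q K ω ω∉𝔽q ω+ω̄≈1 γ (Irreducible⇒rootless irreducible)
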